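{- Let $\overline{p}(n)$ denote the number of overpartitions of $n$. For every positive integer $r$, the sequence $\{\overline{p}(n)\}_{n\geq 1}$ is asymptotically $r$-log-concave, i.e. there exists $N$ such that the sequences $\hat{\mathscr{L}}\{\overline{p}(n)\}_{n\geq N},\ \hat{\mathscr{L}}^2\{\overline{p}(n)\}_{n\geq N},\ \ldots,\ \hat{\mathscr{L}}^r\{\overline{p}(n)\}_{n\geq N}$ all consist of non-negative terms.
   Context: An overpartition of a nonnegative integer $n$ is a partition of $n$ (a non-increasing sequence of positive integers summing to $n$) in which the first occurrence of each distinct part may be overlined; $\overline{p}(n)$ is the number of overpartitions of $n$ (with $\overline{p}(0)=1$). For a sequence $\{a_n\}_{n\geq 0}$, define $\hat{\mathscr{L}}\{a_n\}_{n\geq 0}=\{a_{n+1}^2-a_na_{n+2}\}_{n\geq 0}$ and $\hat{\mathscr{L}}^k\{a_n\}=\hat{\mathscr{L}}(\hat{\mathscr{L}}^{k-1}\{a_n\})$ (applied to a sequence indexed from $N$, the operator is applied after reindexing from $0$). -}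

module Defs where

open import Data.Nat using (ℕ; zero; suc; _+_; _*_; _∸_; _≤?_)
open import Data.Integer using (ℤ; +_; _-_) renaming (_*_ to _*ℤ_)
open import Relation.Nullary using (yes; no)

-- Overpartitions of n with all parts ≤ m.  An overpartition is determined by
-- choosing, for each part size k, a multiplicity c_k ≥ 0, and when c_k ≥ 1
-- whether its first occurrence is overlined (2 choices).
-- ovBounded m n counts overpartitions of n with parts in {1..m}.
-- Parts of size (suc m) with multiplicity c ≥ 1 contribute 2 choices each.
mutual
  ovBounded : ℕ → ℕ → ℕ
  ovBounded zero zero = 1
  ovBounded zero (suc n) = 0
  ovBounded (suc m) n = ovBounded m n + 2 * withPart m n n

  -- withPart m n f : Σ over c ≥ 1 with c * (suc m) ≤ n of ovBounded m (n ∸ c*(suc m)),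
  -- where f is fuel (c ranges over 1..f, fuel n suffices since c ≤ n).
  withPart : ℕ → ℕ → ℕ → ℕ
  withPart m n zero = 0
  withPart m n (suc f) with suc f * suc m ≤? n
  ... | yes _ = ovBounded m (n ∸ suc f * suc m) + withPart m n f
  ... | no  _ = withPart m n f

-- number of overpartitions of n (parts are at most n), with overpartition 0 = 1
overpartition : ℕ → ℕ
overpartition n = ovBounded n n

Lhat : (ℕ → ℤ) → (ℕ → ℤ)
Lhat a n = a (suc n) *ℤ a (suc n) - a n *ℤ a (suc (suc n))

Lhat^ : ℕ → (ℕ → ℤ) → (ℕ → ℤ)
Lhat^ zero a = a
Lhat^ (suc k) a = Lhat (Lhat^ k a)

overpartitionFrom : ℕ → ℕ → ℤ
overpartitionFrom N n = + overpartition (N + n)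

{-# OPTIONS --safe #-}
-- Write a(n) for the number of overpartitions of n. Logarithmic differentiation of Π (1 + qᵏ)/(1 - qᵏ) gives
-- n a(n) = Σ s(m) a(n - m) with 2m ≤ s(m) and Σ_{m ≤ X} s(m) ≤ 2X², so the weights s(m) a(n - m) / (n a(n)) form a
-- probability measure on jumps m, of typical size √n. The ratios v(n) = a(n+1)/a(n) are almost harmonic for the
-- resulting Markov chain, and differencing keeps this true up to commutator terms that are polynomial in lower
-- differences. The part 2m of the jump law is smooth, so chains started at distance O(√n) couple with positive
-- probability; together with the downward drift this shows that an almost harmonic function oscillates very little
-- over distance √n. By induction on j this yields Δʲ v = O(n^(-1/2-j)) for j ≥ 1, while v itself being almost
-- harmonic forces v(n) - v(n+1) ≥ c n^(-3/2). Hence u(n) = 1 - a(n) a(n+2)/a(n+1)² behaves like a symbol of order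
-- -3/2: it is at least c n^(-3/2) and each difference gains a factor 1/n. This property passes to the sequence L a,
-- whose corresponding function is 2u + O(u²) + O(n⁻²), and the theorem follows by iteration.
module Submission where

open import Defs

-- The divisor sums `s(m)` fluctuate: they are bounded below term by term, but above only on
-- average. Upper estimates therefore go through summation by parts, and coupling uses only the
-- smooth minorant `2m`, which still carries half of the mass. Coupling alone sees oscillation over
-- distance √n and cannot show that a difference gains a factor 1/n. The gain comes from
-- differencing the equation instead: the averages have mass n, so if the unnormalised generator of
-- `f` has size n^(-d/2), then `f` oscillates by n^(-d/2-1). Differencing reweights the jump law by
-- ratios of `v`, so the commutators contain `v` itself; they need only orders of regularity already
-- known, which closes the induction. Each bound for a difference read off in this way is half a
-- power of n short, and averaging over a window of length √n recovers it at the end. All estimates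
-- stay in ℚ: √n is replaced by an integer step function. It is too rough to be a symbol, so it
-- serves only in bounds and is never differenced.

module Overpartitions where

  open import Data.Bool using (Bool; true; false; not; if_then_else_)
  open import Data.Nat as ℕ using (ℕ; zero; suc; _∸_; z≤n; s≤s)
  import Data.Nat.Properties as ℕₚ
  open import Data.Nat.DivMod using (m≡m%n+[m/n]*n; m%n<n; m≥n⇒m/n>0)
  open import Data.Nat.Induction using (<-rec)
  import Data.Integer as ℤ
  import Data.Integer.Properties as ℤₚ
  import Data.Integer.Tactic.RingSolver as ℤ-Ring
  open import Data.Rational using (ℚ; 0ℚ; 1ℚ; mkℚ; _+_; _*_; _-_; -_; _≤_; _<_; _/_; ∣_∣; _≟_; _≤?_; toℚᵘ; nonNegative;
    positive; ≢-nonZero; 1/_)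
  open import Data.Rational.Properties using (≤-refl; ≤-trans; ≤-reflexive; ≤-total; <⇒≤; <-≤-trans; ≤-<-trans;
    <-irrefl; ≰⇒>; +-mono-≤; +-monoˡ-≤; +-monoʳ-≤; *-monoˡ-≤-nonNeg; *-monoʳ-≤-nonNeg; +-*-commutativeRing; *-inverseʳ;
    ∣p+q∣≤∣p∣+∣q∣; ∣p*q∣≡∣p∣*∣q∣; ∣-p∣≡∣p∣; 0≤∣p∣; 0≤p⇒∣p∣≡p; ∣p∣≡p∨∣p∣≡-p; +-identityˡ; +-identityʳ; *-identityˡ;
    *-identityʳ; *-zeroˡ; *-zeroʳ; *-comm; *-assoc; +-comm; +-assoc; *-distribˡ-+; *-distribʳ-+; positive⁻¹;
    pos*pos⇒pos; neg-antimono-≤; *-cancelˡ-≤-pos; toℚᵘ-injective; toℚᵘ-homo-+; toℚᵘ-homo-*; toℚᵘ-homo‿-; toℚᵘ-fromℚᵘ;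
    toℚᵘ-cancel-≤; toℚᵘ-mono-≤; module ≤-Reasoning)
  open import Data.Rational.Unnormalised as ℚᵘ using (mkℚᵘ; *≡*; *≤*)
  import Data.Rational.Unnormalised.Properties as ℚᵘₚ
  open import Data.Maybe.Base using (Maybe; just; nothing)
  open import Data.Product using (∃-syntax; _×_; _,_; proj₁; proj₂)
  open import Data.Sum using (inj₁; inj₂; [_,_]′)
  open import Data.Empty using (⊥-elim)
  open import Level using (0ℓ)
  open import Relation.Nullary using (yes; no)
  open import Relation.Binary.PropositionalEquality using (_≡_; refl; sym; trans; cong; cong₂; subst; subst₂; module ≡-Reasoning)
  open import Tactic.RingSolver using (solve-∀)
  import Tactic.RingSolver.Core.AlmostCommutativeRing as ACR

  -- Rational arithmetic

  isZero : (x : ℚ) → Maybe (0ℚ ≡ x)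
  isZero x with 0ℚ ≟ x
  ... | yes p = just p
  ... | no _ = nothing

  ringℚ : ACR.AlmostCommutativeRing 0ℓ 0ℓ
  ringℚ = ACR.fromCommutativeRing +-*-commutativeRing isZero

  2ℚ 4ℚ : ℚ
  2ℚ = 1ℚ + 1ℚ
  4ℚ = 2ℚ + 2ℚ

  0<1 : 0ℚ < 1ℚ
  0<1 = positive⁻¹ 1ℚ

  0≤1 : 0ℚ ≤ 1ℚ
  0≤1 = <⇒≤ 0<1

  +-nn : ∀ {p q} → 0ℚ ≤ p → 0ℚ ≤ q → 0ℚ ≤ p + q
  +-nn {p} {q} a b = ≤-trans (≤-reflexive (sym (+-identityˡ 0ℚ))) (+-mono-≤ a b)

  *-monoˡ : ∀ {r p q} → 0ℚ ≤ r → p ≤ q → r * p ≤ r * q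
  *-monoˡ {r} h = *-monoˡ-≤-nonNeg r {{nonNegative h}}

  *-monoʳ : ∀ {r p q} → 0ℚ ≤ r → p ≤ q → p * r ≤ q * r
  *-monoʳ {r} h = *-monoʳ-≤-nonNeg r {{nonNegative h}}

  *-nn : ∀ {p q} → 0ℚ ≤ p → 0ℚ ≤ q → 0ℚ ≤ p * q
  *-nn {p} {q} a b = ≤-trans (≤-reflexive (sym (*-zeroʳ p))) (*-monoˡ a b)

  *-pos : ∀ {p q} → 0ℚ < p → 0ℚ < q → 0ℚ < p * q
  *-pos {p} {q} a b = positive⁻¹ (p * q) {{pos*pos⇒pos p {{positive a}} q {{positive b}}}}

  *-mono : ∀ {p p′ q q′} → 0ℚ ≤ p → p ≤ p′ → 0ℚ ≤ q → q ≤ q′ → p * q ≤ p′ * q′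
  *-mono 0≤p p≤ 0≤q q≤ = ≤-trans (*-monoˡ 0≤p q≤) (*-monoʳ (≤-trans 0≤q q≤) p≤)

  -nn : ∀ {p q} → p ≤ q → 0ℚ ≤ q - p
  -nn {p} {q} h = ≤-trans (≤-reflexive (eq p)) (+-monoˡ-≤ (- p) h)
    where
    eq : ∀ x → 0ℚ ≡ x - x
    eq = solve-∀ ringℚ

  -- Most inequalities below are proved by exhibiting the difference as a visibly non-negative
  -- polynomial `d`; the identity is left to the ring solver.
  ≤-by : ∀ {p q d} → 0ℚ ≤ d → q - p ≡ d → p ≤ q
  ≤-by {p} {q} {d} h e = ≤-trans (≤-reflexive (sym (+-identityˡ p))) (≤-trans (+-monoˡ-≤ p (≤-trans h (≤-reflexive (sym e)))) (≤-reflexive (eq q p)))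
    where
    eq : ∀ x y → x - y + y ≡ x
    eq = solve-∀ ringℚ

  0≤2 : 0ℚ ≤ 2ℚ
  0≤2 = +-nn 0≤1 0≤1

  0≤4 : 0ℚ ≤ 4ℚ
  0≤4 = +-nn 0≤2 0≤2

  1≤⇒0≤ : ∀ {x} → 1ℚ ≤ x → 0ℚ ≤ x
  1≤⇒0≤ = ≤-trans 0≤1

  1≤⇒0< : ∀ {x} → 1ℚ ≤ x → 0ℚ < x
  1≤⇒0< = <-≤-trans 0<1

  p≤p+q : ∀ {p q} → 0ℚ ≤ q → p ≤ p + q
  p≤p+q {p} {q} h = ≤-by h (eq p q)
    where
    eq : ∀ x y → x + y - x ≡ y
    eq = solve-∀ ringℚ

  q≤p+q : ∀ {p q} → 0ℚ ≤ p → q ≤ p + q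
  q≤p+q {p} {q} h = ≤-by h (eq p q)
    where
    eq : ∀ x y → x + y - y ≡ x
    eq = solve-∀ ringℚ

  1*≤ : ∀ {x y} → 0ℚ ≤ y → 1ℚ ≤ x → y ≤ x * y
  1*≤ {x} {y} h k = ≤-trans (≤-reflexive (sym (*-identityˡ y))) (*-monoʳ h k)

  ≤*1 : ∀ {x y} → 0ℚ ≤ y → x ≤ 1ℚ → x * y ≤ y
  ≤*1 {x} {y} h k = ≤-trans (*-monoʳ h k) (≤-reflexive (*-identityˡ y))

  *-cancelˡ : ∀ {r p q} → 0ℚ < r → r * p ≤ r * q → p ≤ q
  *-cancelˡ {r} h = *-cancelˡ-≤-pos r {{positive h}}

  sq-cancel : ∀ {x y} → 0ℚ ≤ y → x * x ≤ y * y → x ≤ y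
  sq-cancel {x} {y} 0≤y h with x ≤? y
  ... | yes p = p
  ... | no ¬p = ⊥-elim (<-irrefl refl (<-≤-trans y*y<x*x h))
    where
    y<x : y < x
    y<x = ≰⇒> ¬p
    y*y<x*x : y * y < x * x
    y*y<x*x = ≤-<-trans (*-monoˡ 0≤y (<⇒≤ y<x)) (≰⇒> λ q → ¬p (*-cancelˡ (≤-<-trans 0≤y y<x) (≤-trans q (≤-reflexive (*-comm y x)))))

  abs≤ : ∀ {x c} → x ≤ c → - x ≤ c → ∣ x ∣ ≤ c
  abs≤ {x} h k with ∣p∣≡p∨∣p∣≡-p x
  ... | inj₁ e = ≤-trans (≤-reflexive e) h
  ... | inj₂ e = ≤-trans (≤-reflexive e) k

  ≤abs : ∀ x → x ≤ ∣ x ∣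
  ≤abs x with ≤-total 0ℚ x
  ... | inj₁ h = ≤-reflexive (sym (0≤p⇒∣p∣≡p h))
  ... | inj₂ h = ≤-trans h (0≤∣p∣ x)

  -≤abs : ∀ x → - x ≤ ∣ x ∣
  -≤abs x = ≤-trans (≤abs (- x)) (≤-reflexive (∣-p∣≡∣p∣ x))

  abs-swap : ∀ x y → ∣ x - y ∣ ≡ ∣ y - x ∣
  abs-swap x y = trans (sym (∣-p∣≡∣p∣ (x - y))) (cong ∣_∣ (eq x y))
    where
    eq : ∀ x y → - (x - y) ≡ y - x
    eq = solve-∀ ringℚ

  abs-sub : ∀ x y → ∣ x - y ∣ ≤ ∣ x ∣ + ∣ y ∣
  abs-sub x y = ≤-trans (∣p+q∣≤∣p∣+∣q∣ x (- y)) (≤-reflexive (cong (∣ x ∣ +_) (∣-p∣≡∣p∣ y)))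

  -- Total, with value `0ℚ` at `0ℚ`, so that no proof of non-vanishing enters a formula or a ring
  -- identity.
  inv : ℚ → ℚ
  inv p with p ≟ 0ℚ
  ... | yes _ = 0ℚ
  ... | no h = 1/_ p {{≢-nonZero h}}

  inv-r : ∀ {p} → 0ℚ < p → p * inv p ≡ 1ℚ
  inv-r {p} h with p ≟ 0ℚ
  ... | yes e = ⊥-elim (<-irrefl (sym e) h)
  ... | no e = *-inverseʳ p {{≢-nonZero e}}

  inv-nn : ∀ {p} → 0ℚ < p → 0ℚ ≤ inv p
  inv-nn {p} h = *-cancelˡ h (≤-trans (≤-reflexive (*-zeroʳ p)) (≤-trans 0≤1 (≤-reflexive (sym (inv-r h)))))

  inv-pos : ∀ {p} → 0ℚ < p → 0ℚ < inv p
  inv-pos {p} h = ≰⇒> λ k → <-irrefl refl (<-≤-trans 0<1 (≤-trans (≤-reflexive (sym (inv-r h))) (≤-trans (*-monoˡ (<⇒≤ h) k) (≤-reflexive (*-zeroʳ p)))))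

  inv-l : ∀ {p} → 0ℚ < p → inv p * p ≡ 1ℚ
  inv-l {p} h = trans (*-comm (inv p) p) (inv-r h)

  inv-antimono : ∀ {p q} → 0ℚ < p → p ≤ q → inv q ≤ inv p
  inv-antimono {p} {q} 0<p p≤q = *-cancelˡ 0<q (≤-trans (≤-reflexive (inv-r 0<q)) (≤-trans (≤-reflexive (sym (inv-r 0<p))) (*-monoʳ (inv-nn 0<p) p≤q)))
    where
    0<q : 0ℚ < q
    0<q = <-≤-trans 0<p p≤q

  -- Defined by recursion rather than through `fromℤ`, so that `ι (suc n)` unfolds to `ι n + 1ℚ` in
  -- ring identities.
  ι : ℕ → ℚ
  ι zero = 0ℚ
  ι (suc n) = ι n + 1ℚ

  ι-nn : ∀ n → 0ℚ ≤ ι n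
  ι-nn zero = ≤-refl
  ι-nn (suc n) = +-nn (ι-nn n) 0≤1

  1≤ι : ∀ n → 1ℚ ≤ ι (suc n)
  1≤ι n = q≤p+q (ι-nn n)

  ι-mono : ∀ {m n} → m ℕ.≤ n → ι m ≤ ι n
  ι-mono {n = n} z≤n = ι-nn n
  ι-mono (s≤s h) = +-monoˡ-≤ 1ℚ (ι-mono h)

  ι-+ : ∀ m n → ι (m ℕ.+ n) ≡ ι m + ι n
  ι-+ zero n = sym (+-identityˡ (ι n))
  ι-+ (suc m) n = trans (cong (_+ 1ℚ) (ι-+ m n)) (eq (ι m) (ι n))
    where
    eq : ∀ x y → x + y + 1ℚ ≡ x + 1ℚ + y
    eq = solve-∀ ringℚ

  ι-* : ∀ m n → ι (m ℕ.* n) ≡ ι m * ι n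
  ι-* zero n = sym (*-zeroˡ (ι n))
  ι-* (suc m) n = trans (ι-+ n (m ℕ.* n)) (trans (cong (ι n +_) (ι-* m n)) (eq (ι n) (ι m)))
    where
    eq : ∀ x y → x + y * x ≡ (y + 1ℚ) * x
    eq = solve-∀ ringℚ

  ι-∸ : ∀ {m n} → m ℕ.≤ n → ι (n ∸ m) ≡ ι n - ι m
  ι-∸ {m} {n} h = trans (eq (ι (n ∸ m)) (ι m)) (cong (_- ι m) (trans (sym (ι-+ (n ∸ m) m)) (cong ι (ℕₚ.m∸n+n≡m h))))
    where
    eq : ∀ x y → x ≡ x + y - y
    eq = solve-∀ ringℚ

  ι-reflect : ∀ {m n} → ι m ≤ ι n → m ℕ.≤ n
  ι-reflect {m} {n} h with m ℕ.≤? n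
  ... | yes p = p
  ... | no ¬p = ⊥-elim (<-irrefl refl (<-≤-trans 0<1 (≤-by (-nn (≤-trans (ι-mono (ℕₚ.≰⇒> ¬p)) h)) (eq (ι n)))))
    where
    eq : ∀ x → 0ℚ - 1ℚ ≡ x - (x + 1ℚ)
    eq = solve-∀ ringℚ

  -- Picks lengths that are a fixed fraction of `κ n`. Rounding down costs at most a factor 2, since
  -- `q ≤ x` makes the quotient at least 1.
  fraction : ∀ q x → 1 ℕ.≤ q → q ℕ.≤ x → ∃[ h ] (q ℕ.* h ℕ.≤ x × x ℕ.≤ (q ℕ.+ q) ℕ.* h)
  fraction (suc q) x _ q≤x = h , ℕₚ.≤-trans (ℕₚ.m≤n+m (suc q ℕ.* h) (x ℕ.% suc q)) (ℕₚ.≤-reflexive (sym e)) ,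
    ℕₚ.≤-trans (ℕₚ.≤-reflexive e) (ℕₚ.≤-trans (ℕₚ.+-monoˡ-≤ (suc q ℕ.* h) (ℕₚ.≤-trans (ℕₚ.<⇒≤ (m%n<n x (suc q))) (ℕₚ.≤-trans (ℕₚ.≤-reflexive (sym (ℕₚ.*-identityʳ (suc q)))) (ℕₚ.*-monoʳ-≤ (suc q) (m≥n⇒m/n>0 q≤x))))) (ℕₚ.≤-reflexive (sym (ℕₚ.*-distribʳ-+ h (suc q) (suc q)))))
    where
    h = x ℕ./ suc q
    e : x ≡ x ℕ.% suc q ℕ.+ suc q ℕ.* h
    e = trans (m≡m%n+[m/n]*n x (suc q)) (cong (x ℕ.% suc q ℕ.+_) (ℕₚ.*-comm h (suc q)))

  -- Powers and finite sums.

  infixr 8 _^_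
  _^_ : ℚ → ℕ → ℚ
  x ^ zero = 1ℚ
  x ^ suc n = x * x ^ n

  ^-nn : ∀ {x} → 0ℚ ≤ x → ∀ n → 0ℚ ≤ x ^ n
  ^-nn h zero = 0≤1
  ^-nn h (suc n) = *-nn h (^-nn h n)

  ^-pos : ∀ {x} → 0ℚ < x → ∀ n → 0ℚ < x ^ n
  ^-pos h zero = 0<1
  ^-pos h (suc n) = *-pos h (^-pos h n)

  ^-mono : ∀ {x y} → 0ℚ ≤ x → x ≤ y → ∀ n → x ^ n ≤ y ^ n
  ^-mono h k zero = ≤-refl
  ^-mono h k (suc n) = *-mono h k (^-nn h n) (^-mono h k n)

  1≤^ : ∀ {x} → 1ℚ ≤ x → ∀ n → 1ℚ ≤ x ^ n
  1≤^ h zero = ≤-refl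
  1≤^ h (suc n) = ≤-trans (1≤^ h n) (1*≤ (1≤⇒0≤ (1≤^ h n)) h)

  ^-+ : ∀ x m n → x ^ (m ℕ.+ n) ≡ x ^ m * x ^ n
  ^-+ x zero n = sym (*-identityˡ _)
  ^-+ x (suc m) n = trans (cong (x *_) (^-+ x m n)) (sym (*-assoc x (x ^ m) (x ^ n)))

  *-^ : ∀ x y n → (x * y) ^ n ≡ x ^ n * y ^ n
  *-^ x y zero = sym (*-identityˡ 1ℚ)
  *-^ x y (suc n) = trans (cong (x * y *_) (*-^ x y n)) (eq x y (x ^ n) (y ^ n))
    where
    eq : ∀ a b c d → a * b * (c * d) ≡ a * c * (b * d)
    eq = solve-∀ ringℚ

  1^ : ∀ n → 1ℚ ^ n ≡ 1ℚ
  1^ zero = refl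
  1^ (suc n) = trans (*-identityˡ _) (1^ n)

  ^-≤1 : ∀ {x} → 0ℚ ≤ x → x ≤ 1ℚ → ∀ n → x ^ n ≤ 1ℚ
  ^-≤1 h k n = ≤-trans (^-mono h k n) (≤-reflexive (1^ n))

  ^-exp : ∀ {x} → 1ℚ ≤ x → ∀ {m n} → m ℕ.≤ n → x ^ m ≤ x ^ n
  ^-exp h {n = n} z≤n = 1≤^ h n
  ^-exp h (s≤s k) = *-monoˡ (1≤⇒0≤ h) (^-exp h k)

  -- The mean value inequality for powers; increments of degree `suc n` drop to degree `n`.
  ^-diff : ∀ {x y} → 0ℚ ≤ y → y ≤ x → ∀ n → x ^ suc n - y ^ suc n ≤ ι (suc n) * (x - y) * x ^ n
  ^-diff {x} {y} 0≤y y≤x zero = ≤-reflexive (eq x y)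
    where
    eq : ∀ x y → x * 1ℚ - y * 1ℚ ≡ (0ℚ + 1ℚ) * (x - y) * 1ℚ
    eq = solve-∀ ringℚ
  ^-diff {x} {y} 0≤y y≤x (suc n) = ≤-by (+-nn (*-nn (-nn (^-diff 0≤y y≤x n)) 0≤x) (*-nn (-nn y≤x) (-nn (^-mono 0≤y y≤x (suc n))))) (eq x y (x ^ n) (y ^ n) (ι n))
    where
    0≤x : 0ℚ ≤ x
    0≤x = ≤-trans 0≤y y≤x
    eq : ∀ x y p q i → (i + 1ℚ + 1ℚ) * (x - y) * (x * p) - (x * (x * p) - y * (y * q))
       ≡ ((i + 1ℚ) * (x - y) * p - (x * p - y * q)) * x + (x - y) * (x * p - y * q)
    eq = solve-∀ ringℚ

  sum : ℕ → (ℕ → ℚ) → ℚ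
  sum zero f = 0ℚ
  sum (suc n) f = sum n f + f n

  sum-cong : ∀ n {f h} → (∀ i → i ℕ.< n → f i ≡ h i) → sum n f ≡ sum n h
  sum-cong zero e = refl
  sum-cong (suc n) e = cong₂ _+_ (sum-cong n λ i i<n → e i (ℕₚ.m<n⇒m<1+n i<n)) (e n ℕₚ.≤-refl)

  sum-mono : ∀ n {f h} → (∀ i → i ℕ.< n → f i ≤ h i) → sum n f ≤ sum n h
  sum-mono zero e = ≤-refl
  sum-mono (suc n) e = +-mono-≤ (sum-mono n λ i i<n → e i (ℕₚ.m<n⇒m<1+n i<n)) (e n ℕₚ.≤-refl)

  sum-+ : ∀ n f h → sum n (λ i → f i + h i) ≡ sum n f + sum n h
  sum-+ zero f h = sym (+-identityˡ 0ℚ)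
  sum-+ (suc n) f h = trans (cong (_+ (f n + h n)) (sum-+ n f h)) (eq (sum n f) (sum n h) (f n) (h n))
    where
    eq : ∀ a b c d → a + b + (c + d) ≡ a + c + (b + d)
    eq = solve-∀ ringℚ

  sum-*ˡ : ∀ n c f → sum n (λ i → c * f i) ≡ c * sum n f
  sum-*ˡ zero c f = sym (*-zeroʳ c)
  sum-*ˡ (suc n) c f = trans (cong (_+ c * f n) (sum-*ˡ n c f)) (sym (*-distribˡ-+ c _ _))

  sum-nn : ∀ n {f} → (∀ i → i ℕ.< n → 0ℚ ≤ f i) → 0ℚ ≤ sum n f
  sum-nn zero e = ≤-refl
  sum-nn (suc n) e = +-nn (sum-nn n λ i i<n → e i (ℕₚ.m<n⇒m<1+n i<n)) (e n ℕₚ.≤-refl)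

  sum-abs : ∀ n f → ∣ sum n f ∣ ≤ sum n (λ i → ∣ f i ∣)
  sum-abs zero f = ≤-refl
  sum-abs (suc n) f = ≤-trans (∣p+q∣≤∣p∣+∣q∣ (sum n f) (f n)) (+-monoˡ-≤ ∣ f n ∣ (sum-abs n f))

  sum-head : ∀ n f → sum (suc n) f ≡ f 0 + sum n (λ i → f (suc i))
  sum-head zero f = trans (+-identityˡ (f 0)) (sym (+-identityʳ (f 0)))
  sum-head (suc n) f = trans (cong (_+ f (suc n)) (sum-head n f)) (+-assoc (f 0) _ (f (suc n)))

  sum-split : ∀ m n f → sum (m ℕ.+ n) f ≡ sum m f + sum n (λ i → f (m ℕ.+ i))
  sum-split zero n f = sym (+-identityˡ _)
  sum-split (suc m) n f = trans (sum-head (m ℕ.+ n) f) (trans (cong (f 0 +_) (sum-split m n (λ i → f (suc i))))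
    (trans (sym (+-assoc (f 0) _ _)) (cong (_+ sum n (λ i → f (suc (m ℕ.+ i)))) (sym (sum-head m f)))))

  sum-term : ∀ n f → (∀ i → i ℕ.< n → 0ℚ ≤ f i) → ∀ i → i ℕ.< n → f i ≤ sum n f
  sum-term (suc n) f h i i<1+n with ℕₚ.m<1+n⇒m<n∨m≡n i<1+n
  ... | inj₁ i<n = ≤-trans (sum-term n f (λ j j<n → h j (ℕₚ.m<n⇒m<1+n j<n)) i i<n) (p≤p+q (h n ℕₚ.≤-refl))
  ... | inj₂ refl = q≤p+q (sum-nn n λ j j<n → h j (ℕₚ.m<n⇒m<1+n j<n))

  sum-const : ∀ n c → sum n (λ _ → c) ≡ ι n * c
  sum-const zero c = sym (*-zeroˡ c)
  sum-const (suc n) c = trans (cong (_+ c) (sum-const n c)) (eq (ι n) c)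
    where
    eq : ∀ x y → x * y + y ≡ (x + 1ℚ) * y
    eq = solve-∀ ringℚ

  -- Integers inside ℚ and the archimedean property.

  fromℤ : ℤ.ℤ → ℚ
  fromℤ i = i / 1

  toℚᵘ-fromℤ : ∀ i → toℚᵘ (fromℤ i) ℚᵘ.≃ mkℚᵘ i 0
  toℚᵘ-fromℤ i = toℚᵘ-fromℚᵘ (mkℚᵘ i 0)

  fromℤ-+ : ∀ i j → fromℤ (i ℤ.+ j) ≡ fromℤ i + fromℤ j
  fromℤ-+ i j = toℚᵘ-injective (ℚᵘₚ.≃-trans (toℚᵘ-fromℤ (i ℤ.+ j)) (ℚᵘₚ.≃-trans (*≡* (eq i j)) (ℚᵘₚ.≃-sym (ℚᵘₚ.≃-trans (toℚᵘ-homo-+ (fromℤ i) (fromℤ j)) (ℚᵘₚ.+-cong (toℚᵘ-fromℤ i) (toℚᵘ-fromℤ j))))))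
    where
    eq : ∀ i j → (i ℤ.+ j) ℤ.* ℤ.+ 1 ≡ (i ℤ.* ℤ.+ 1 ℤ.+ j ℤ.* ℤ.+ 1) ℤ.* ℤ.+ 1
    eq = ℤ-Ring.solve-∀

  fromℤ-* : ∀ i j → fromℤ (i ℤ.* j) ≡ fromℤ i * fromℤ j
  fromℤ-* i j = toℚᵘ-injective (ℚᵘₚ.≃-trans (toℚᵘ-fromℤ (i ℤ.* j)) (ℚᵘₚ.≃-sym (ℚᵘₚ.≃-trans (toℚᵘ-homo-* (fromℤ i) (fromℤ j)) (ℚᵘₚ.≃-trans (ℚᵘₚ.*-cong (toℚᵘ-fromℤ i) (toℚᵘ-fromℤ j)) (*≡* refl)))))

  fromℤ-neg : ∀ i → fromℤ (ℤ.- i) ≡ - fromℤ i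
  fromℤ-neg i = toℚᵘ-injective (ℚᵘₚ.≃-trans (toℚᵘ-fromℤ (ℤ.- i)) (ℚᵘₚ.≃-sym (ℚᵘₚ.≃-trans (toℚᵘ-homo‿- (fromℤ i)) (ℚᵘₚ.-‿cong (toℚᵘ-fromℤ i)))))

  fromℤ-nn : ∀ i → 0ℚ ≤ fromℤ i → ℤ.+ 0 ℤ.≤ i
  fromℤ-nn i h with ℚᵘₚ.≤-respʳ-≃ (toℚᵘ-fromℤ i) (toℚᵘ-mono-≤ h)
  ... | *≤* le = subst₂ ℤ._≤_ refl (ℤₚ.*-identityʳ i) le

  ι≡fromℤ : ∀ n → ι n ≡ fromℤ (ℤ.+ n)
  ι≡fromℤ zero = refl
  ι≡fromℤ (suc n) = trans (cong (_+ 1ℚ) (ι≡fromℤ n)) (trans (sym (fromℤ-+ (ℤ.+ n) (ℤ.+ 1))) (cong (λ z → fromℤ (ℤ.+ z)) (ℕₚ.+-comm n 1)))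

  archimedean : ∀ x → ∃[ N ] x ≤ ι N
  archimedean x@(mkℚ n d _) = N , ≤-trans (toℚᵘ-cancel-≤ (ℚᵘₚ.≤-respʳ-≃ (ℚᵘₚ.≃-sym (toℚᵘ-fromℤ (ℤ.+ N))) (*≤* le))) (≤-reflexive (sym (ι≡fromℤ N)))
    where
    N = ℤ.∣ n ∣
    i≤∣i∣ : ∀ i → i ℤ.≤ ℤ.+ ℤ.∣ i ∣
    i≤∣i∣ (ℤ.+ m) = ℤₚ.≤-refl
    i≤∣i∣ ℤ.-[1+ m ] = ℤ.-≤+
    le : n ℤ.* ℤ.+ 1 ℤ.≤ ℤ.+ N ℤ.* ℤ.+ suc d
    le = ℤₚ.≤-trans (ℤₚ.≤-reflexive (ℤₚ.*-identityʳ n)) (ℤₚ.≤-trans (i≤∣i∣ n) (ℤₚ.≤-trans (ℤ.+≤+ (ℕₚ.m≤m*n N (suc d))) (ℤₚ.≤-reflexive (ℤₚ.pos-* N (suc d)))))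

  -- Symbol classes

  Δ : (ℕ → ℚ) → ℕ → ℚ
  Δ f n = f (suc n) - f n

  -- The bound is required for all `n`, not eventually; statements about large `n` are obtained by
  -- shifting the sequence.
  Bd : (ℕ → ℚ) → (ℕ → ℚ) → Set
  Bd w f = ∃[ C ] (0ℚ ≤ C × (∀ n → ∣ f n ∣ ≤ C * w n))

  Bd-weaken : ∀ {w w′ f} → (∀ n → w n ≤ w′ n) → Bd w f → Bd w′ f
  Bd-weaken h (C , 0≤C , b) = C , 0≤C , λ n → ≤-trans (b n) (*-monoˡ 0≤C (h n))

  Bd-cong : ∀ {w f h} → (∀ n → f n ≡ h n) → Bd w f → Bd w h
  Bd-cong e (C , 0≤C , b) = C , 0≤C , λ n → ≤-trans (≤-reflexive (cong ∣_∣ (sym (e n)))) (b n)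

  Bd-+ : ∀ {w f h} → Bd w f → Bd w h → Bd w (λ n → f n + h n)
  Bd-+ {w} {f} {h} (C , 0≤C , b) (C′ , 0≤C′ , b′) = C + C′ , +-nn 0≤C 0≤C′ , λ n →
    ≤-trans (∣p+q∣≤∣p∣+∣q∣ (f n) (h n)) (≤-trans (+-mono-≤ (b n) (b′ n)) (≤-reflexive (sym (*-distribʳ-+ (w n) C C′))))

  Bd-* : ∀ {w w′ f h} → Bd w f → Bd w′ h → Bd (λ n → w n * w′ n) (λ n → f n * h n)
  Bd-* {w} {w′} {f} {h} (C , 0≤C , b) (C′ , 0≤C′ , b′) = C * C′ , *-nn 0≤C 0≤C′ , λ n →
    ≤-trans (≤-reflexive (∣p*q∣≡∣p∣*∣q∣ (f n) (h n))) (≤-trans (*-mono (0≤∣p∣ (f n)) (b n) (0≤∣p∣ (h n)) (b′ n)) (≤-reflexive (eq C (w n) C′ (w′ n))))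
    where
    eq : ∀ a b c d → a * b * (c * d) ≡ a * c * (b * d)
    eq = solve-∀ ringℚ

  Bd-neg : ∀ {w f} → Bd w f → Bd w (λ n → - f n)
  Bd-neg {f = f} (C , 0≤C , b) = C , 0≤C , λ n → ≤-trans (≤-reflexive (∣-p∣≡∣p∣ (f n))) (b n)

  module Symbols (step : ℕ → ℚ) (0≤step : ∀ n → 0ℚ ≤ step n) (step≤1 : ∀ n → step n ≤ 1ℚ) where

    -- A discrete symbol class: every difference gains a factor `step`. The order `J` is finite
    -- because regularity is built up one difference at a time, and because a shift uses up one
    -- order.
    Sym : ℕ → (ℕ → ℚ) → (ℕ → ℚ) → Set
    Sym zero w f = Bd w f
    Sym (suc J) w f = Bd w f × Sym J (λ n → step n * w n) (Δ f)

    Sym-down : ∀ J {w f} → Sym (suc J) w f → Sym J w f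
    Sym-down zero (b , _) = b
    Sym-down (suc J) (b , s) = b , Sym-down J s

    Sym-weaken : ∀ J {w w′ f} → (∀ n → w n ≤ w′ n) → Sym J w f → Sym J w′ f
    Sym-weaken zero h b = Bd-weaken h b
    Sym-weaken (suc J) h (b , s) = Bd-weaken h b , Sym-weaken J (λ n → *-monoˡ (0≤step n) (h n)) s

    Sym-cong : ∀ J {w f h} → (∀ n → f n ≡ h n) → Sym J w f → Sym J w h
    Sym-cong zero e b = Bd-cong e b
    Sym-cong (suc J) e (b , s) = Bd-cong e b , Sym-cong J (λ n → cong₂ _-_ (e (suc n)) (e n)) s

    Sym-+ : ∀ J {w f h} → Sym J w f → Sym J w h → Sym J w (λ n → f n + h n)
    Sym-+ zero b b′ = Bd-+ b b′
    Sym-+ (suc J) {f = f} {h} (b , s) (b′ , s′) = Bd-+ b b′ , Sym-cong J (λ n → eq (f (suc n)) (f n) (h (suc n)) (h n)) (Sym-+ J s s′)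
      where
      eq : ∀ a b c d → a - b + (c - d) ≡ a + c - (b + d)
      eq = solve-∀ ringℚ

    Sym-neg : ∀ J {w f} → Sym J w f → Sym J w (λ n → - f n)
    Sym-neg zero b = Bd-neg b
    Sym-neg (suc J) {f = f} (b , s) = Bd-neg b , Sym-cong J (λ n → eq (f (suc n)) (f n)) (Sym-neg J s)
      where
      eq : ∀ a b → - (a - b) ≡ - a - (- b)
      eq = solve-∀ ringℚ

    Sym-sub : ∀ J {w f h} → Sym J w f → Sym J w h → Sym J w (λ n → f n - h n)
    Sym-sub J s s′ = Sym-+ J s (Sym-neg J s′)

    Sym-shift : ∀ J {w f} → (∀ n → 0ℚ ≤ w n) → Sym (suc J) w f → Sym J w (λ n → f (suc n))
    Sym-shift J {w} {f} 0≤w s = Sym-cong J (λ n → eq (f n) (f (suc n))) (Sym-+ J (Sym-down J s) (Sym-weaken J (λ n → ≤*1 (0≤w n) (step≤1 n)) (proj₂ s)))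
      where
      eq : ∀ a b → a + (b - a) ≡ b
      eq = solve-∀ ringℚ

    -- The discrete Leibniz rule contains the shifted factor `h (suc n)`, which costs one order of
    -- `h`. That order is available, since only `J` of the `suc J` orders are needed after the
    -- difference.
    Sym-* : ∀ J {w w′ f h} → (∀ n → 0ℚ ≤ w n) → (∀ n → 0ℚ ≤ w′ n) → Sym J w f → Sym J w′ h → Sym J (λ n → w n * w′ n) (λ n → f n * h n)
    Sym-* zero _ _ b b′ = Bd-* b b′
    Sym-* (suc J) {w} {w′} {f} {h} 0≤w 0≤w′ s s′ = Bd-* (proj₁ s) (proj₁ s′) ,
      Sym-cong J (λ n → eq (f n) (f (suc n)) (h n) (h (suc n)))
        (Sym-+ J (Sym-weaken J (λ n → ≤-reflexive (*-assoc (step n) (w n) (w′ n))) (Sym-* J (λ n → *-nn (0≤step n) (0≤w n)) 0≤w′ (proj₂ s) (Sym-shift J 0≤w′ s′)))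
                 (Sym-weaken J (λ n → ≤-reflexive (eq′ (w n) (step n) (w′ n))) (Sym-* J 0≤w (λ n → *-nn (0≤step n) (0≤w′ n)) (Sym-down J s) (proj₂ s′))))
      where
      eq : ∀ a b c d → (b - a) * d + a * (d - c) ≡ b * d - a * c
      eq = solve-∀ ringℚ
      eq′ : ∀ a b c → a * (b * c) ≡ b * (a * c)
      eq′ = solve-∀ ringℚ

    -- Δ(1/f) = - Δf · (1/f) · (1/Ef), where the last factor is again a reciprocal of a symbol.
    Sym-inv : ∀ J {w f} → (∀ n → 0ℚ < w n) → (∃[ D ] (0ℚ ≤ D × (∀ n → w n ≤ D * w (suc n)))) → (∀ n → 0ℚ < f n) → (∃[ C ] (0ℚ ≤ C × (∀ n → w n ≤ C * f n))) →
      Sym J w f → Sym J (λ n → inv (w n)) (λ n → inv (f n))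
    Sym-inv J {w} {f} 0<w (D , 0≤D , wD) 0<f (C , 0≤C , wf) s = go J s
      where
      bd : Bd (λ n → inv (w n)) (λ n → inv (f n))
      bd = C , 0≤C , λ n → ≤-trans (≤-reflexive (0≤p⇒∣p∣≡p (inv-nn (0<f n)))) (begin
        inv (f n) ≡⟨ sym (trans (cong (inv (f n) *_) (inv-r (0<w n))) (*-identityʳ _)) ⟩
        inv (f n) * (w n * inv (w n)) ≤⟨ *-monoˡ (inv-nn (0<f n)) (*-monoʳ (inv-nn (0<w n)) (wf n)) ⟩
        inv (f n) * (C * f n * inv (w n)) ≡⟨ eq (inv (f n)) C (f n) (inv (w n)) ⟩
        f n * inv (f n) * (C * inv (w n)) ≡⟨ trans (cong (_* (C * inv (w n))) (inv-r (0<f n))) (*-identityˡ _) ⟩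
        C * inv (w n) ∎)
        where
        open ≤-Reasoning
        eq : ∀ a b c d → a * (b * c * d) ≡ c * a * (b * d)
        eq = solve-∀ ringℚ
      go : ∀ J → Sym J w f → Sym J (λ n → inv (w n)) (λ n → inv (f n))
      go zero _ = bd
      go (suc J) s = bd , Sym-cong J eqΔ (Sym-weaken J wt≤ (Sym-* J (λ n → *-nn (*-nn (0≤step n) (<⇒≤ (0<w n))) (0≤iw n)) 0≤iw
          (Sym-* J (λ n → *-nn (0≤step n) (<⇒≤ (0<w n))) 0≤iw (Sym-neg J (proj₂ s)) (go J (Sym-down J s)))
          -- The shifted function is compared with the unshifted weight through
          -- `w n ≤ D * w (suc n)`, which is why `D` enters.
          (Sym-inv J {w} {λ n → f (suc n)} 0<w (D , 0≤D , wD) (λ n → 0<f (suc n)) (D * C , *-nn 0≤D 0≤C , λ n → ≤-trans (wD n) (≤-trans (*-monoˡ 0≤D (wf (suc n))) (≤-reflexive (sym (*-assoc D C (f (suc n))))))) (Sym-shift J (λ n → <⇒≤ (0<w n)) s))))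
        where
        0≤iw : ∀ n → 0ℚ ≤ inv (w n)
        0≤iw n = inv-nn (0<w n)
        wt≤ : ∀ n → step n * w n * inv (w n) * inv (w n) ≤ step n * inv (w n)
        wt≤ n = ≤-reflexive (cong (_* inv (w n)) (trans (*-assoc (step n) (w n) (inv (w n))) (trans (cong (step n *_) (inv-r (0<w n))) (*-identityʳ (step n)))))
        eqΔ : ∀ n → - (f (suc n) - f n) * inv (f n) * inv (f (suc n)) ≡ inv (f (suc n)) - inv (f n)
        eqΔ n = trans (eq₁ (f (suc n)) (f n) (inv (f n)) (inv (f (suc n)))) (trans (cong₂ (λ x y → inv (f (suc n)) * x - inv (f n) * y) (inv-r (0<f n)) (inv-r (0<f (suc n)))) (cong₂ _-_ (*-identityʳ (inv (f (suc n)))) (*-identityʳ (inv (f n)))))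
          where
          eq₁ : ∀ b a x y → - (b - a) * x * y ≡ y * (a * x) - x * (b * y)
          eq₁ = solve-∀ ringℚ

  -- Iterating the log-concavity operator

  -- `small` says that `w` tends to 0 and that `step²` is of lower order than `w`. With `step` about
  -- 1/n and `w` about n^(-3/2), the errors of one iteration are then eventually dominated by its
  -- main term.
  record Scale : Set where
    field
      step w : ℕ → ℚ
      0≤step : ∀ n → 0ℚ ≤ step n
      step≤1 : ∀ n → step n ≤ 1ℚ
      0<w : ∀ n → 0ℚ < w n
      D : ℚ
      0≤D : 0ℚ ≤ D
      w-suc : ∀ n → w n ≤ D * w (suc n)
      small : ∀ x → ∃[ N ] (∀ n → N ℕ.≤ n → x * w n ≤ 1ℚ × x * (step n * step n) ≤ w n)

  shiftScale : ℕ → Scale → Scale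
  shiftScale N S = record
    { step = λ n → step (n ℕ.+ N) ; w = λ n → w (n ℕ.+ N) ; 0≤step = λ n → 0≤step (n ℕ.+ N) ; step≤1 = λ n → step≤1 (n ℕ.+ N)
    ; 0<w = λ n → 0<w (n ℕ.+ N) ; D = D ; 0≤D = 0≤D ; w-suc = λ n → w-suc (n ℕ.+ N)
    ; small = λ x → proj₁ (small x) , λ n N≤n → proj₂ (small x) (n ℕ.+ N) (ℕₚ.≤-trans N≤n (ℕₚ.m≤m+n n N)) }
    where open Scale S

  module _ (S : Scale) where
    open Scale S
    open Symbols step 0≤step step≤1

    SymOn : ℕ → (ℕ → ℚ) → (ℕ → ℚ) → Set
    SymOn = Sym

    -- The analogue of an elliptic symbol: `w` bounds `u` from both sides, so that `inv ∘ u` is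
    -- again a symbol.
    record Regular (u : ℕ → ℚ) : Set where
      field
        C : ℚ
        0≤C : 0ℚ ≤ C
        w≤Cu : ∀ n → w n ≤ C * u n
        sym-u : ∀ J → Sym J w u

    regular-pos : ∀ {u} → Regular u → ∀ n → 0ℚ < u n
    regular-pos {u} ru n = ≰⇒> λ u≤0 → <-irrefl refl (<-≤-trans (0<w n) (≤-trans (w≤Cu n) (≤-trans (*-monoˡ 0≤C u≤0) (≤-reflexive (*-zeroʳ C)))))
      where open Regular ru

  shiftSym : ∀ N S J {w f} → SymOn S J w f → SymOn (shiftScale N S) J (λ n → w (n ℕ.+ N)) (λ n → f (n ℕ.+ N))
  shiftSym N S zero (C , 0≤C , b) = C , 0≤C , λ n → b (n ℕ.+ N)
  shiftSym N S (suc J) ((C , 0≤C , b) , s) = (C , 0≤C , λ n → b (n ℕ.+ N)) , shiftSym N S J s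

  shiftRegular : ∀ N S {u} → Regular S u → Regular (shiftScale N S) (λ n → u (n ℕ.+ N))
  shiftRegular N S ru = record { C = C ; 0≤C = 0≤C ; w≤Cu = λ n → w≤Cu (n ℕ.+ N) ; sym-u = λ J → shiftSym N S J (sym-u J) }
    where open Regular ru

  -- `curvature u n` is `u n * u (n + 2) - u (n + 1)²`, written in differences so that its size
  -- `step² w²` can be read off. Relative to `u (n + 1)²` it becomes `η`, of size `step²`.
  curvature η next : (ℕ → ℚ) → ℕ → ℚ
  curvature u n = u n * Δ (Δ u) n - Δ u n * Δ u n
  η u n = curvature u n * (inv (u (suc n)) * inv (u (suc n)))
  -- If 1 - u = b(n) b(n+2) / b(n+1)², then 1 - next u is the same ratio for the sequence Lℚ b.
  next u n = 2ℚ * u (suc n) - u (suc n) * u (suc n) - η u n * ((1ℚ - u (suc n)) * (1ℚ - u (suc n)))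

  module Next (S : Scale) (u : ℕ → ℚ) (ru : Regular S u) where
    open Scale S
    open Symbols step 0≤step step≤1
    open Regular ru

    0<u : ∀ n → 0ℚ < u n
    0<u = regular-pos S ru

    0≤w : ∀ n → 0ℚ ≤ w n
    0≤w n = <⇒≤ (0<w n)

    step² : ℕ → ℚ
    step² n = step n * step n

    0≤step² : ∀ n → 0ℚ ≤ step² n
    0≤step² n = *-nn (0≤step n) (0≤step n)

    u₁-sym : ∀ J → Sym J w (λ n → u (suc n))
    u₁-sym J = Sym-shift J 0≤w (sym-u (suc J))

    w≤DCu₁ : ∀ n → w n ≤ D * C * u (suc n)
    w≤DCu₁ n = ≤-trans (w-suc n) (≤-trans (*-monoˡ 0≤D (w≤Cu (suc n))) (≤-reflexive (sym (*-assoc D C (u (suc n))))))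

    iu-sym : ∀ J → Sym J (λ n → inv (w n)) (λ n → inv (u (suc n)))
    iu-sym J = Sym-inv J 0<w (D , 0≤D , w-suc) (λ n → 0<u (suc n)) (D * C , *-nn 0≤D 0≤C , w≤DCu₁) (u₁-sym J)

    curvature-sym : ∀ J → Sym J (λ n → step² n * (w n * w n)) (curvature u)
    curvature-sym J = Sym-sub J
      (Sym-weaken J (λ n → ≤-reflexive (eq₁ (w n) (step n))) (Sym-* J 0≤w (λ n → *-nn (0≤step n) (*-nn (0≤step n) (0≤w n))) (sym-u J) (proj₂ (proj₂ (sym-u (suc (suc J)))))))
      (Sym-weaken J (λ n → ≤-reflexive (eq₂ (w n) (step n))) (Sym-* J (λ n → *-nn (0≤step n) (0≤w n)) (λ n → *-nn (0≤step n) (0≤w n)) (proj₂ (sym-u (suc J))) (proj₂ (sym-u (suc J)))))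
      where
      eq₁ : ∀ w s → w * (s * (s * w)) ≡ s * s * (w * w)
      eq₁ = solve-∀ ringℚ
      eq₂ : ∀ w s → s * w * (s * w) ≡ s * s * (w * w)
      eq₂ = solve-∀ ringℚ

    η-sym : ∀ J → Sym J step² (η u)
    η-sym J = Sym-weaken J (λ n → ≤-reflexive (wt≡ n)) (Sym-* J (λ n → *-nn (0≤step² n) (*-nn (0≤w n) (0≤w n))) (λ n → *-nn (0≤iw n) (0≤iw n)) (curvature-sym J) (Sym-* J 0≤iw 0≤iw (iu-sym J) (iu-sym J)))
      where
      0≤iw : ∀ n → 0ℚ ≤ inv (w n)
      0≤iw n = inv-nn (0<w n)
      eq : ∀ s w i → s * (w * w) * (i * i) ≡ s * (w * i * (w * i))
      eq = solve-∀ ringℚ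
      wt≡ : ∀ n → step² n * (w n * w n) * (inv (w n) * inv (w n)) ≡ step² n
      wt≡ n = trans (eq (step² n) (w n) (inv (w n))) (trans (cong (λ z → step² n * (z * z)) (inv-r (0<w n))) (trans (cong (step² n *_) (*-identityˡ 1ℚ)) (*-identityʳ (step² n))))

    Cη C₀ X : ℚ
    Cη = proj₁ (η-sym 0)
    C₀ = proj₁ (sym-u 0)
    -- One threshold for three needs: `1ℚ` gives `w ≤ 1` and `step² ≤ w`, `C₀` gives `u ≤ 1`, and
    -- the last summand lets the main term absorb the `η` term of `next u`.
    X = 1ℚ + C₀ + 2ℚ * (D * C) * Cη

    0≤Cη : 0ℚ ≤ Cη
    0≤Cη = proj₁ (proj₂ (η-sym 0))

    0≤C₀ : 0ℚ ≤ C₀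
    0≤C₀ = proj₁ (proj₂ (sym-u 0))

    0≤DC : 0ℚ ≤ D * C
    0≤DC = *-nn 0≤D 0≤C

    1≤X : 1ℚ ≤ X
    1≤X = ≤-trans (p≤p+q {1ℚ} {C₀} 0≤C₀) (p≤p+q {1ℚ + C₀} (*-nn (*-nn 0≤2 0≤DC) 0≤Cη))

    C₀≤X : C₀ ≤ X
    C₀≤X = ≤-trans (q≤p+q {1ℚ} {C₀} 0≤1) (p≤p+q {1ℚ + C₀} (*-nn (*-nn 0≤2 0≤DC) 0≤Cη))

    Cη≤X : 2ℚ * (D * C) * Cη ≤ X
    Cη≤X = q≤p+q {1ℚ + C₀} (+-nn 0≤1 0≤C₀)

    module _ (Xw≤1 : ∀ n → X * w n ≤ 1ℚ) (Xs≤w : ∀ n → X * step² n ≤ w n) where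

      w≤1 : ∀ n → w n ≤ 1ℚ
      w≤1 n = ≤-trans (1*≤ (0≤w n) 1≤X) (Xw≤1 n)

      s≤w : ∀ n → step² n ≤ w n
      s≤w n = ≤-trans (1*≤ (0≤step² n) 1≤X) (Xs≤w n)

      u≤C₀ : ∀ n → u n ≤ C₀ * w n
      u≤C₀ n = ≤-trans (≤abs (u n)) (proj₂ (proj₂ (sym-u 0)) n)

      w-suc≤1 : ∀ n → u n ≤ 1ℚ
      w-suc≤1 n = ≤-trans (u≤C₀ n) (≤-trans (*-monoʳ (0≤w n) C₀≤X) (Xw≤1 n))

      one : ℕ → ℚ
      one _ = 1ℚ

      Sym-zero : ∀ J {v} → (∀ n → 0ℚ ≤ v n) → Sym J v (λ _ → 0ℚ)
      Sym-zero zero {v} 0≤v = 0ℚ , ≤-refl , λ n → ≤-reflexive (sym (*-zeroˡ (v n)))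
      Sym-zero (suc J) {v} 0≤v = Sym-zero zero 0≤v , Sym-zero J (λ n → *-nn (0≤step n) (0≤v n))

      one-sym : ∀ J → Sym J one one
      one-sym zero = 1ℚ , 0≤1 , λ _ → ≤-reflexive (sym (*-identityˡ 1ℚ))
      one-sym (suc J) = one-sym zero , Sym-zero J (λ n → *-nn (0≤step n) 0≤1)

      next-sym : ∀ J → Sym J w (next u)
      next-sym J = Sym-sub J (Sym-sub J
          (Sym-cong J (λ n → eq (u (suc n))) (Sym-+ J (u₁-sym J) (u₁-sym J)))
          (Sym-weaken J (λ n → ≤*1 (0≤w n) (w≤1 n)) (Sym-* J 0≤w 0≤w (u₁-sym J) (u₁-sym J))))
        (Sym-weaken J (λ n → ≤-trans (≤-reflexive (trans (cong (step² n *_) (*-identityˡ 1ℚ)) (*-identityʳ (step² n)))) (s≤w n))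
          (Sym-* J 0≤step² (λ _ → *-nn 0≤1 0≤1) (η-sym J) (Sym-* J (λ _ → 0≤1) (λ _ → 0≤1) 1-u 1-u)))
        where
        eq : ∀ x → x + x ≡ 2ℚ * x
        eq = solve-∀ ringℚ
        1-u : Sym J one (λ n → 1ℚ - u (suc n))
        1-u = Sym-sub J (one-sym J) (Sym-weaken J w≤1 (u₁-sym J))

      -- Of the main term `2 u`, one copy of `u` pays for `u²`. The other, multiplied by `2 D C`,
      -- covers `w` twice: once for the claim and once for the `η` term.
      next-low : ∀ n → w n ≤ 2ℚ * (D * C) * next u n
      next-low n = ≤-by (+-nn (+-nn (*-nn 0≤2 (-nn (w≤DCu₁ n))) (*-nn 0≤2DC (*-nn 0≤u₁ 0≤c))) (+-nn (*-nn 0≤2DC (-nn ηc²≤)) (-nn (≤-trans (≤-reflexive (sym (*-assoc (2ℚ * (D * C)) Cη (step² n)))) (≤-trans (*-monoʳ (0≤step² n) Cη≤X) (Xs≤w n))))))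
          (eq (w n) (D * C) (u (suc n)) (η u n) (Cη * step² n))
        where
        0≤2DC : 0ℚ ≤ 2ℚ * (D * C)
        0≤2DC = *-nn 0≤2 0≤DC
        0≤u₁ : 0ℚ ≤ u (suc n)
        0≤u₁ = <⇒≤ (0<u (suc n))
        c : ℚ
        c = 1ℚ - u (suc n)
        0≤c : 0ℚ ≤ c
        0≤c = -nn (w-suc≤1 (suc n))
        c≤1 : c ≤ 1ℚ
        c≤1 = ≤-by 0≤u₁ (eqc (u (suc n)))
          where
          eqc : ∀ x → 1ℚ - (1ℚ - x) ≡ x
          eqc = solve-∀ ringℚ
        ηc²≤ : η u n * (c * c) ≤ Cη * step² n
        ηc²≤ = begin
          η u n * (c * c) ≤⟨ *-monoʳ (*-nn 0≤c 0≤c) (≤-trans (≤abs (η u n)) (proj₂ (proj₂ (η-sym 0)) n)) ⟩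
          Cη * step² n * (c * c) ≡⟨ *-comm (Cη * step² n) (c * c) ⟩
          c * c * (Cη * step² n) ≤⟨ ≤*1 (*-nn 0≤Cη (0≤step² n)) (≤-trans (≤*1 0≤c c≤1) c≤1) ⟩
          Cη * step² n ∎
          where open ≤-Reasoning
        eq : ∀ w d u h s → 2ℚ * d * (2ℚ * u - u * u - h * ((1ℚ - u) * (1ℚ - u))) - w
           ≡ 2ℚ * (d * u - w) + 2ℚ * d * (u * (1ℚ - u)) + (2ℚ * d * (s - h * ((1ℚ - u) * (1ℚ - u))) + (w - 2ℚ * d * s))
        eq = solve-∀ ringℚ

      next-regular : Regular S (next u)
      next-regular = record { C = 2ℚ * (D * C) ; 0≤C = *-nn 0≤2 0≤DC ; w≤Cu = next-low ; sym-u = next-sym }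

  Lℚ : (ℕ → ℚ) → ℕ → ℚ
  Lℚ b n = b (suc n) * b (suc n) - b n * b (suc (suc n))

  Lℚ^ : ℕ → (ℕ → ℚ) → ℕ → ℚ
  Lℚ^ zero b = b
  Lℚ^ (suc j) b = Lℚ (Lℚ^ j b)

  Lℚ-cong : ∀ {b c} → (∀ n → b n ≡ c n) → ∀ n → Lℚ b n ≡ Lℚ c n
  Lℚ-cong e n = cong₂ _-_ (cong₂ _*_ (e (suc n)) (e (suc n))) (cong₂ _*_ (e n) (e (suc (suc n))))

  Lℚ^-cong : ∀ j {b c} → (∀ n → b n ≡ c n) → ∀ n → Lℚ^ j b n ≡ Lℚ^ j c n
  Lℚ^-cong zero e = e
  Lℚ^-cong (suc j) e = Lℚ-cong (Lℚ^-cong j e)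

  Lℚ^-L : ∀ j b n → Lℚ^ j (Lℚ b) n ≡ Lℚ^ (suc j) b n
  Lℚ^-L zero b n = refl
  Lℚ^-L (suc j) b = Lℚ-cong (Lℚ^-L j b)

  Lℚ^-shift : ∀ j b N n → Lℚ^ j (λ m → b (m ℕ.+ N)) n ≡ Lℚ^ j b (n ℕ.+ N)
  Lℚ^-shift zero b N n = refl
  Lℚ^-shift (suc j) b N = Lℚ-cong (Lℚ^-shift j b N)

  -- `Lℚ b n` equals `b (n + 1)² * u n`, so positivity passes to it, and its own deficit is
  -- `next u`, regular again after a shift that makes the smallness hypotheses hold everywhere.
  eventually-log-concave : ∀ j S b u → (∀ n → 0ℚ < b n) → (∀ n → b n * b (suc (suc n)) ≡ b (suc n) * b (suc n) * (1ℚ - u n)) → Regular S u →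
    ∃[ N ] (∀ i → i ℕ.≤ j → ∀ n → N ℕ.≤ n → 0ℚ ≤ Lℚ^ i b n)
  eventually-log-concave zero S b u 0<b _ _ = 0 , λ { zero z≤n n _ → <⇒≤ (0<b n) }
  eventually-log-concave (suc j) S b u 0<b e ru = proj₁ rest ℕ.+ N , λ
    { zero _ n _ → <⇒≤ (0<b n)
    ; (suc i) (s≤s i≤j) n N≤n → subst (0ℚ ≤_) (trans (Lℚ^-shift i (Lℚ b) N (n ∸ N)) (trans (cong (Lℚ^ i (Lℚ b)) (ℕₚ.m∸n+n≡m (ℕₚ.≤-trans (ℕₚ.m≤n+m N (proj₁ rest)) N≤n))) (Lℚ^-L i b n)))
        (proj₂ rest i i≤j (n ∸ N) (ℕₚ.≤-trans (ℕₚ.≤-reflexive (sym (ℕₚ.m+n∸n≡m (proj₁ rest) N))) (ℕₚ.∸-monoˡ-≤ N N≤n))) }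
    where
    open Scale S using (small)
    module NX = Next S u ru
    N : ℕ
    N = proj₁ (small NX.X)
    S′ : Scale
    S′ = shiftScale N S
    u′ : ℕ → ℚ
    u′ n = u (n ℕ.+ N)
    ru′ : Regular S′ u′
    ru′ = shiftRegular N S ru
    b′ : ℕ → ℚ
    b′ n = Lℚ b (n ℕ.+ N)
    Lb : ∀ n → Lℚ b n ≡ b (suc n) * b (suc n) * u n
    Lb n = trans (cong (λ z → b (suc n) * b (suc n) - z) (e n)) (eq (b (suc n) * b (suc n)) (u n))
      where
      eq : ∀ x y → x - x * (1ℚ - y) ≡ x * y
      eq = solve-∀ ringℚ
    0<b′ : ∀ n → 0ℚ < b′ n
    0<b′ n = subst (0ℚ <_) (sym (Lb (n ℕ.+ N))) (*-pos (*-pos (0<b (suc (n ℕ.+ N))) (0<b (suc (n ℕ.+ N)))) (regular-pos S ru (n ℕ.+ N)))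
    e′ : ∀ n → Lℚ b n * Lℚ b (suc (suc n)) ≡ Lℚ b (suc n) * Lℚ b (suc n) * (1ℚ - next u n)
    e′ n = begin
      Lℚ b n * Lℚ b (suc (suc n)) ≡⟨ cong₂ _*_ (Lb n) (Lb (suc (suc n))) ⟩
      b₁ * b₁ * u₀ * (b₃ * b₃ * u₂) ≡⟨ eq₁ b₁ u₀ b₃ u₂ ⟩
      b₁ * b₃ * (b₁ * b₃) * (u₀ * u₂) ≡⟨ cong (λ z → z * z * (u₀ * u₂)) (e (suc n)) ⟩
      b₂ * b₂ * (1ℚ - u₁) * (b₂ * b₂ * (1ℚ - u₁)) * (u₀ * u₂) ≡⟨ eq₂ b₂ u₀ u₁ u₂ ⟩
      -- Here `u₀ * u₂` has become `u₁ * u₁` plus the curvature. The factors `1ℚ` make room for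
      -- `u₁ * inv u₁`, a relation unknown to the ring solver.
      b₂ * b₂ * (b₂ * b₂) * ((u₁ * u₁ + curvature u n * (1ℚ * 1ℚ)) * ((1ℚ - u₁) * (1ℚ - u₁))) ≡⟨ cong (λ z → b₂ * b₂ * (b₂ * b₂) * ((u₁ * u₁ + curvature u n * (z * z)) * ((1ℚ - u₁) * (1ℚ - u₁)))) (sym (inv-r (regular-pos S ru (suc n)))) ⟩
      b₂ * b₂ * (b₂ * b₂) * ((u₁ * u₁ + curvature u n * (u₁ * inv u₁ * (u₁ * inv u₁))) * ((1ℚ - u₁) * (1ℚ - u₁))) ≡⟨ eq₃ b₂ u₁ (curvature u n) (inv u₁) ⟩
      b₂ * b₂ * u₁ * (b₂ * b₂ * u₁) * (1ℚ - next u n) ≡⟨ cong (λ z → z * z * (1ℚ - next u n)) (sym (Lb (suc n))) ⟩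
      Lℚ b (suc n) * Lℚ b (suc n) * (1ℚ - next u n) ∎
      where
      open ≡-Reasoning
      b₁ = b (suc n)
      b₂ = b (suc (suc n))
      b₃ = b (suc (suc (suc n)))
      u₀ = u n
      u₁ = u (suc n)
      u₂ = u (suc (suc n))
      eq₁ : ∀ x y z w → x * x * y * (z * z * w) ≡ x * z * (x * z) * (y * w)
      eq₁ = solve-∀ ringℚ
      eq₂ : ∀ b x y z → b * b * (1ℚ - y) * (b * b * (1ℚ - y)) * (x * z) ≡ b * b * (b * b) * ((y * y + (x * (z - y - (y - x)) - (y - x) * (y - x)) * (1ℚ * 1ℚ)) * ((1ℚ - y) * (1ℚ - y)))
      eq₂ = solve-∀ ringℚ
      eq₃ : ∀ b y m i → b * b * (b * b) * ((y * y + m * (y * i * (y * i))) * ((1ℚ - y) * (1ℚ - y))) ≡ b * b * y * (b * b * y) * (1ℚ - (2ℚ * y - y * y - m * (i * i) * ((1ℚ - y) * (1ℚ - y))))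
      eq₃ = solve-∀ ringℚ
    rest : ∃[ N′ ] (∀ i → i ℕ.≤ j → ∀ n → N′ ℕ.≤ n → 0ℚ ≤ Lℚ^ i b′ n)
    rest = eventually-log-concave j S′ b′ (next u′) 0<b′ (λ n → e′ (n ℕ.+ N))
      (Next.next-regular S′ u′ ru′ (λ n → proj₁ (proj₂ (small NX.X) (n ℕ.+ N) (ℕₚ.m≤n+m N n))) (λ n → proj₂ (proj₂ (small NX.X) (n ℕ.+ N) (ℕₚ.m≤n+m N n))))

  -- The scale √n

  -- κ n = ⌈√n⌉, except that κ 0 = 1.
  κ : ℕ → ℕ
  κ zero = 1
  κ (suc n) with suc n ℕ.≤? κ n ℕ.* κ n
  ... | yes _ = κ n
  ... | no _ = suc (κ n)

  k : ℕ → ℚ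
  k n = ι (κ n)

  1≤κ : ∀ n → 1 ℕ.≤ κ n
  1≤κ zero = ℕₚ.≤-refl
  1≤κ (suc n) with suc n ℕ.≤? κ n ℕ.* κ n
  ... | yes _ = 1≤κ n
  ... | no _ = s≤s z≤n

  2≤κ⇒1≤n : ∀ {n} → 2 ℕ.≤ κ n → 1 ℕ.≤ n
  2≤κ⇒1≤n {zero} (s≤s ())
  2≤κ⇒1≤n {suc n} _ = s≤s z≤n

  κ-step : ∀ n → κ n ℕ.≤ κ (suc n)
  κ-step n with suc n ℕ.≤? κ n ℕ.* κ n
  ... | yes _ = ℕₚ.≤-refl
  ... | no _ = ℕₚ.n≤1+n _

  κ-mono : ∀ m n → κ n ℕ.≤ κ (m ℕ.+ n)
  κ-mono zero n = ℕₚ.≤-refl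
  κ-mono (suc m) n = ℕₚ.≤-trans (κ-mono m n) (κ-step (m ℕ.+ n))

  n≤κ² : ∀ n → n ℕ.≤ κ n ℕ.* κ n
  n≤κ² zero = z≤n
  n≤κ² (suc n) with suc n ℕ.≤? κ n ℕ.* κ n
  ... | yes h = h
  ... | no h = ℕₚ.≤-trans (s≤s (n≤κ² n)) (s≤s (ℕₚ.+-mono-≤ (z≤n {κ n}) (ℕₚ.*-monoʳ-≤ (κ n) (ℕₚ.n≤1+n (κ n)))))

  1≤k : ∀ n → 1ℚ ≤ k n
  1≤k n = ≤-trans (≤-reflexive (sym (+-identityˡ 1ℚ))) (ι-mono (1≤κ n))

  0<k : ∀ n → 0ℚ < k n
  0<k n = 1≤⇒0< (1≤k n)

  0≤k : ∀ n → 0ℚ ≤ k n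
  0≤k n = <⇒≤ (0<k n)

  k-mono : ∀ m n → k n ≤ k (m ℕ.+ n)
  k-mono m n = ι-mono (κ-mono m n)

  n≤k² : ∀ n → ι n ≤ k n * k n
  n≤k² n = ≤-trans (ι-mono (n≤κ² n)) (≤-reflexive (ι-* (κ n) (κ n)))

  [k-1]²≤n : ∀ n → (k n - 1ℚ) * (k n - 1ℚ) ≤ ι n
  [k-1]²≤n zero = ≤-reflexive (eq 1ℚ)
    where
    eq : ∀ x → (0ℚ + x - x) * (0ℚ + x - x) ≡ 0ℚ
    eq = solve-∀ ringℚ
  [k-1]²≤n (suc n) with suc n ℕ.≤? κ n ℕ.* κ n
  ... | yes h = ≤-trans ([k-1]²≤n n) (p≤p+q 0≤1)
  ... | no h = ≤-trans (≤-reflexive (eq (k n))) (≤-trans (≤-reflexive (sym (ι-* (κ n) (κ n)))) (ι-mono (ℕₚ.<⇒≤ (ℕₚ.≰⇒> h))))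
    where
    eq : ∀ x → (x + 1ℚ - 1ℚ) * (x + 1ℚ - 1ℚ) ≡ x * x
    eq = solve-∀ ringℚ

  k²≤4n : ∀ n → k (suc n) * k (suc n) ≤ 4ℚ * ι (suc n)
  k²≤4n n with 2ℚ ≤? k (suc n)
  ... | yes h = ≤-trans (*-mono (0≤k (suc n)) le (0≤k (suc n)) le) (≤-trans (≤-reflexive (eq (k (suc n)))) (*-monoˡ 0≤4 ([k-1]²≤n (suc n))))
    where
    eq₁ : ∀ x → 2ℚ * (x - 1ℚ) - x ≡ x - 2ℚ
    eq₁ = solve-∀ ringℚ
    eq : ∀ x → 2ℚ * (x - 1ℚ) * (2ℚ * (x - 1ℚ)) ≡ 4ℚ * ((x - 1ℚ) * (x - 1ℚ))
    eq = solve-∀ ringℚ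
    le : k (suc n) ≤ 2ℚ * (k (suc n) - 1ℚ)
    le = ≤-by (-nn h) (eq₁ (k (suc n)))
  ... | no h = ≤-trans (*-mono (0≤k (suc n)) (<⇒≤ (≰⇒> h)) (0≤k (suc n)) (<⇒≤ (≰⇒> h))) (≤-trans (≤-reflexive (eq 1ℚ)) (*-monoˡ 0≤4 (1≤ι n)))
    where
    eq : ∀ x → (x + x) * (x + x) ≡ (x + x + (x + x)) * x
    eq = solve-∀ ringℚ

  g : ℕ → ℚ
  g n = inv (k n)

  0<g : ∀ n → 0ℚ < g n
  0<g n = inv-pos (0<k n)

  0≤g : ∀ n → 0ℚ ≤ g n
  0≤g n = inv-nn (0<k n)

  kg : ∀ n → k n * g n ≡ 1ℚ
  kg n = inv-r (0<k n)

  g≤1 : ∀ n → g n ≤ 1ℚ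
  g≤1 n = ≤-trans (1*≤ (0≤g n) (1≤k n)) (≤-reflexive (kg n))

  g-anti : ∀ m n → g (m ℕ.+ n) ≤ g n
  g-anti m n = inv-antimono (0<k n) (k-mono m n)

  -- The jump length in units of `k n`, raised by 1 so that every polynomial loss is bounded by a
  -- power of `ω`.
  ω : ℕ → ℕ → ℚ
  ω n m = 1ℚ + ι m * g n

  1≤ω : ∀ n m → 1ℚ ≤ ω n m
  1≤ω n m = p≤p+q (*-nn (ι-nn m) (0≤g n))

  0≤ω : ∀ n m → 0ℚ ≤ ω n m
  0≤ω n m = 1≤⇒0≤ (1≤ω n m)

  -- Uses (k - 1)² ≤ n = y + m ≤ k′² + m with k = k n and k′ = k y.
  k≤k′+ω : ∀ m y → k (m ℕ.+ y) ≤ k y + ω (m ℕ.+ y) m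
  k≤k′+ω m y with K ≤? K′ + 1ℚ
    where
    K = k (m ℕ.+ y)
    K′ = k y
  ... | yes h = ≤-trans h (+-monoʳ-≤ (k y) (1≤ω (m ℕ.+ y) m))
  ... | no h = ≤-by (*-nn (-nn e) (0≤g n)) (eq₃ K K′ (ι m) G (kg n))
    where
    n = m ℕ.+ y
    K = k n
    K′ = k y
    G = g n
    0≤D : 0ℚ ≤ K - (K′ + 1ℚ)
    0≤D = -nn (<⇒≤ (≰⇒> h))
    eq₁ : ∀ a b m s → (m - (a - (b + 1ℚ)) * a) ≡ ((b * b + m) - s) + (s - (a - 1ℚ) * (a - 1ℚ)) + (a - (b + 1ℚ)) * (b - 1ℚ)
    eq₁ = solve-∀ ringℚ
    e : (K - (K′ + 1ℚ)) * K ≤ ι m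
    e = ≤-by (+-nn (+-nn (-nn le) (-nn ([k-1]²≤n n))) (*-nn 0≤D (-nn (1≤k y)))) (eq₁ K K′ (ι m) (ι n))
      where
      le : ι n ≤ K′ * K′ + ι m
      le = ≤-trans (≤-reflexive (trans (ι-+ m y) (+-comm (ι m) (ι y)))) (+-monoˡ-≤ (ι m) (n≤k² y))
    eq₃ : ∀ a b m g → a * g ≡ 1ℚ → b + (1ℚ + m * g) - a ≡ (m - (a - (b + 1ℚ)) * a) * g
    eq₃ a b m g h = sym (trans (eq₄ a b m g) (trans (cong (λ z → m * g - (a - (b + 1ℚ)) * z) h) (eq₅ a b (m * g))))
      where
      eq₄ : ∀ a b m g → (m - (a - (b + 1ℚ)) * a) * g ≡ m * g - (a - (b + 1ℚ)) * (a * g)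
      eq₄ = solve-∀ ringℚ
      eq₅ : ∀ a b x → x - (a - (b + 1ℚ)) * 1ℚ ≡ b + (1ℚ + x) - a
      eq₅ = solve-∀ ringℚ

  -- σ i is the weight s(i + 1) of a jump of length i + 1.
  record Renewal : Set where
    field
      a σ : ℕ → ℚ
      a0 : a 0 ≡ 1ℚ
      a-step : ∀ n → a n ≤ a (suc n)
      rec : ∀ n → ι n * a n ≡ sum n (λ i → σ i * a (n ∸ suc i))
      σ-low : ∀ i → 2ℚ * ι (suc i) ≤ σ i
      σ-sum : ∀ X → sum X σ ≤ 2ℚ * (ι X * ι X)

  -- Renewal sequences

  module Analysis (R : Renewal) where
    open Renewal R

    a-+ : ∀ m n → a n ≤ a (m ℕ.+ n)
    a-+ zero n = ≤-refl
    a-+ (suc m) n = ≤-trans (a-+ m n) (a-step (m ℕ.+ n))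

    a-mono : ∀ {m n} → m ℕ.≤ n → a m ≤ a n
    a-mono {m} {n} h = subst (λ z → a m ≤ a z) (ℕₚ.m∸n+n≡m h) (a-+ (n ∸ m) m)

    1≤a : ∀ n → 1ℚ ≤ a n
    1≤a n = ≤-trans (≤-reflexive (sym a0)) (a-mono z≤n)

    0<a : ∀ n → 0ℚ < a n
    0<a n = 1≤⇒0< (1≤a n)

    0≤a : ∀ n → 0ℚ ≤ a n
    0≤a n = <⇒≤ (0<a n)

    0≤σ : ∀ i → 0ℚ ≤ σ i
    0≤σ i = ≤-trans (*-nn 0≤2 (ι-nn (suc i))) (σ-low i)

    -- Moments of the jump law.

    tailSum : ℕ → ℚ
    tailSum n = sum n (λ i → a (n ∸ suc i))

    -- Expanding the square, every product a(n - i) a(n - j) with i < j is at most a(n) a(n - j).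
    tailSum² : ∀ n j → let B = sum j (λ i → a (n ∸ suc i)) in
      B * B ≤ a n * sum j (λ i → 2ℚ * ι (suc i) * a (n ∸ suc i))
    tailSum² n zero = ≤-reflexive (eq (a n))
      where
      eq : ∀ x → 0ℚ * 0ℚ ≡ x * 0ℚ
      eq = solve-∀ ringℚ
    tailSum² n (suc j) = ≤-by (+-nn (-nn (tailSum² n j)) (*-nn (0≤a (n ∸ suc j)) (+-nn (+-nn (*-nn 0≤2 (-nn B≤)) (-nn (a-mono (ℕₚ.m∸n≤m n (suc j))))) (0≤a n))))
      (eq B (a (n ∸ suc j)) (a n) (ι j) (sum j (λ i → 2ℚ * ι (suc i) * a (n ∸ suc i))))
      where
      B = sum j (λ i → a (n ∸ suc i))
      B≤ : B ≤ ι j * a n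
      B≤ = ≤-trans (sum-mono j λ i _ → a-mono (ℕₚ.m∸n≤m n (suc i))) (≤-reflexive (sum-const j (a n)))
      eq : ∀ b x y i s → y * (s + 2ℚ * (i + 1ℚ) * x) - (b + x) * (b + x) ≡ y * s - b * b + x * (2ℚ * (i * y - b) + (y - x) + y)
      eq = solve-∀ ringℚ

    -- This is where √n enters: by `σ-low` the right side of `tailSum²` is at most `a n` times the
    -- recurrence sum, that is `n * a n * a n`, and a square root is taken.
    tailSum≤ : ∀ n → tailSum n ≤ k n * a n
    tailSum≤ n = sq-cancel (*-nn (0≤k n) (0≤a n)) (begin
      tailSum n * tailSum n ≤⟨ tailSum² n n ⟩
      a n * sum n (λ i → 2ℚ * ι (suc i) * a (n ∸ suc i)) ≤⟨ *-monoˡ (0≤a n) (sum-mono n λ i _ → *-monoʳ (0≤a (n ∸ suc i)) (σ-low i)) ⟩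
      a n * sum n (λ i → σ i * a (n ∸ suc i)) ≡⟨ cong (a n *_) (sym (rec n)) ⟩
      a n * (ι n * a n) ≤⟨ *-monoˡ (0≤a n) (*-monoʳ (0≤a n) (n≤k² n)) ⟩
      a n * (k n * k n * a n) ≡⟨ eq (a n) (k n) ⟩
      k n * a n * (k n * a n) ∎)
      where
      open ≤-Reasoning
      eq : ∀ x y → x * (y * y * x) ≡ y * x * (y * x)
      eq = solve-∀ ringℚ

    -- Summation by parts against an increasing weight: by `tailSum≤` the mass of `a` below `y` is
    -- at most `k y * a y`, so each increment of `φ` costs `K` times one term. The `1ℚ` in
    -- `k y + 1ℚ ≤ K` accounts for that term itself.
    abel₁ : ∀ n K (φ : ℕ → ℚ) → (∀ y → y ℕ.≤ n → k y + 1ℚ ≤ K) → (∀ i → φ i ≤ φ (suc i)) →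
      sum n (λ i → φ (suc i) * a (n ∸ suc i)) ≤ φ 0 * tailSum n + K * sum n (λ i → (φ (suc i) - φ i) * a (n ∸ suc i))
    abel₁ zero K φ hK hφ = ≤-reflexive (eq (φ 0) K)
      where
      eq : ∀ x y → 0ℚ ≡ x * 0ℚ + y * 0ℚ
      eq = solve-∀ ringℚ
    abel₁ (suc n) K φ hK hφ = begin
      sum (suc n) (λ i → φ (suc i) * a (n ∸ i)) ≡⟨ sum-head n _ ⟩
      φ 1 * a n + sum n (λ i → φ (suc (suc i)) * a (n ∸ suc i)) ≤⟨ +-monoʳ-≤ (φ 1 * a n) (abel₁ n K (λ i → φ (suc i)) (λ y h → hK y (ℕₚ.m≤n⇒m≤1+n h)) (λ i → hφ (suc i))) ⟩
      φ 1 * a n + (φ 1 * tailSum n + K * S) ≤⟨ ≤-by (*-nn (-nn (hφ 0)) (+-nn (*-nn (-nn (hK n (ℕₚ.n≤1+n n))) (0≤a n)) (-nn (tailSum≤ n)))) (eq (φ 0) (φ 1) (a n) (tailSum n) K S (k n)) ⟩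
      φ 0 * (a n + tailSum n) + K * ((φ 1 - φ 0) * a n + S) ≡⟨ cong₂ (λ x y → φ 0 * x + K * y) (sym (sum-head n _)) (sym (sum-head n _)) ⟩
      φ 0 * tailSum (suc n) + K * sum (suc n) (λ i → (φ (suc i) - φ i) * a (n ∸ i)) ∎
      where
      open ≤-Reasoning
      S = sum n (λ i → (φ (suc (suc i)) - φ (suc i)) * a (n ∸ suc i))
      eq : ∀ p q x t y s c → p * (x + t) + y * ((q - p) * x + s) - (q * x + (q * t + y * s)) ≡ (q - p) * ((y - (c + 1ℚ)) * x + (c * x - t))
      eq = solve-∀ ringℚ

    k≤top : ∀ {y n} → y ℕ.≤ n → k y ≤ k n
    k≤top {y} {n} h = subst (λ z → k y ≤ k z) (ℕₚ.m∸n+n≡m h) (k-mono (n ∸ y) y)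

    M₀ : ℕ → ℚ
    M₀ zero = 1ℚ
    M₀ (suc c) = 1ℚ + 2ℚ * (ι (suc c) * M₀ c)

    0≤M₀ : ∀ c → 0ℚ ≤ M₀ c
    0≤M₀ zero = 0≤1
    0≤M₀ (suc c) = +-nn 0≤1 (*-nn 0≤2 (*-nn (ι-nn (suc c)) (0≤M₀ c)))

    -- Every power of the jump length costs one `k n`: `abel₁` trades degree `suc c` for increments
    -- of degree `c` times `k n + 1 ≤ 2 k n`.
    tail-moment : ∀ c n → sum n (λ i → (k n + ι (suc i)) ^ c * a (n ∸ suc i)) ≤ M₀ c * (k n ^ suc c * a n)
    tail-moment zero n = ≤-trans (≤-reflexive (sum-cong n λ i _ → *-identityˡ _)) (≤-trans (tailSum≤ n) (≤-reflexive (eq (k n) (a n))))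
      where
      eq : ∀ x y → x * y ≡ 1ℚ * (x * 1ℚ * y)
      eq = solve-∀ ringℚ
    tail-moment (suc c) n = begin
      sum n (λ i → φ (suc i) * a (n ∸ suc i)) ≤⟨ abel₁ n (K + 1ℚ) φ (λ y h → +-monoˡ-≤ 1ℚ (k≤top h)) (λ i → ^-mono (+-nn (0≤k n) (ι-nn i)) (x≤ i) (suc c)) ⟩
      φ 0 * tailSum n + (K + 1ℚ) * sum n (λ i → (φ (suc i) - φ i) * a (n ∸ suc i)) ≤⟨ +-mono-≤ (*-mono (^-nn 0≤K0 (suc c)) (≤-reflexive (cong (_^ suc c) (+-identityʳ K))) (sum-nn n λ i _ → 0≤a (n ∸ suc i)) (tailSum≤ n))
           (*-mono (+-nn (0≤k n) 0≤1) (+-monoʳ-≤ K (1≤k n)) (sum-nn n λ i _ → *-nn (-nn (^-mono (+-nn (0≤k n) (ι-nn i)) (x≤ i) (suc c))) (0≤a (n ∸ suc i))) (sum-mono n λ i _ → *-monoʳ (0≤a (n ∸ suc i)) (incr i))) ⟩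
      K ^ suc c * (K * a n) + (K + K) * sum n (λ i → ι (suc c) * (K + ι (suc i)) ^ c * a (n ∸ suc i)) ≡⟨ cong (λ z → K ^ suc c * (K * a n) + (K + K) * z) (trans (sum-cong n λ i _ → *-assoc (ι (suc c)) _ _) (sum-*ˡ n (ι (suc c)) _)) ⟩
      K ^ suc c * (K * a n) + (K + K) * (ι (suc c) * sum n (λ i → (K + ι (suc i)) ^ c * a (n ∸ suc i))) ≤⟨ +-monoʳ-≤ (K ^ suc c * (K * a n)) (*-monoˡ (+-nn (0≤k n) (0≤k n)) (*-monoˡ (ι-nn (suc c)) (tail-moment c n))) ⟩
      K ^ suc c * (K * a n) + (K + K) * (ι (suc c) * (M₀ c * (K ^ suc c * a n))) ≡⟨ eq K (K ^ suc c) (a n) (ι (suc c)) (M₀ c) ⟩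
      M₀ (suc c) * (K ^ suc (suc c) * a n) ∎
      where
      open ≤-Reasoning
      K = k n
      φ : ℕ → ℚ
      φ i = (K + ι i) ^ suc c
      0≤K0 : 0ℚ ≤ K + 0ℚ
      0≤K0 = +-nn (0≤k n) ≤-refl
      x≤ : ∀ i → K + ι i ≤ K + ι (suc i)
      x≤ i = +-monoʳ-≤ K (p≤p+q 0≤1)
      eq₁ : ∀ x y → x + (y + 1ℚ) - (x + y) ≡ 1ℚ
      eq₁ = solve-∀ ringℚ
      incr : ∀ i → φ (suc i) - φ i ≤ ι (suc c) * (K + ι (suc i)) ^ c
      incr i = ≤-trans (^-diff (+-nn (0≤k n) (ι-nn i)) (x≤ i) c) (≤-reflexive (cong (_* (K + ι (suc i)) ^ c) (trans (cong (ι (suc c) *_) (eq₁ K (ι i))) (*-identityʳ (ι (suc c))))))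
      eq : ∀ x p y i m → p * (x * y) + (x + x) * (i * (m * (p * y))) ≡ (1ℚ + 2ℚ * (i * m)) * (x * p * y)
      eq = solve-∀ ringℚ

    -- Needed because `σ` has a good upper bound only on average. Against a decreasing `ρ`, a bound
    -- on partial sums is enough.
    abel₂ : ∀ n (t ρ H : ℕ → ℚ) → (∀ X → sum X t ≤ H X) → (∀ i → ρ (suc i) ≤ ρ i) → (∀ i → 0ℚ ≤ ρ i) →
      sum n (λ i → t i * ρ i) ≤ H 0 * ρ 0 + sum n (λ i → (H (suc i) - H i) * ρ i)
    abel₂ n t ρ H hH hρ 0≤ρ = ≤-trans (p≤p+q (*-nn (-nn (hH n)) (0≤ρ n))) (go n)
      where
      eq₀ : ∀ x y → 0ℚ + (x - 0ℚ) * y ≡ x * y + 0ℚ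
      eq₀ = solve-∀ ringℚ
      eq : ∀ L R T t h h′ r r′ → (L + (h′ - h) * r) - (R + t * r + (h′ - (T + t)) * r′) ≡ (L - (R + (h - T) * r)) + (h′ - (T + t)) * (r - r′)
      eq = solve-∀ ringℚ
      -- The boundary term of the summation by parts stays on the left so that the induction closes;
      -- it is dropped afterwards by non-negativity.
      go : ∀ n → sum n (λ i → t i * ρ i) + (H n - sum n t) * ρ n ≤ H 0 * ρ 0 + sum n (λ i → (H (suc i) - H i) * ρ i)
      go zero = ≤-reflexive (eq₀ (H 0) (ρ 0))
      go (suc n) = ≤-trans (≤-by (+-nn (-nn (go n)) (*-nn (-nn (hH (suc n))) (-nn (hρ n))))
        (eq (H 0 * ρ 0 + sum n (λ i → (H (suc i) - H i) * ρ i)) (sum n (λ i → t i * ρ i)) (sum n t) (t n) (H n) (H (suc n)) (ρ n) (ρ (suc n))))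
        (≤-reflexive (+-assoc (H 0 * ρ 0) (sum n (λ i → (H (suc i) - H i) * ρ i)) ((H (suc n) - H n) * ρ n)))

    a∸-anti : ∀ n i → a (n ∸ suc i) ≤ a (n ∸ i)
    a∸-anti n i = a-mono (ℕₚ.∸-monoʳ-≤ n (ℕₚ.n≤1+n i))

    M : ℕ → ℚ
    M c = 2ℚ + 2ℚ * (ι (suc (suc c)) * M₀ (suc c))

    0≤M : ∀ c → 0ℚ ≤ M c
    0≤M c = +-nn 0≤2 (*-nn 0≤2 (*-nn (ι-nn (suc (suc c))) (0≤M₀ (suc c))))

    -- By `σ-sum` the weights summed up to `X` are at most `2 (k n + X)^(c + 2)`. The increments of
    -- this have degree `c + 1`, which leads back to `tail-moment`.
    σ-moment : ∀ c n → sum n (λ i → σ i * (k n + ι (suc i)) ^ c * a (n ∸ suc i)) ≤ M c * (k n ^ suc (suc c) * a n)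
    σ-moment c n = begin
      sum n (λ i → t i * a (n ∸ suc i)) ≤⟨ abel₂ n t (λ i → a (n ∸ suc i)) H hH (λ i → a∸-anti n (suc i)) (λ i → 0≤a (n ∸ suc i)) ⟩
      H 0 * a (n ∸ 1) + sum n (λ i → (H (suc i) - H i) * a (n ∸ suc i)) ≤⟨ +-mono-≤ (*-mono (*-nn 0≤2 (^-nn 0≤K0 (suc (suc c)))) (≤-reflexive (cong (λ z → 2ℚ * z ^ suc (suc c)) (+-identityʳ K))) (0≤a (n ∸ 1)) (a∸-anti n 0))
           (sum-mono n λ i _ → *-monoʳ (0≤a (n ∸ suc i)) (incr i)) ⟩
      2ℚ * K ^ suc (suc c) * a n + sum n (λ i → (2ℚ * ι (suc (suc c))) * (K + ι (suc i)) ^ suc c * a (n ∸ suc i)) ≡⟨ cong (2ℚ * K ^ suc (suc c) * a n +_) (trans (sum-cong n λ i _ → *-assoc (2ℚ * ι (suc (suc c))) _ _) (sum-*ˡ n (2ℚ * ι (suc (suc c))) _)) ⟩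
      2ℚ * K ^ suc (suc c) * a n + (2ℚ * ι (suc (suc c))) * sum n (λ i → (K + ι (suc i)) ^ suc c * a (n ∸ suc i)) ≤⟨ +-monoʳ-≤ (2ℚ * K ^ suc (suc c) * a n) (*-monoˡ (*-nn 0≤2 (ι-nn (suc (suc c)))) (tail-moment (suc c) n)) ⟩
      2ℚ * K ^ suc (suc c) * a n + (2ℚ * ι (suc (suc c))) * (M₀ (suc c) * (K ^ suc (suc c) * a n)) ≡⟨ eq (K ^ suc (suc c)) (a n) (ι (suc (suc c))) (M₀ (suc c)) ⟩
      M c * (K ^ suc (suc c) * a n) ∎
      where
      open ≤-Reasoning
      K = k n
      t H : ℕ → ℚ
      t i = σ i * (K + ι (suc i)) ^ c
      H X = 2ℚ * (K + ι X) ^ suc (suc c)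
      0≤K0 : 0ℚ ≤ K + 0ℚ
      0≤K0 = +-nn (0≤k n) ≤-refl
      0≤K+ : ∀ i → 0ℚ ≤ K + ι i
      0≤K+ i = +-nn (0≤k n) (ι-nn i)
      x≤ : ∀ i → K + ι i ≤ K + ι (suc i)
      x≤ i = +-monoʳ-≤ K (p≤p+q 0≤1)
      eq : ∀ p y i m → 2ℚ * p * y + (2ℚ * i) * (m * (p * y)) ≡ (2ℚ + 2ℚ * (i * m)) * (p * y)
      eq = solve-∀ ringℚ
      eq₁ : ∀ x y → x + (y + 1ℚ) - (x + y) ≡ 1ℚ
      eq₁ = solve-∀ ringℚ
      eq₃ : ∀ p q → 2ℚ * p - 2ℚ * q ≡ 2ℚ * (p - q)
      eq₃ = solve-∀ ringℚ
      incr : ∀ i → H (suc i) - H i ≤ (2ℚ * ι (suc (suc c))) * (K + ι (suc i)) ^ suc c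
      incr i = ≤-trans (≤-reflexive (eq₃ ((K + ι (suc i)) ^ suc (suc c)) ((K + ι i) ^ suc (suc c)))) (≤-trans (*-monoˡ 0≤2 (^-diff (0≤K+ i) (x≤ i) (suc c)))
        (≤-reflexive (trans (cong (λ z → 2ℚ * (ι (suc (suc c)) * z * (K + ι (suc i)) ^ suc c)) (eq₁ K (ι i))) (eq₄ (ι (suc (suc c))) ((K + ι (suc i)) ^ suc c)))))
        where
        eq₄ : ∀ x y → 2ℚ * (x * 1ℚ * y) ≡ 2ℚ * x * y
        eq₄ = solve-∀ ringℚ
      hH : ∀ X → sum X t ≤ H X
      hH X = begin
        sum X t ≤⟨ sum-mono X (λ i i<X → *-monoˡ (0≤σ i) (^-mono (0≤K+ (suc i)) (+-monoʳ-≤ K (ι-mono i<X)) c)) ⟩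
        sum X (λ i → σ i * (K + ι X) ^ c) ≡⟨ trans (sum-cong X (λ i _ → *-comm (σ i) _)) (sum-*ˡ X ((K + ι X) ^ c) σ) ⟩
        (K + ι X) ^ c * sum X σ ≤⟨ *-monoˡ (^-nn (0≤K+ X) c) (≤-trans (σ-sum X) (*-monoˡ 0≤2 (*-mono (ι-nn X) (q≤p+q (0≤k n)) (ι-nn X) (q≤p+q (0≤k n))))) ⟩
        (K + ι X) ^ c * (2ℚ * ((K + ι X) * (K + ι X))) ≡⟨ eq₅ ((K + ι X) ^ c) (K + ι X) ⟩
        2ℚ * (K + ι X) ^ suc (suc c) ∎
        where
        eq₅ : ∀ p x → p * (2ℚ * (x * x)) ≡ 2ℚ * (x * (x * p))
        eq₅ = solve-∀ ringℚ

    r : ℕ → ℚ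
    r n = inv (a n)

    0≤r : ∀ n → 0ℚ ≤ r n
    0≤r n = inv-nn (0<a n)

    ar : ∀ n → a n * r n ≡ 1ℚ
    ar n = inv-r (0<a n)

    wt : ℕ → ℕ → ℚ
    wt n i = σ i * a (n ∸ suc i) * r n

    0≤wt : ∀ n i → 0ℚ ≤ wt n i
    0≤wt n i = *-nn (*-nn (0≤σ i) (0≤a (n ∸ suc i))) (0≤r n)

    -- Averages are left unnormalised: the recurrence gives `W n` total mass `ι n`, so that no
    -- division by `n` is needed.
    W : ℕ → (ℕ → ℚ) → ℚ
    W n F = sum n (λ i → wt n i * F i)

    W-mono : ∀ n {F G} → (∀ i → i ℕ.< n → F i ≤ G i) → W n F ≤ W n G
    W-mono n h = sum-mono n λ i i<n → *-monoˡ (0≤wt n i) (h i i<n)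

    W-nn : ∀ n {F} → (∀ i → i ℕ.< n → 0ℚ ≤ F i) → 0ℚ ≤ W n F
    W-nn n h = sum-nn n λ i i<n → *-nn (0≤wt n i) (h i i<n)

    W-*ˡ : ∀ n c F → W n (λ i → c * F i) ≡ c * W n F
    W-*ˡ n c F = trans (sum-cong n λ i _ → eq (wt n i) c (F i)) (sum-*ˡ n c _)
      where
      eq : ∀ x y z → x * (y * z) ≡ y * (x * z)
      eq = solve-∀ ringℚ

    W-+ : ∀ n F G → W n (λ i → F i + G i) ≡ W n F + W n G
    W-+ n F G = trans (sum-cong n λ i _ → *-distribˡ-+ (wt n i) (F i) (G i)) (sum-+ n _ _)

    W-abs : ∀ n F → ∣ W n F ∣ ≤ W n (λ i → ∣ F i ∣)
    W-abs n F = ≤-trans (sum-abs n _) (≤-reflexive (sum-cong n λ i _ → trans (∣p*q∣≡∣p∣*∣q∣ (wt n i) (F i)) (cong (_* ∣ F i ∣) (0≤p⇒∣p∣≡p (0≤wt n i)))))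

    W-wt : ∀ n → sum n (wt n) ≡ ι n
    W-wt n = begin
      sum n (λ i → σ i * a (n ∸ suc i) * r n) ≡⟨ sum-cong n (λ i _ → *-comm (σ i * a (n ∸ suc i)) (r n)) ⟩
      sum n (λ i → r n * (σ i * a (n ∸ suc i))) ≡⟨ sum-*ˡ n (r n) _ ⟩
      r n * sum n (λ i → σ i * a (n ∸ suc i)) ≡⟨ cong (r n *_) (sym (rec n)) ⟩
      r n * (ι n * a n) ≡⟨ eq (r n) (ι n) (a n) ⟩
      ι n * (a n * r n) ≡⟨ cong (ι n *_) (ar n) ⟩
      ι n * 1ℚ ≡⟨ *-identityʳ (ι n) ⟩
      ι n ∎
      where
      open ≡-Reasoning
      eq : ∀ x y z → x * (y * z) ≡ y * (z * x)
      eq = solve-∀ ringℚ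

    W-const : ∀ n c → W n (λ _ → c) ≡ ι n * c
    W-const n c = trans (sum-cong n λ i _ → *-comm (wt n i) c) (trans (sum-*ˡ n c (wt n)) (trans (cong (c *_) (W-wt n)) (*-comm c (ι n))))

    -- As `W n` has mass `n`, comparable with `k²`, all moments of the jump length in units of `k n`
    -- are bounded uniformly in `n`.
    W-ω : ∀ c n → W n (λ i → ω n (suc i) ^ c) ≤ M c * (k n * k n)
    W-ω c n = begin
      W n (λ i → ω n (suc i) ^ c) ≡⟨ sum-cong n (λ i _ → trans (cong (λ z → wt n i * z ^ c) (eqω i)) (trans (cong (wt n i *_) (*-^ (g n) (k n + ι (suc i)) c)) (eq₁ (σ i) (a (n ∸ suc i)) (r n) (g n ^ c) ((k n + ι (suc i)) ^ c)))) ⟩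
      sum n (λ i → (r n * g n ^ c) * (σ i * (k n + ι (suc i)) ^ c * a (n ∸ suc i))) ≡⟨ sum-*ˡ n (r n * g n ^ c) _ ⟩
      (r n * g n ^ c) * sum n (λ i → σ i * (k n + ι (suc i)) ^ c * a (n ∸ suc i)) ≤⟨ *-monoˡ (*-nn (0≤r n) (^-nn (0≤g n) c)) (σ-moment c n) ⟩
      (r n * g n ^ c) * (M c * (k n ^ suc (suc c) * a n)) ≡⟨ eq₂ (r n) (g n ^ c) (M c) (k n) (k n ^ c) (a n) ⟩
      M c * (k n * k n) * ((k n ^ c * g n ^ c) * (a n * r n)) ≡⟨ cong (M c * (k n * k n) *_) (cong₂ _*_ (trans (sym (*-^ (k n) (g n) c)) (trans (cong (_^ c) (kg n)) (1^ c))) (ar n)) ⟩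
      M c * (k n * k n) * (1ℚ * 1ℚ) ≡⟨ trans (cong (M c * (k n * k n) *_) (*-identityˡ 1ℚ)) (*-identityʳ _) ⟩
      M c * (k n * k n) ∎
      where
      open ≤-Reasoning
      eqω : ∀ i → ω n (suc i) ≡ g n * (k n + ι (suc i))
      eqω i = trans (cong (_+ ι (suc i) * g n) (sym (kg n))) (eq (k n) (g n) (ι (suc i)))
        where
        eq : ∀ x y z → x * y + z * y ≡ y * (x + z)
        eq = solve-∀ ringℚ
      eq₁ : ∀ s x r g y → s * x * r * (g * y) ≡ (r * g) * (s * y * x)
      eq₁ = solve-∀ ringℚ
      eq₂ : ∀ r g m x y z → (r * g) * (m * (x * (x * y) * z)) ≡ m * (x * x) * ((y * g) * (z * r))
      eq₂ = solve-∀ ringℚ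

    k²≤ : ∀ {n} → 1 ℕ.≤ n → k n * k n ≤ 4ℚ * ι n
    k²≤ {suc n} _ = k²≤4n n

    -- Growth of `a` over distances of order √n.

    shiftConst : ℚ
    shiftConst = 2ℚ + 4ℚ * M₀ 1

    0≤shiftConst : 0ℚ ≤ shiftConst
    0≤shiftConst = +-nn 0≤2 (*-nn 0≤4 (0≤M₀ 1))

    -- Shifting the weights by `h ≤ k z` costs only a constant: the partial sums of `σ (h + j)` are
    -- at most `2 (h + X)²`, with increments at most `4 (k z + X + 1)`.
    shifted-sum≤ : ∀ h z → ι h ≤ k z → sum z (λ j → σ (h ℕ.+ j) * a (z ∸ suc j)) ≤ shiftConst * (k z * k z * a z)
    shifted-sum≤ h z h≤k = begin
      sum z (λ j → t j * a (z ∸ suc j)) ≤⟨ abel₂ z t (λ j → a (z ∸ suc j)) H hH (λ i → a∸-anti z (suc i)) (λ i → 0≤a (z ∸ suc i)) ⟩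
      H 0 * a (z ∸ 1) + sum z (λ i → (H (suc i) - H i) * a (z ∸ suc i)) ≤⟨ +-mono-≤ (*-mono (*-nn 0≤2 (*-nn h0 h0)) (*-monoˡ 0≤2 (*-mono h0 h0≤ h0 h0≤)) (0≤a (z ∸ 1)) (a∸-anti z 0))
           (sum-mono z λ i _ → *-monoʳ (0≤a (z ∸ suc i)) (incr i)) ⟩
      2ℚ * (k z * k z) * a z + sum z (λ i → 4ℚ * (k z + ι (suc i)) ^ 1 * a (z ∸ suc i)) ≡⟨ cong (2ℚ * (k z * k z) * a z +_) (trans (sum-cong z λ i _ → *-assoc 4ℚ ((k z + ι (suc i)) ^ 1) (a (z ∸ suc i))) (sum-*ˡ z 4ℚ _)) ⟩
      2ℚ * (k z * k z) * a z + 4ℚ * sum z (λ i → (k z + ι (suc i)) ^ 1 * a (z ∸ suc i)) ≤⟨ +-monoʳ-≤ (2ℚ * (k z * k z) * a z) (*-monoˡ 0≤4 (tail-moment 1 z)) ⟩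
      2ℚ * (k z * k z) * a z + 4ℚ * (M₀ 1 * (k z ^ 2 * a z)) ≡⟨ eq (k z) (a z) (M₀ 1) ⟩
      shiftConst * (k z * k z * a z) ∎
      where
      open ≤-Reasoning
      t H : ℕ → ℚ
      t j = σ (h ℕ.+ j)
      H X = 2ℚ * ((ι h + ι X) * (ι h + ι X))
      h0 : 0ℚ ≤ ι h + 0ℚ
      h0 = +-nn (ι-nn h) ≤-refl
      h0≤ : ι h + 0ℚ ≤ k z
      h0≤ = ≤-trans (≤-reflexive (+-identityʳ (ι h))) h≤k
      eq : ∀ x y m → 2ℚ * (x * x) * y + 4ℚ * (m * (x * (x * 1ℚ) * y)) ≡ (2ℚ + 4ℚ * m) * (x * x * y)
      eq = solve-∀ ringℚ
      eq₁ : ∀ x y z → 4ℚ * ((z + (y + 1ℚ)) * 1ℚ) - (2ℚ * ((x + (y + 1ℚ)) * (x + (y + 1ℚ))) - 2ℚ * ((x + y) * (x + y))) ≡ 4ℚ * (z - x) + 2ℚ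
      eq₁ = solve-∀ ringℚ
      incr : ∀ i → H (suc i) - H i ≤ 4ℚ * (k z + ι (suc i)) ^ 1
      incr i = ≤-by (+-nn (*-nn 0≤4 (-nn h≤k)) 0≤2) (eq₁ (ι h) (ι i) (k z))
      hH : ∀ X → sum X t ≤ H X
      hH X = begin
        sum X t ≤⟨ q≤p+q (sum-nn h λ i _ → 0≤σ i) ⟩
        sum h σ + sum X t ≡⟨ sym (sum-split h X σ) ⟩
        sum (h ℕ.+ X) σ ≤⟨ σ-sum (h ℕ.+ X) ⟩
        2ℚ * (ι (h ℕ.+ X) * ι (h ℕ.+ X)) ≡⟨ cong (λ x → 2ℚ * (x * x)) (ι-+ h X) ⟩
        H X ∎

    rec-split : ∀ h z → ι (h ℕ.+ z) * a (h ℕ.+ z) ≡ sum h (λ i → σ i * a (h ℕ.+ z ∸ suc i)) + sum z (λ j → σ (h ℕ.+ j) * a (z ∸ suc j))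
    rec-split h z = trans (rec (h ℕ.+ z)) (trans (sum-split h z _) (cong (sum h (λ i → σ i * a (h ℕ.+ z ∸ suc i)) +_)
      (sum-cong z λ j _ → cong (λ x → σ (h ℕ.+ j) * a x) (trans (cong (h ℕ.+ z ∸_) (sym (ℕₚ.+-suc h j))) (ℕₚ.[m+n]∸[m+o]≡n∸o h z (suc j))))))

    vConst : ℚ
    vConst = 4ℚ * (2ℚ + shiftConst)

    a-suc≤ : ∀ n → a (suc n) ≤ vConst * a n
    a-suc≤ n = *-cancelˡ (1≤⇒0< (1≤ι n)) (begin
      ι (suc n) * a (suc n) ≡⟨ rec-split 1 n ⟩
      0ℚ + σ 0 * a n + sum n (λ j → σ (1 ℕ.+ j) * a (n ∸ suc j)) ≤⟨ +-mono-≤ (+-monoʳ-≤ 0ℚ (*-monoʳ (0≤a n) σ0≤)) (shifted-sum≤ 1 n (≤-trans (≤-reflexive (+-identityˡ 1ℚ)) (1≤k n))) ⟩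
      0ℚ + 2ℚ * a n + shiftConst * (k n * k n * a n) ≤⟨ +-monoˡ-≤ (shiftConst * (k n * k n * a n)) (+-monoʳ-≤ 0ℚ (*-monoˡ 0≤2 (1*≤ (0≤a n) (≤-trans (1≤k n) (1*≤ (0≤k n) (1≤k n)))))) ⟩
      0ℚ + 2ℚ * (k n * k n * a n) + shiftConst * (k n * k n * a n) ≡⟨ eq (k n * k n * a n) shiftConst ⟩
      (2ℚ + shiftConst) * (k n * k n * a n) ≤⟨ *-monoˡ (+-nn 0≤2 0≤shiftConst) (*-monoʳ (0≤a n) (≤-trans (*-mono (0≤k n) (k-mono 1 n) (0≤k n) (k-mono 1 n)) (k²≤4n n))) ⟩
      (2ℚ + shiftConst) * (4ℚ * ι (suc n) * a n) ≡⟨ eq′ (2ℚ + shiftConst) (ι (suc n)) (a n) ⟩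
      ι (suc n) * (vConst * a n) ∎)
      where
      open ≤-Reasoning
      σ0≤ : σ 0 ≤ 2ℚ
      σ0≤ = ≤-trans (≤-reflexive (sym (+-identityˡ (σ 0)))) (≤-trans (σ-sum 1) (≤-reflexive (eq₀ 1ℚ)))
        where
        eq₀ : ∀ x → (1ℚ + 1ℚ) * ((0ℚ + 1ℚ) * (0ℚ + 1ℚ)) ≡ 1ℚ + 1ℚ
        eq₀ = solve-∀ ringℚ
      eq : ∀ x c → 0ℚ + 2ℚ * x + c * x ≡ (2ℚ + c) * x
      eq = solve-∀ ringℚ
      eq′ : ∀ c x y → c * (4ℚ * x * y) ≡ x * (4ℚ * c * y)
      eq′ = solve-∀ ringℚ

    dblConst : ℚ
    dblConst = 1ℚ + (4ℚ + 4ℚ) * shiftConst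

    1≤dblConst : 1ℚ ≤ dblConst
    1≤dblConst = p≤p+q (*-nn (+-nn 0≤4 0≤4) 0≤shiftConst)

    -- In the recurrence at `h + z`, jumps of length at most `h` have weight at most `2 h² ≤ z / 2`
    -- and are absorbed by the left side. Longer jumps land below `z` and cost a multiple of
    -- `k² * a z`, comparable with `z * a z`.
    doubling : ∀ h z → 1 ℕ.≤ z → 4ℚ * (ι h * ι h) ≤ ι z → a (h ℕ.+ z) ≤ dblConst * a z
    doubling h z 1≤z 4h²≤z = ≤-trans (*-cancelˡ 0<z (≤-by (+-nn (+-nn (*-nn 0≤2 (-nn main)) (*-nn (-nn 4h²≤z) (0≤a (h ℕ.+ z)))) (*-nn 0≤2 (*-nn (*-nn 0≤shiftConst (-nn (k²≤ 1≤z))) (0≤a z)))) (eq (ι z) (a (h ℕ.+ z)) (ι h) (a z) shiftConst (k z * k z))))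
        (*-monoʳ (0≤a z) (q≤p+q {1ℚ} {(4ℚ + 4ℚ) * shiftConst} 0≤1))
      where
      open ≤-Reasoning
      0<z : 0ℚ < ι z
      0<z = <-≤-trans 0<1 (≤-trans (≤-reflexive (sym (+-identityˡ 1ℚ))) (ι-mono 1≤z))
      h≤k : ι h ≤ k z
      h≤k = sq-cancel (0≤k z) (≤-trans (≤-trans (1*≤ (*-nn (ι-nn h) (ι-nn h)) (≤-trans (p≤p+q 0≤1) (p≤p+q 0≤2))) 4h²≤z) (n≤k² z))
      main : ι z * a (h ℕ.+ z) ≤ 2ℚ * (ι h * ι h) * a (h ℕ.+ z) + shiftConst * (k z * k z * a z)
      main = begin
        ι z * a (h ℕ.+ z) ≤⟨ *-monoʳ (0≤a (h ℕ.+ z)) (ι-mono (ℕₚ.m≤n+m z h)) ⟩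
        ι (h ℕ.+ z) * a (h ℕ.+ z) ≡⟨ rec-split h z ⟩
        sum h (λ i → σ i * a (h ℕ.+ z ∸ suc i)) + sum z (λ j → σ (h ℕ.+ j) * a (z ∸ suc j)) ≤⟨ +-mono-≤ (sum-mono h λ i _ → *-monoˡ (0≤σ i) (a-mono (ℕₚ.m∸n≤m (h ℕ.+ z) (suc i)))) (shifted-sum≤ h z h≤k) ⟩
        sum h (λ i → σ i * a (h ℕ.+ z)) + shiftConst * (k z * k z * a z) ≡⟨ cong (_+ shiftConst * (k z * k z * a z)) (trans (sum-cong h λ i _ → *-comm (σ i) (a (h ℕ.+ z))) (trans (sum-*ˡ h (a (h ℕ.+ z)) σ) (*-comm (a (h ℕ.+ z)) (sum h σ)))) ⟩
        sum h σ * a (h ℕ.+ z) + shiftConst * (k z * k z * a z) ≤⟨ +-monoˡ-≤ (shiftConst * (k z * k z * a z)) (*-monoʳ (0≤a (h ℕ.+ z)) (σ-sum h)) ⟩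
        2ℚ * (ι h * ι h) * a (h ℕ.+ z) + shiftConst * (k z * k z * a z) ∎
      eq : ∀ z A h a c q → z * ((4ℚ + 4ℚ) * c * a) - z * A ≡ 2ℚ * (2ℚ * (h * h) * A + c * (q * a) - z * A) + (z - 4ℚ * (h * h)) * A + 2ℚ * (c * (4ℚ * z - q) * a)
      eq = solve-∀ ringℚ

    doubling^ : ∀ j h z → 1 ℕ.≤ z → 4ℚ * (ι h * ι h) ≤ ι z → a (j ℕ.* h ℕ.+ z) ≤ dblConst ^ j * a z
    doubling^ zero h z _ _ = ≤-reflexive (sym (*-identityˡ (a z)))
    doubling^ (suc j) h z 1≤z le = begin
      a (h ℕ.+ j ℕ.* h ℕ.+ z) ≡⟨ cong a (ℕₚ.+-assoc h (j ℕ.* h) z) ⟩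
      a (h ℕ.+ (j ℕ.* h ℕ.+ z)) ≤⟨ doubling h (j ℕ.* h ℕ.+ z) (ℕₚ.≤-trans 1≤z (ℕₚ.m≤n+m z (j ℕ.* h))) (≤-trans le (ι-mono (ℕₚ.m≤n+m z (j ℕ.* h)))) ⟩
      dblConst * a (j ℕ.* h ℕ.+ z) ≤⟨ *-monoˡ (1≤⇒0≤ 1≤dblConst) (doubling^ j h z 1≤z le) ⟩
      dblConst * (dblConst ^ j * a z) ≡⟨ sym (*-assoc dblConst (dblConst ^ j) (a z)) ⟩
      dblConst ^ suc j * a z ∎
      where open ≤-Reasoning

    near-ratio : ∀ L m y → 8 ℕ.≤ κ (m ℕ.+ y) → m ℕ.≤ L ℕ.* κ (m ℕ.+ y) → ι (m ℕ.+ y) ≤ 2ℚ * ι y → a (m ℕ.+ y) ≤ dblConst ^ (L ℕ.* 16) * a y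
    near-ratio L m zero 8≤κ _ n≤2y = ⊥-elim (<-irrefl refl (<-≤-trans 0<1 (≤-trans (≤-trans (≤-reflexive (sym (+-identityˡ 1ℚ))) (ι-mono 1≤n)) (≤-trans n≤2y (≤-reflexive (*-zeroʳ 2ℚ))))))
      where
      1≤n : 1 ℕ.≤ m ℕ.+ 0
      1≤n = 2≤κ⇒1≤n (ℕₚ.≤-trans (s≤s (s≤s z≤n)) 8≤κ)
    near-ratio L m y@(suc y′) 8≤κ m≤Lκ n≤2y = ≤-trans (a-mono (ℕₚ.+-monoˡ-≤ y m≤)) (doubling^ (L ℕ.* 16) h y (s≤s z≤n) le)
      where
      n = m ℕ.+ y
      -- From `8 h ≤ k n` and `k² ≤ 4 n ≤ 8 y` follows `4 h² ≤ y`, as `doubling` requires;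
      -- `k n ≤ 16 h` bounds the number of steps by `16 L`.
      h = proj₁ (fraction 8 (κ n) (s≤s z≤n) 8≤κ)
      8h≤κ : 8 ℕ.* h ℕ.≤ κ n
      8h≤κ = proj₁ (proj₂ (fraction 8 (κ n) (s≤s z≤n) 8≤κ))
      κ≤16h : κ n ℕ.≤ 16 ℕ.* h
      κ≤16h = proj₂ (proj₂ (fraction 8 (κ n) (s≤s z≤n) 8≤κ))
      m≤ : m ℕ.≤ L ℕ.* 16 ℕ.* h
      m≤ = ℕₚ.≤-trans m≤Lκ (ℕₚ.≤-trans (ℕₚ.*-monoʳ-≤ L κ≤16h) (ℕₚ.≤-reflexive (sym (ℕₚ.*-assoc L 16 h))))
      1≤n : 1 ℕ.≤ n
      1≤n = ℕₚ.≤-trans (s≤s z≤n) (ℕₚ.m≤n+m y m)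
      8h≤k : ι 8 * ι h ≤ k n
      8h≤k = ≤-trans (≤-reflexive (sym (ι-* 8 h))) (ι-mono 8h≤κ)
      64h²≤ : ι 8 * ι h * (ι 8 * ι h) ≤ 4ℚ * (2ℚ * ι y)
      64h²≤ = ≤-trans (*-mono (*-nn (ι-nn 8) (ι-nn h)) 8h≤k (*-nn (ι-nn 8) (ι-nn h)) 8h≤k) (≤-trans (k²≤ 1≤n) (*-monoˡ 0≤4 n≤2y))
      le : 4ℚ * (ι h * ι h) ≤ ι y
      le = *-cancelˡ (*-pos (1≤⇒0< (≤-trans (p≤p+q 0≤1) (p≤p+q 0≤2))) (1≤⇒0< (p≤p+q {1ℚ} 0≤1))) (≤-by (+-nn (-nn 64h²≤) (*-nn (*-nn (*-nn 0≤4 0≤4) 0≤2) (*-nn (ι-nn h) (ι-nn h)))) (eq (ι y) (ι h)))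
        where
        eq : ∀ y h → 4ℚ * 2ℚ * y - 4ℚ * 2ℚ * (4ℚ * (h * h)) ≡ 4ℚ * (2ℚ * y) - ι 8 * h * (ι 8 * h) + 4ℚ * 4ℚ * 2ℚ * (h * h)
        eq = solve-∀ ringℚ

    -- The smooth part of the jump law carries at least half of the mass: by `abel₂` the weights `σ`
    -- may be replaced by the increments of `2 X²`, which are at most twice `2 (i + 1)`.
    overlapMass : ∀ n → ι n ≤ 2ℚ * sum n (λ i → 2ℚ * ι (suc i) * a (n ∸ suc i) * r n)
    overlapMass n = begin
      ι n ≡⟨ trans (sym (*-identityʳ (ι n))) (trans (cong (ι n *_) (sym (ar n))) (sym (*-assoc (ι n) (a n) (r n)))) ⟩
      ι n * a n * r n ≡⟨ cong (_* r n) (rec n) ⟩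
      sum n (λ i → σ i * a (n ∸ suc i)) * r n ≤⟨ *-monoʳ (0≤r n) (abel₂ n σ (λ i → a (n ∸ suc i)) H σ-sum (λ i → a∸-anti n (suc i)) (λ i → 0≤a (n ∸ suc i))) ⟩
      (H 0 * a (n ∸ 1) + sum n (λ i → (H (suc i) - H i) * a (n ∸ suc i))) * r n ≤⟨ *-monoʳ (0≤r n) (+-mono-≤ (≤-reflexive (eq₀ (a (n ∸ 1)))) (sum-mono n λ i _ → *-monoʳ (0≤a (n ∸ suc i)) (incr i))) ⟩
      (0ℚ + sum n (λ i → 2ℚ * (2ℚ * ι (suc i)) * a (n ∸ suc i))) * r n ≡⟨ trans (cong (_* r n) (+-identityˡ S)) (trans (*-comm S (r n)) (trans (sym (sum-*ˡ n (r n) _)) (trans (sum-cong n (λ i _ → eq (r n) (ι (suc i)) (a (n ∸ suc i)))) (sum-*ˡ n 2ℚ _)))) ⟩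
      2ℚ * sum n (λ i → 2ℚ * ι (suc i) * a (n ∸ suc i) * r n) ∎
      where
      open ≤-Reasoning
      H : ℕ → ℚ
      H X = 2ℚ * (ι X * ι X)
      S = sum n (λ i → 2ℚ * (2ℚ * ι (suc i)) * a (n ∸ suc i))
      eq₀ : ∀ x → 2ℚ * (0ℚ * 0ℚ) * x ≡ 0ℚ
      eq₀ = solve-∀ ringℚ
      eq : ∀ r x y → r * (2ℚ * (2ℚ * x) * y) ≡ 2ℚ * (2ℚ * x * y * r)
      eq = solve-∀ ringℚ
      eq₁ : ∀ x → 2ℚ * (2ℚ * (x + 1ℚ)) - (2ℚ * ((x + 1ℚ) * (x + 1ℚ)) - 2ℚ * (x * x)) ≡ 2ℚ
      eq₁ = solve-∀ ringℚ
      incr : ∀ i → H (suc i) - H i ≤ 2ℚ * (2ℚ * ι (suc i))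
      incr i = ≤-by 0≤2 (eq₁ (ι i))

    wt≤σ : ∀ n i → wt n i ≤ σ i
    wt≤σ n i = begin
      σ i * a (n ∸ suc i) * r n ≤⟨ *-monoʳ (0≤r n) (*-monoˡ (0≤σ i) (a-mono (ℕₚ.m∸n≤m n (suc i)))) ⟩
      σ i * a n * r n ≡⟨ trans (*-assoc (σ i) (a n) (r n)) (trans (cong (σ i *_) (ar n)) (*-identityʳ (σ i))) ⟩
      σ i ∎
      where open ≤-Reasoning

    drift-aux : ∀ X n′ (F : ℕ → ℚ) → let n = X ℕ.+ n′ in (∀ i → 0ℚ ≤ F i) → (∀ i → X ℕ.≤ i → ι X ≤ F i) →
      ι n * ι X ≤ W n F + ι X * (2ℚ * (ι X * ι X))
    drift-aux X n′ F 0≤F X≤F = begin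
      ι n * ι X ≡⟨ sym (W-const n (ι X)) ⟩
      W n (λ _ → ι X) ≡⟨ sum-split X n′ _ ⟩
      sum X (λ i → wt n i * ι X) + sum n′ (λ j → wt n (X ℕ.+ j) * ι X) ≤⟨ +-mono-≤ (sum-mono X λ i _ → *-monoʳ (ι-nn X) (wt≤σ n i)) (sum-mono n′ λ j _ → *-monoˡ (0≤wt n (X ℕ.+ j)) (X≤F (X ℕ.+ j) (ℕₚ.m≤m+n X j))) ⟩
      sum X (λ i → σ i * ι X) + S ≡⟨ cong (_+ S) (trans (sum-cong X λ i _ → *-comm (σ i) (ι X)) (sum-*ˡ X (ι X) σ)) ⟩
      ι X * sum X σ + S ≤⟨ +-mono-≤ (*-monoˡ (ι-nn X) (σ-sum X)) (≤-trans (q≤p+q (sum-nn X λ i _ → *-nn (0≤wt n i) (0≤F i))) (≤-reflexive (sym (sum-split X n′ _)))) ⟩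
      ι X * (2ℚ * (ι X * ι X)) + W n F ≡⟨ +-comm (ι X * (2ℚ * (ι X * ι X))) (W n F) ⟩
      W n F + ι X * (2ℚ * (ι X * ι X)) ∎
      where
      open ≤-Reasoning
      n = X ℕ.+ n′
      S = sum n′ (λ j → wt n (X ℕ.+ j) * F (X ℕ.+ j))

    -- Take `X` between `k / 8` and `k / 4`. Jumps up to `X` have mass at most `2 X² ≤ n / 2`,
    -- because `wt ≤ σ`; the remaining half moves by at least `X`, and truncation at `m ≥ κ n ≥ X`
    -- does not affect this.
    drift : ∀ n m → 4 ℕ.≤ κ n → κ n ℕ.≤ m → k n * ι n ≤ 4ℚ * 4ℚ * W n (λ i → ι (suc i ℕ.⊓ m))
    drift n m 4≤κ κ≤m = ≤-by (+-nn (+-nn (*-nn (*-nn 0≤4 0≤4) (-nn main)) (*-nn (ι-nn n) (-nn k≤8X))) (*-nn (*-nn 0≤2 (ι-nn X)) (+-nn (-nn (k²≤ 1≤n)) (-nn (*-mono (*-nn 0≤4 (ι-nn X)) 4X≤k (*-nn 0≤4 (ι-nn X)) 4X≤k)))))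
        (eq (k n) (ι n) (W n F) (ι X))
      where
      F : ℕ → ℚ
      F i = ι (suc i ℕ.⊓ m)
      fr = fraction 4 (κ n) (s≤s z≤n) 4≤κ
      X = proj₁ fr
      4X≤k : 4ℚ * ι X ≤ k n
      4X≤k = ≤-trans (≤-reflexive (sym (ι-* 4 X))) (ι-mono (proj₁ (proj₂ fr)))
      k≤8X : k n ≤ (4ℚ + 4ℚ) * ι X
      k≤8X = ≤-trans (ι-mono (proj₂ (proj₂ fr))) (≤-reflexive (ι-* 8 X))
      1≤n : 1 ℕ.≤ n
      1≤n = 2≤κ⇒1≤n (ℕₚ.≤-trans (s≤s (s≤s z≤n)) 4≤κ)
      X≤κ : X ℕ.≤ κ n
      X≤κ = ℕₚ.≤-trans (ℕₚ.m≤m+n X (3 ℕ.* X)) (proj₁ (proj₂ fr))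
      k≤n : k n ≤ ι n
      k≤n = *-cancelˡ (1≤⇒0< (≤-trans (p≤p+q 0≤1) (p≤p+q 0≤2))) (≤-trans (*-monoʳ (0≤k n) (ι-mono 4≤κ)) (k²≤ 1≤n))
      X≤n : X ℕ.≤ n
      X≤n = ι-reflect (≤-trans (ι-mono X≤κ) k≤n)
      main : ι n * ι X ≤ W n F + ι X * (2ℚ * (ι X * ι X))
      main = subst (λ z → ι z * ι X ≤ W z F + ι X * (2ℚ * (ι X * ι X))) (ℕₚ.m+[n∸m]≡n X≤n) (drift-aux X (n ∸ X) F (λ i → ι-nn (suc i ℕ.⊓ m)) λ i X≤i → ι-mono (ℕₚ.⊓-glb (ℕₚ.m≤n⇒m≤1+n X≤i) (ℕₚ.≤-trans X≤κ κ≤m)))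
      eq : ∀ k n w x → 4ℚ * 4ℚ * w - k * n ≡ 4ℚ * 4ℚ * (w + x * (2ℚ * (x * x)) - n * x) + n * ((4ℚ + 4ℚ) * x - k) + 2ℚ * x * (4ℚ * n - k * k + (k * k - 4ℚ * x * (4ℚ * x)))
      eq = solve-∀ ringℚ

    -- Comparing the scale at two points.

    g′-diff : ∀ m y → g y - g (m ℕ.+ y) ≤ ω (m ℕ.+ y) m * g (m ℕ.+ y) * g y
    g′-diff m y = ≤-by (*-nn (-nn (k≤k′+ω m y)) (*-nn (0≤g n) (0≤g y))) (sym (trans (eq (k n) (k y) (ω n m) (g n) (g y)) (trans (cong₂ (λ u v → u * g n + ω n m * g n * g y - v * g y) (kg y) (kg n)) (eq′ (g n) (g y) (ω n m)))))
      where
      n = m ℕ.+ y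
      eq : ∀ a b w x y → (b + w - a) * (x * y) ≡ b * y * x + w * x * y - a * x * y
      eq = solve-∀ ringℚ
      eq′ : ∀ x y w → 1ℚ * x + w * x * y - 1ℚ * y ≡ w * x * y - (y - x)
      eq′ = solve-∀ ringℚ

    g′≤ : ∀ m y → g y ≤ 2ℚ * ω (m ℕ.+ y) m * g (m ℕ.+ y)
    g′≤ m y = ≤-by (+-nn (+-nn (-nn (g′-diff m y)) (*-nn (*-nn (0≤ω n m) (0≤g n)) (-nn (g≤1 y)))) (*-nn (-nn (1≤ω n m)) (0≤g n))) (eq (g n) (g y) (ω n m))
      where
      n = m ℕ.+ y
      eq : ∀ x y w → 2ℚ * w * x - y ≡ (w * x * y - (y - x)) + w * x * (1ℚ - y) + (w - 1ℚ) * x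
      eq = solve-∀ ringℚ

    g′^≤ : ∀ d m y → g y ^ d ≤ 2ℚ ^ d * ω (m ℕ.+ y) m ^ d * g (m ℕ.+ y) ^ d
    g′^≤ d m y = ≤-trans (^-mono (0≤g y) (g′≤ m y) d) (≤-reflexive (trans (*-^ (2ℚ * ω (m ℕ.+ y) m) (g (m ℕ.+ y)) d) (cong (_* g (m ℕ.+ y) ^ d) (*-^ 2ℚ (ω (m ℕ.+ y) m) d))))

    g′^-diff : ∀ d m y → g y ^ d - g (m ℕ.+ y) ^ d ≤ ι d * (ω (m ℕ.+ y) m * g (m ℕ.+ y)) * g y ^ d
    g′^-diff zero m y = ≤-reflexive (eq (ω (m ℕ.+ y) m) (g (m ℕ.+ y)))
      where
      eq : ∀ x y → 1ℚ - 1ℚ ≡ 0ℚ * (x * y) * 1ℚ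
      eq = solve-∀ ringℚ
    g′^-diff (suc d) m y = ≤-trans (^-diff (0≤g n) (g-anti m y) d) (≤-by (*-nn (*-nn (ι-nn (suc d)) (-nn (g′-diff m y))) (^-nn (0≤g y) d)) (eq (ι (suc d)) (ω n m) (g n) (g y) (g y ^ d)))
      where
      n = m ℕ.+ y
      eq : ∀ i w x y p → i * (w * x) * (y * p) - i * (y - x) * p ≡ i * (w * x * y - (y - x)) * p
      eq = solve-∀ ringℚ

    C₁ C₂ : ℕ → ℚ
    C₁ d = ι d * 2ℚ ^ d
    C₂ d = 2ℚ ^ suc d

    0≤C₁ : ∀ d → 0ℚ ≤ C₁ d
    0≤C₁ d = *-nn (ι-nn d) (^-nn 0≤2 d)

    0≤C₂ : ∀ d → 0ℚ ≤ C₂ d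
    0≤C₂ d = ^-nn 0≤2 (suc d)

    -- Expresses the distance function of the coupling argument at the scale of the upper point `n`.
    -- The excess over `g n ^ d` carries the factor `C₁ d * g n + β * C₂ d`, small once `n` is large
    -- and `β` small, so the gain from coupling can pay for it.
    spread : ∀ d {β} m y → 0ℚ ≤ β → let n = m ℕ.+ y in
      g y ^ d + β * (ι m * g y ^ suc d) ≤ g n ^ d + g n ^ d * (C₁ d * g n + β * C₂ d) * ω n m ^ suc (suc d)
    spread d {β} m y 0≤β = ≤-by (+-nn (+-nn (+-nn (-nn (g′^-diff d m y)) (*-nn (*-nn (ι-nn d) (*-nn 0≤w (0≤g n))) (-nn (g′^≤ d m y)))) (*-nn (*-nn (0≤C₁ d) (*-nn (^-nn (0≤g n) d) (0≤g n))) (*-nn (^-nn 0≤w (suc d)) (-nn (1≤ω n m)))))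
        (+-nn (*-nn 0≤β (*-nn (ι-nn m) (-nn (g′^≤ (suc d) m y)))) (*-nn (*-nn 0≤β (0≤C₂ d)) (*-nn (^-nn (0≤g n) d) (^-nn 0≤w (suc d))))))
        (eq (g y ^ d) (g y ^ suc d) β (ι m) (g n ^ d) (g n) (ι d) (2ℚ ^ d) (ω n m ^ d))
      where
      n = m ℕ.+ y
      0≤w = 0≤ω n m
      eq : ∀ p p′ b m q x i t v → let w = 1ℚ + m * x in
        q + q * (i * t * x + b * (2ℚ * t)) * (w * (w * v)) - (p + b * (m * p′))
        ≡ (i * (w * x) * p - (p - q)) + i * (w * x) * (t * v * q - p) + i * t * (q * x) * (w * v * (w - 1ℚ))
          + (b * (m * (2ℚ * t * (w * v) * (x * q) - p′)) + b * (2ℚ * t) * (q * (w * v)))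
      eq = solve-∀ ringℚ

    argmax : ∀ n (u : ℕ → ℚ) → ∃[ z ] (z ℕ.≤ n × (∀ x → x ℕ.≤ n → u x ≤ u z))
    argmax zero u = 0 , z≤n , λ { zero z≤n → ≤-refl }
    argmax (suc n) u with argmax n u
    ... | z , z≤n′ , h with ≤-total (u z) (u (suc n))
    ... | inj₁ le = suc n , ℕₚ.≤-refl , λ x x≤ → case x x≤
      where
      case : ∀ x → x ℕ.≤ suc n → u x ≤ u (suc n)
      case x x≤ with ℕₚ.m≤n⇒m<n∨m≡n x≤
      ... | inj₁ (s≤s x≤n) = ≤-trans (h x x≤n) le
      ... | inj₂ refl = ≤-refl
    ... | inj₂ ge = z , ℕₚ.m≤n⇒m≤1+n z≤n′ , λ x x≤ → case x x≤
      where
      case : ∀ x → x ℕ.≤ suc n → u x ≤ u z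
      case x x≤ with ℕₚ.m≤n⇒m<n∨m≡n x≤
      ... | inj₁ (s≤s x≤n) = h x x≤n
      ... | inj₂ refl = ge

    -- Turns a pairwise oscillation bound into one level `h` for all points, so that two averages
    -- can be compared with the same constant. The level is the maximum of `f - X`.
    band : ∀ n (f X : ℕ → ℚ) c → (∀ z z′ → z ℕ.≤ n → z′ ℕ.≤ n → f z ≤ f z′ + (c + (X z + X z′))) →
      ∃[ h ] ((∀ z → z ℕ.≤ n → f z ≤ h + X z) × (∀ z → z ℕ.≤ n → h - c - X z ≤ f z))
    band n f X c hyp with argmax n (λ z → f z - X z)
    ... | z₀ , z₀≤n , mx = f z₀ - X z₀ , (λ z z≤ → ≤-by (-nn (mx z z≤)) (eq₁ (f z₀) (X z₀) (f z) (X z))) , (λ z z≤ → ≤-by (-nn (hyp z₀ z z₀≤n z≤)) (eq₂ (f z₀) (X z₀) (f z) (X z) c))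
      where
      eq₁ : ∀ a b x y → a - b + y - x ≡ a - b - (x - y)
      eq₁ = solve-∀ ringℚ
      eq₂ : ∀ a b x y c → x - (a - b - c - y) ≡ x + (c + (b + y)) - a
      eq₂ = solve-∀ ringℚ

    -- The generator of the jump chain, multiplied by `n` because `W n` has mass `ι n`.
    𝓛 : (ℕ → ℚ) → ℕ → ℚ
    𝓛 f n = W n (λ i → f (n ∸ suc i) - f n)

    𝓛-eq : ∀ f n → ι n * f n ≡ W n (λ i → f (n ∸ suc i)) - 𝓛 f n
    𝓛-eq f n = begin
      ι n * f n ≡⟨ sym (W-const n (f n)) ⟩
      W n (λ _ → f n) ≡⟨ eq (W n (λ _ → f n)) (𝓛 f n) ⟩
      (𝓛 f n + W n (λ _ → f n)) - 𝓛 f n ≡⟨ cong (_- 𝓛 f n) (sym (W-+ n (λ i → f (n ∸ suc i) - f n) (λ _ → f n))) ⟩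
      W n (λ i → f (n ∸ suc i) - f n + f n) - 𝓛 f n ≡⟨ cong (_- 𝓛 f n) (sum-cong n λ i _ → cong (wt n i *_) (eq′ (f (n ∸ suc i)) (f n))) ⟩
      W n (λ i → f (n ∸ suc i)) - 𝓛 f n ∎
      where
      open ≡-Reasoning
      eq : ∀ x y → x ≡ (y + x) - y
      eq = solve-∀ ringℚ
      eq′ : ∀ x y → x - y + y ≡ x
      eq′ = solve-∀ ringℚ

    spread′ : ∀ d {β} n z → 0ℚ ≤ β → z ℕ.≤ n →
      g z ^ d + β * (ι (n ∸ z) * g z ^ suc d) ≤ g n ^ d + g n ^ d * (C₁ d * g n + β * C₂ d) * ω n (n ∸ z) ^ suc (suc d)
    spread′ d {β} n z 0≤β z≤n′ = subst (λ N → g z ^ d + β * (ι (n ∸ z) * g z ^ suc d) ≤ g N ^ d + g N ^ d * (C₁ d * g N + β * C₂ d) * ω N (n ∸ z) ^ suc (suc d)) (ℕₚ.m∸n+n≡m z≤n′) (spread d (n ∸ z) z 0≤β)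

    -- Coupling: oscillation of almost harmonic functions.

    16ℚ 64ℚ 128ℚ 256ℚ : ℚ
    16ℚ = 4ℚ * 4ℚ
    64ℚ = 4ℚ * 16ℚ
    128ℚ = 2ℚ * 64ℚ
    256ℚ = 4ℚ * 64ℚ

    0≤16 : 0ℚ ≤ 16ℚ
    0≤16 = *-nn 0≤4 0≤4
    0≤64 : 0ℚ ≤ 64ℚ
    0≤64 = *-nn 0≤4 0≤16
    0≤128 : 0ℚ ≤ 128ℚ
    0≤128 = *-nn 0≤2 0≤64

    0<2 : 0ℚ < 2ℚ
    0<2 = <-≤-trans 0<1 (p≤p+q 0≤1)
    0<4 : 0ℚ < 4ℚ
    0<4 = <-≤-trans 0<2 (p≤p+q 0≤2)
    0<128 : 0ℚ < 128ℚ
    0<128 = *-pos 0<2 (*-pos 0<4 (*-pos 0<4 0<4))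

    -- The constants are chosen in the order L (drift beats overshooting), Q and q (coupling over distance L κ), β, N₀, K.
    record Constants (d : ℕ) (B E : ℚ) : Set where
      field
        L N₀ : ℕ
        l q Q Λ Λ′ β K M₂ M₃ : ℚ
        1≤L : 1 ℕ.≤ L
        0≤l : 0ℚ ≤ l
        l≤1 : l ≤ 1ℚ
        lL : l * ι L ≡ 1ℚ
        0≤q : 0ℚ ≤ q
        q≤1 : q ≤ 1ℚ
        qQ : q * Q ≡ 1ℚ
        ratio≤Q : ∀ m y → 8 ℕ.≤ κ (m ℕ.+ y) → m ℕ.≤ L ℕ.* κ (m ℕ.+ y) → ι (m ℕ.+ y) ≤ 2ℚ * ι y → a (m ℕ.+ y) ≤ Q * a y
        1≤Λ : 1ℚ ≤ Λ
        1≤Λ′ : 1ℚ ≤ Λ′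
        Λ-pow : (1ℚ + ι L) ^ suc (suc d) ≤ Λ
        Λ′-pow : 2ℚ ^ d * (1ℚ + ι L) ^ d ≤ Λ′
        0≤β : 0ℚ ≤ β
        0≤K : 0ℚ ≤ K
        0≤M₂ : 0ℚ ≤ M₂
        0≤M₃ : 0ℚ ≤ M₃
        moment₂ : ∀ n → W n (λ i → ω n (suc i) ^ suc (suc d)) ≤ M₂ * (k n * k n)
        moment₃ : ∀ n → W n (λ i → ω n (suc i) ^ suc (suc (suc d))) ≤ M₃ * (k n * k n)
        L-large : 256ℚ * (M₃ * C₂ d) * l ≤ 1ℚ
        β-small : 128ℚ * (β * (C₂ d * (M₂ * Λ))) ≤ q
        g-small₁ : ∀ n → N₀ ℕ.≤ κ n → 256ℚ * (M₃ * C₁ d) * g n ≤ β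
        g-small₂ : ∀ n → N₀ ℕ.≤ κ n → 128ℚ * (C₁ d * (M₂ * Λ)) * g n ≤ q
        8L≤N₀ : 8 ℕ.* L ℕ.≤ N₀
        Kβ : 128ℚ * E ≤ K * β
        Kq : 64ℚ * (E * Λ′) ≤ K * q
        K-small : 2ℚ * B * ι N₀ ^ d ≤ K

    *inv* : ∀ {x} y → 0ℚ < x → y * inv x * x ≡ y
    *inv* {x} y h = trans (*-assoc y (inv x) x) (trans (cong (y *_) (inv-l h)) (*-identityʳ y))

    -- Doeblin splitting: the part `q * o` of the weight keeps the exact sum of `φ`, and only the
    -- rest is estimated by the level `h`. The exact part later cancels between the two points.
    overlap-upper : ∀ x (w o φ X : ℕ → ℚ) h q → 0ℚ ≤ q → (∀ i → 0ℚ ≤ o i) → (∀ i → 0ℚ ≤ X i) → (∀ i → q * o i ≤ w i) → (∀ i → φ i ≤ h + X i) →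
      sum x (λ i → w i * φ i) ≤ sum x (λ i → w i * (h + X i)) + q * (sum x (λ i → o i * φ i) - h * sum x o)
    overlap-upper zero w o φ X h q 0≤q 0≤o 0≤X o≤w φ≤ = ≤-reflexive (eq h q)
      where
      eq : ∀ h q → 0ℚ ≡ 0ℚ + q * (0ℚ - h * 0ℚ)
      eq = solve-∀ ringℚ
    overlap-upper (suc x) w o φ X h q 0≤q 0≤o 0≤X o≤w φ≤ =
      ≤-by (+-nn (-nn (overlap-upper x w o φ X h q 0≤q 0≤o 0≤X o≤w φ≤)) (+-nn (*-nn (-nn (o≤w x)) (-nn (φ≤ x))) (*-nn (*-nn 0≤q (0≤o x)) (0≤X x))))
        (eq (sum x (λ i → w i * φ i)) (sum x (λ i → w i * (h + X i))) (sum x (λ i → o i * φ i)) (sum x o) h q (w x) (o x) (φ x) (X x))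
      where
      eq : ∀ S T F O h q w o f X → T + w * (h + X) + q * (F + o * f - h * (O + o)) - (S + w * f)
        ≡ T + q * (F - h * O) - S + ((w - q * o) * (h + X - f) + q * o * X)
      eq = solve-∀ ringℚ

    overlap-lower : ∀ x (w o φ X : ℕ → ℚ) h q → 0ℚ ≤ q → (∀ i → 0ℚ ≤ o i) → (∀ i → 0ℚ ≤ X i) → (∀ i → q * o i ≤ w i) → (∀ i → h - X i ≤ φ i) →
      sum x (λ i → w i * (h - X i)) + q * (sum x (λ i → o i * φ i) - h * sum x o) ≤ sum x (λ i → w i * φ i)
    overlap-lower zero w o φ X h q 0≤q 0≤o 0≤X o≤w φ≥ = ≤-reflexive (eq h q)
      where
      eq : ∀ h q → 0ℚ + q * (0ℚ - h * 0ℚ) ≡ 0ℚ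
      eq = solve-∀ ringℚ
    overlap-lower (suc x) w o φ X h q 0≤q 0≤o 0≤X o≤w φ≥ =
      ≤-by (+-nn (-nn (overlap-lower x w o φ X h q 0≤q 0≤o 0≤X o≤w φ≥)) (+-nn (*-nn (-nn (o≤w x)) (-nn (φ≥ x))) (*-nn (*-nn 0≤q (0≤o x)) (0≤X x))))
        (eq (sum x (λ i → w i * φ i)) (sum x (λ i → w i * (h - X i))) (sum x (λ i → o i * φ i)) (sum x o) h q (w x) (o x) (φ x) (X x))
      where
      eq : ∀ S T F O h q w o f X → S + w * f - (T + w * (h - X) + q * (F + o * f - h * (O + o)))
        ≡ S - (T + q * (F - h * O)) + ((w - q * o) * (f - (h - X)) + q * o * X)
      eq = solve-∀ ringℚ

    W-shift : ∀ n (X : ℕ → ℚ) h → W n (λ i → h + X i) ≡ ι n * h + W n X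
    W-shift n X h = trans (W-+ n (λ _ → h) X) (cong (_+ W n X) (W-const n h))

    W-shift⁻ : ∀ n (X : ℕ → ℚ) h → W n (λ i → h - X i) ≡ ι n * h - W n X
    W-shift⁻ n X h = trans (sum-cong n λ i _ → cong (λ z → wt n i * (h + z)) (eq (X i))) (trans (W-shift n (λ i → (- 1ℚ) * X i) h) (cong (ι n * h +_) (trans (W-*ˡ n (- 1ℚ) X) (sym (eq (W n X))))))
      where
      eq : ∀ x → - x ≡ (- 1ℚ) * x
      eq = solve-∀ ringℚ

    half-pos : ∀ {n} y → 1 ℕ.≤ n → ι n ≤ 2ℚ * ι y → 1 ℕ.≤ y
    half-pos zero 1≤n h = ⊥-elim (<-irrefl refl (<-≤-trans 0<1 (≤-trans (≤-trans (≤-reflexive (sym (+-identityˡ 1ℚ))) (ι-mono 1≤n)) (≤-trans h (≤-reflexive (*-zeroʳ 2ℚ))))))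
    half-pos (suc y) _ _ = s≤s z≤n

    𝓛-neg : ∀ f n → 𝓛 (λ z → - f z) n ≡ - 𝓛 f n
    𝓛-neg f n = trans (sum-cong n λ i _ → cong (wt n i *_) (eq (f (n ∸ suc i)) (f n))) (trans (W-*ˡ n (- 1ℚ) (λ i → f (n ∸ suc i) - f n)) (eq′ (𝓛 f n)))
      where
      eq : ∀ x y → - x - (- y) ≡ (- 1ℚ) * (x - y)
      eq = solve-∀ ringℚ
      eq′ : ∀ x → (- 1ℚ) * x ≡ - x
      eq′ = solve-∀ ringℚ

    module Contraction (d : ℕ) (f : ℕ → ℚ) (B E : ℚ) (0≤B : 0ℚ ≤ B) (0≤E : 0ℚ ≤ E) (f≤B : ∀ n → ∣ f n ∣ ≤ B)
      (𝓛f≤ : ∀ n → ∣ 𝓛 f n ∣ ≤ E * (g n ^ d * (k n * k n))) (C : Constants d B E) where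
      open Constants C

      D₂ D₃ : ℕ
      D₂ = suc (suc d)
      D₃ = suc D₂

      c₁ c₂ : ℚ
      c₁ = C₁ d
      c₂ = C₂ d

      -- Harris' argument: for distant points Φ decreases on average when only the larger point jumps, because of the
      -- drift; for nearby points both jump and coincide with probability at least q/4, which beats the slope β of Φ.
      Φ : ℕ → ℕ → ℚ
      Φ y m = g y ^ d + β * (ι m * g y ^ suc d)

      0≤g^ : ∀ n e → 0ℚ ≤ g n ^ e
      0≤g^ n = ^-nn (0≤g n)

      g^≤Φ : ∀ y m → g y ^ d ≤ Φ y m
      g^≤Φ y m = p≤p+q (*-nn 0≤β (*-nn (ι-nn m) (0≤g^ y (suc d))))

      Bound : ℕ → Set
      Bound n = ∀ m y → m ℕ.+ y ≡ n → ∣ f n - f y ∣ ≤ K * Φ y m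

      small : ∀ m y → κ (m ℕ.+ y) ℕ.≤ N₀ → ∣ f (m ℕ.+ y) - f y ∣ ≤ K * Φ y m
      small m y κ≤N₀ = begin
        ∣ f (m ℕ.+ y) - f y ∣ ≤⟨ ≤-trans (abs-sub (f (m ℕ.+ y)) (f y)) (+-mono-≤ (f≤B (m ℕ.+ y)) (f≤B y)) ⟩
        B + B ≡⟨ eq B ⟩
        2ℚ * B * 1ℚ ≤⟨ *-monoˡ (*-nn 0≤2 0≤B) (1≤^ (≤-trans (≤-reflexive (sym (kg y))) (*-monoʳ (0≤g y) (≤-trans (k-mono m y) (ι-mono κ≤N₀)))) d) ⟩
        2ℚ * B * (ι N₀ * g y) ^ d ≡⟨ trans (cong (2ℚ * B *_) (*-^ (ι N₀) (g y) d)) (sym (*-assoc (2ℚ * B) (ι N₀ ^ d) (g y ^ d))) ⟩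
        2ℚ * B * ι N₀ ^ d * g y ^ d ≤⟨ *-mono (*-nn (*-nn 0≤2 0≤B) (^-nn (ι-nn N₀) d)) K-small (0≤g^ y d) (g^≤Φ y m) ⟩
        K * Φ y m ∎
        where
        open ≤-Reasoning
        eq : ∀ x → x + x ≡ 2ℚ * x * 1ℚ
        eq = solve-∀ ringℚ

      module Large (m y : ℕ) (N₀≤κ : N₀ ℕ.≤ κ (m ℕ.+ y)) (1≤m : 1 ℕ.≤ m) (IH : ∀ {n′} → n′ ℕ.< m ℕ.+ y → Bound n′) where
        n : ℕ
        n = m ℕ.+ y
        G u Xc : ℚ
        G = g n
        u = G ^ d
        Xc = u * (c₁ * G + β * c₂)

        8L≤κ : 8 ℕ.* L ℕ.≤ κ n
        8L≤κ = ℕₚ.≤-trans 8L≤N₀ N₀≤κ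

        8≤κ : 8 ℕ.≤ κ n
        8≤κ = ℕₚ.≤-trans (ℕₚ.*-monoʳ-≤ 8 1≤L) 8L≤κ

        1≤n : 1 ℕ.≤ n
        1≤n = ℕₚ.≤-trans 1≤m (ℕₚ.m≤m+n m y)

        k²≤4n′ : k n * k n ≤ 4ℚ * ι n
        k²≤4n′ = k²≤ 1≤n

        0≤G : 0ℚ ≤ G
        0≤G = 0≤g n

        0≤u : 0ℚ ≤ u
        0≤u = 0≤g^ n d

        0≤Xc : 0ℚ ≤ Xc
        0≤Xc = *-nn 0≤u (+-nn (*-nn (0≤C₁ d) 0≤G) (*-nn 0≤β (0≤C₂ d)))

        𝓛≤ : ∀ x → 1 ℕ.≤ x → ∣ 𝓛 f x ∣ ≤ 4ℚ * (E * g x ^ d) * ι x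
        𝓛≤ x 1≤x = begin
          ∣ 𝓛 f x ∣ ≤⟨ 𝓛f≤ x ⟩
          E * (g x ^ d * (k x * k x)) ≤⟨ *-monoˡ 0≤E (*-monoˡ (0≤g^ x d) (k²≤ 1≤x)) ⟩
          E * (g x ^ d * (4ℚ * ι x)) ≡⟨ eq E (g x ^ d) (ι x) ⟩
          4ℚ * (E * g x ^ d) * ι x ∎
          where
          open ≤-Reasoning
          eq : ∀ x y z → x * (y * (4ℚ * z)) ≡ 4ℚ * (x * y) * z
          eq = solve-∀ ringℚ

        module Far (Lκ≤m : L ℕ.* κ n ℕ.≤ m) where
          Ψ : ℕ → ℚ
          Ψ i = Φ y m + (- (β * (G * u)) * ι (suc i ℕ.⊓ m) + l * Xc * ω n (suc i) ^ D₃)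

          -- A jump of length `j ≤ m` lowers `Φ` by at least `β j g^(d + 1)`. A longer jump
          -- exchanges the roles of the two points and costs `Xc ω^D₂` by `spread′`; since then
          -- `ω ≥ L`, this is at most `l Xc ω^D₃`, a factor `1/L` in return for one more moment.
          point : ∀ i → i ℕ.< n → ∣ f (n ∸ suc i) - f y ∣ ≤ K * Ψ i
          point i i<n with suc i ℕ.≤? m
          ... | yes j≤m = ≤-trans (IH (ℕₚ.∸-monoʳ-< {n} (s≤s z≤n) i<n) (m ∸ suc i) y (sym (ℕₚ.+-∸-comm y j≤m)))
            (*-monoˡ 0≤K (≤-by (+-nn (*-nn (*-nn 0≤β (ι-nn (suc i))) (-nn (^-mono 0≤G (g-anti m y) (suc d)))) (*-nn (*-nn 0≤l 0≤Xc) (^-nn (0≤ω n (suc i)) D₃)))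
              (trans (cong₂ (λ a b → Φ y m + (- (β * (G * u)) * a + l * Xc * ω n (suc i) ^ D₃) - (g y ^ d + β * (b * g y ^ suc d))) (cong ι (ℕₚ.m≤n⇒m⊓n≡m j≤m)) (ι-∸ j≤m))
                (eq (g y ^ d) β (ι m) (g y ^ suc d) (G * u) (ι (suc i)) (l * Xc * ω n (suc i) ^ D₃)))))
            where
            eq : ∀ p b m p′ q j z → p + b * (m * p′) + (- (b * q) * j + z) - (p + b * ((m - j) * p′)) ≡ b * j * (p′ - q) + z
            eq = solve-∀ ringℚ
          ... | no j≰m = begin
            ∣ f y₁ - f y ∣ ≡⟨ abs-swap (f y₁) (f y) ⟩
            ∣ f y - f y₁ ∣ ≤⟨ IH (ℕₚ.m<n+m y 1≤m) (j ∸ m) y₁ e ⟩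
            K * Φ y₁ (j ∸ m) ≤⟨ *-monoˡ 0≤K le ⟩
            K * Ψ i ∎
            where
            open ≤-Reasoning
            j = suc i
            y₁ = n ∸ j
            m≤j : m ℕ.≤ j
            m≤j = ℕₚ.<⇒≤ (ℕₚ.≰⇒> j≰m)
            j≤n : j ℕ.≤ n
            j≤n = i<n
            e : j ∸ m ℕ.+ y₁ ≡ y
            e = ℕₚ.+-cancelˡ-≡ m (j ∸ m ℕ.+ y₁) y (trans (sym (ℕₚ.+-assoc m (j ∸ m) y₁)) (trans (cong (ℕ._+ y₁) (ℕₚ.m+[n∸m]≡n m≤j)) (ℕₚ.m+[n∸m]≡n j≤n)))
            L≤ω : ι L ≤ ω n j
            L≤ω = begin
              ι L ≡⟨ sym (*-identityʳ (ι L)) ⟩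
              ι L * 1ℚ ≡⟨ cong (ι L *_) (sym (kg n)) ⟩
              ι L * (k n * G) ≡⟨ sym (*-assoc (ι L) (k n) G) ⟩
              ι L * k n * G ≡⟨ cong (_* G) (sym (ι-* L (κ n))) ⟩
              ι (L ℕ.* κ n) * G ≤⟨ *-monoʳ 0≤G (ι-mono (ℕₚ.≤-trans Lκ≤m m≤j)) ⟩
              ι j * G ≤⟨ q≤p+q 0≤1 ⟩
              ω n j ∎
            ω^ : ω n j ^ D₂ ≤ l * ω n j ^ D₃
            ω^ = begin
              ω n j ^ D₂ ≡⟨ sym (trans (cong (_* ω n j ^ D₂) lL) (*-identityˡ (ω n j ^ D₂))) ⟩
              l * ι L * ω n j ^ D₂ ≤⟨ *-monoʳ (^-nn (0≤ω n j) D₂) (*-monoˡ 0≤l L≤ω) ⟩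
              l * ω n j * ω n j ^ D₂ ≡⟨ *-assoc l (ω n j) (ω n j ^ D₂) ⟩
              l * ω n j ^ D₃ ∎
            n∸y₁ : n ∸ y₁ ≡ j
            n∸y₁ = ℕₚ.m∸[m∸n]≡n j≤n
            sp : g y₁ ^ d + β * (ι j * g y₁ ^ suc d) ≤ u + Xc * ω n j ^ D₂
            sp = subst (λ z → g y₁ ^ d + β * (ι z * g y₁ ^ suc d) ≤ u + Xc * ω n z ^ D₂) n∸y₁ (spread′ d n y₁ 0≤β (ℕₚ.m∸n≤m n j))
            le : Φ y₁ (j ∸ m) ≤ Ψ i
            le = ≤-by (+-nn (+-nn (+-nn (*-nn (*-nn 0≤β (-nn (ι-mono (ℕₚ.m∸n≤m j m)))) (0≤g^ y₁ (suc d))) (-nn sp)) (*-nn 0≤Xc (-nn ω^)))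
                 (+-nn (-nn (^-mono 0≤G (g-anti m y) d)) (*-nn (*-nn 0≤β (ι-nn m)) (-nn (^-mono 0≤G (g-anti m y) (suc d))))))
                 (trans (cong (λ a → Φ y m + (- (β * (G * u)) * a + l * Xc * ω n j ^ D₃) - Φ y₁ (j ∸ m)) (cong ι (ℕₚ.m≥n⇒m⊓n≡n m≤j)))
                   (eq (g y ^ d) β (ι m) (g y ^ suc d) (G * u) l Xc (ω n j ^ D₃) (g y₁ ^ d) (g y₁ ^ suc d) (ι (j ∸ m)) (ι j) u (ω n j ^ D₂)))
              where
              eq : ∀ p b m p′ q l X w r r′ jm j u v → p + b * (m * p′) + (- (b * q) * m + l * X * w) - (r + b * (jm * r′))
                ≡ b * (j - jm) * r′ + (u + X * v - (r + b * (j * r′))) + X * (l * w - v) + (p - u + b * m * (p′ - q))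
              eq = solve-∀ ringℚ

          Wm Wω : ℚ
          Wm = W n (λ i → ι (suc i ℕ.⊓ m))
          Wω = W n (λ i → ω n (suc i) ^ D₃)

          WΨ : W n Ψ ≡ ι n * Φ y m + (- (β * (G * u)) * Wm + l * Xc * Wω)
          WΨ = trans (W-+ n _ _) (cong₂ _+_ (W-const n (Φ y m)) (trans (W-+ n _ _) (cong₂ _+_ (W-*ˡ n (- (β * (G * u))) _) (W-*ˡ n (l * Xc) _))))

          drift₁ : u * ι n ≤ 16ℚ * (G * u * Wm)
          drift₁ = begin
            u * ι n ≡⟨ sym (trans (cong (λ z → z * (u * ι n)) (kg n)) (*-identityˡ (u * ι n))) ⟩
            k n * G * (u * ι n) ≡⟨ eq (k n) G u (ι n) ⟩
            G * u * (k n * ι n) ≤⟨ *-monoˡ (*-nn 0≤G 0≤u) (drift n m (ℕₚ.≤-trans (s≤s (s≤s (s≤s (s≤s z≤n)))) 8≤κ) (ℕₚ.≤-trans (ℕₚ.≤-trans (ℕₚ.≤-reflexive (sym (ℕₚ.*-identityˡ (κ n)))) (ℕₚ.*-monoˡ-≤ (κ n) 1≤L)) Lκ≤m)) ⟩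
            G * u * (4ℚ * 4ℚ * Wm) ≡⟨ eq′ (G * u) Wm ⟩
            16ℚ * (G * u * Wm) ∎
            where
            open ≤-Reasoning
            eq : ∀ x y z w → x * y * (z * w) ≡ y * z * (x * w)
            eq = solve-∀ ringℚ
            eq′ : ∀ x y → x * (4ℚ * 4ℚ * y) ≡ 16ℚ * (x * y)
            eq′ = solve-∀ ringℚ

          -- Overshooting uses up at most half of the gain `β u n / 16` from `drift₁`; the other
          -- half, times `K`, pays for `𝓛 f` through `Kβ`. `g-small₁` treats the part of `Xc` with
          -- `c₁`, `L-large` the part with `β c₂`.
          excess : 2ℚ * 16ℚ * (l * Xc * Wω) ≤ β * (u * ι n)
          excess = *-cancelˡ 0<2 (begin
            2ℚ * (2ℚ * 16ℚ * (l * Xc * Wω)) ≡⟨ eq₀ (l * Xc * Wω) ⟩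
            64ℚ * (l * Xc * Wω) ≤⟨ *-monoˡ 0≤64 (*-monoˡ (*-nn 0≤l 0≤Xc) (≤-trans (moment₃ n) (*-monoˡ 0≤M₃ k²≤4n′))) ⟩
            64ℚ * (l * Xc * (M₃ * (4ℚ * ι n))) ≡⟨ eq l u c₁ G β c₂ M₃ (ι n) ⟩
            (l * (256ℚ * (M₃ * c₁) * G) + 256ℚ * (M₃ * c₂) * l * β) * (u * ι n) ≤⟨ *-monoʳ (*-nn 0≤u (ι-nn n)) (+-mono-≤ (≤-trans (*-monoˡ 0≤l (g-small₁ n N₀≤κ)) (≤*1 0≤β l≤1)) (*-monoʳ 0≤β L-large)) ⟩
            (β + 1ℚ * β) * (u * ι n) ≡⟨ eq′ β (u * ι n) ⟩
            2ℚ * (β * (u * ι n)) ∎)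
            where
            open ≤-Reasoning
            eq₀ : ∀ x → 2ℚ * (2ℚ * 16ℚ * x) ≡ 64ℚ * x
            eq₀ = solve-∀ ringℚ
            eq : ∀ l u a G b c M n → 64ℚ * (l * (u * (a * G + b * c)) * (M * (4ℚ * n))) ≡ (l * (256ℚ * (M * a) * G) + 256ℚ * (M * c) * l * b) * (u * n)
            eq = solve-∀ ringℚ
            eq′ : ∀ b x → (b + 1ℚ * b) * x ≡ 2ℚ * (b * x)
            eq′ = solve-∀ ringℚ

          far : ∣ f n - f y ∣ ≤ K * Φ y m
          far = *-cancelˡ (<-≤-trans 0<1 (≤-trans (≤-reflexive (sym (+-identityˡ 1ℚ))) (ι-mono 1≤n))) (begin
            ι n * ∣ f n - f y ∣ ≡⟨ trans (cong (_* ∣ f n - f y ∣) (sym (0≤p⇒∣p∣≡p (ι-nn n)))) (sym (∣p*q∣≡∣p∣*∣q∣ (ι n) (f n - f y))) ⟩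
            ∣ ι n * (f n - f y) ∣ ≡⟨ cong ∣_∣ split ⟩
            ∣ W n (λ i → f (n ∸ suc i) - f y) - 𝓛 f n ∣ ≤⟨ abs-sub (W n (λ i → f (n ∸ suc i) - f y)) (𝓛 f n) ⟩
            ∣ W n (λ i → f (n ∸ suc i) - f y) ∣ + ∣ 𝓛 f n ∣ ≤⟨ +-mono-≤ (≤-trans (W-abs n _) (W-mono n point)) (𝓛≤ n 1≤n) ⟩
            W n (λ i → K * Ψ i) + 4ℚ * (E * u) * ι n ≡⟨ cong (_+ 4ℚ * (E * u) * ι n) (trans (W-*ˡ n K Ψ) (cong (K *_) WΨ)) ⟩
            K * (ι n * Φ y m + (- (β * (G * u)) * Wm + l * Xc * Wω)) + 4ℚ * (E * u) * ι n ≤⟨ final ⟩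
            ι n * (K * Φ y m) ∎)
            where
            open ≤-Reasoning
            split : ι n * (f n - f y) ≡ W n (λ i → f (n ∸ suc i) - f y) - 𝓛 f n
            split = trans (eq (ι n) (f n) (f y)) (trans (cong₂ _+_ (𝓛-eq f n) (sym (W-const n (- f y)))) (trans (eq′ (W n (λ i → f (n ∸ suc i))) (𝓛 f n) (W n (λ _ → - f y))) (cong (_- 𝓛 f n) (sym (W-+ n (λ i → f (n ∸ suc i)) (λ _ → - f y))))))
              where
              eq : ∀ n x y → n * (x - y) ≡ n * x + n * (- y)
              eq = solve-∀ ringℚ
              eq′ : ∀ w l z → w - l + z ≡ w + z - l
              eq′ = solve-∀ ringℚ
            final : K * (ι n * Φ y m + (- (β * (G * u)) * Wm + l * Xc * Wω)) + 4ℚ * (E * u) * ι n ≤ ι n * (K * Φ y m)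
            final = *-cancelˡ (*-pos 0<2 (*-pos 0<4 0<4)) (≤-by
              (+-nn (+-nn (*-nn (*-nn 0≤2 (*-nn 0≤K 0≤β)) (-nn drift₁)) (*-nn 0≤K (-nn excess)))
                 (*-nn (-nn Kβ) (*-nn 0≤u (ι-nn n)))) (eq (ι n) K (Φ y m) β (G * u) Wm (l * Xc * Wω) E u))
              where
              eq : ∀ n K P b g w x E u → 2ℚ * 16ℚ * (n * (K * P)) - 2ℚ * 16ℚ * (K * (n * P + (- (b * g) * w + x)) + 4ℚ * (E * u) * n)
                 ≡ 2ℚ * (K * b) * (16ℚ * (g * w) - u * n) + K * (b * (u * n) - 2ℚ * 16ℚ * x) + (K * b - 128ℚ * E) * (u * n)
              eq = solve-∀ ringℚ

        module Near (m≤Lκ : m ℕ.≤ L ℕ.* κ n) where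
          ιn : ι n ≡ ι m + ι y
          ιn = ι-+ m y

          m≤Lk : ι m ≤ ι L * k n
          m≤Lk = ≤-trans (ι-mono m≤Lκ) (≤-reflexive (ι-* L (κ n)))

          8L≤k : (4ℚ + 4ℚ) * ι L ≤ k n
          8L≤k = ≤-trans (≤-reflexive (sym (ι-* 8 L))) (ι-mono 8L≤κ)

          -- Since `8 L ≤ k n`, one has `m ≤ L k ≤ k² / 8 ≤ n / 2`.
          n≤2y : ι n ≤ 2ℚ * ι y
          n≤2y = *-cancelˡ 0<4 (≤-by (+-nn (+-nn (*-nn (+-nn 0≤4 0≤4) (-nn m≤Lk)) (*-nn (-nn 8L≤k) (0≤k n))) (-nn (≤-trans k²≤4n′ (≤-reflexive (cong (4ℚ *_) ιn)))))
            (trans (cong (λ z → 4ℚ * (2ℚ * ι y) - 4ℚ * z) ιn) (eq (ι m) (ι y) (ι L) (k n))))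
            where
            eq : ∀ m y L k → 4ℚ * (2ℚ * y) - 4ℚ * (m + y) ≡ (4ℚ + 4ℚ) * (L * k - m) + (k - (4ℚ + 4ℚ) * L) * k + (4ℚ * (m + y) - k * k)
            eq = solve-∀ ringℚ

          1≤y : 1 ℕ.≤ y
          1≤y = half-pos y 1≤n n≤2y

          0<ιn : 0ℚ < ι n
          0<ιn = <-≤-trans 0<1 (≤-trans (≤-reflexive (sym (+-identityˡ 1ℚ))) (ι-mono 1≤n))

          0<ιy : 0ℚ < ι y
          0<ιy = <-≤-trans 0<1 (≤-trans (≤-reflexive (sym (+-identityˡ 1ℚ))) (ι-mono 1≤y))

          qr : q * r y ≤ r n
          qr = begin
            q * r y ≡⟨ sym (trans (cong (q * r y *_) (ar n)) (*-identityʳ (q * r y))) ⟩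
            q * r y * (a n * r n) ≤⟨ *-monoˡ (*-nn 0≤q (0≤r y)) (*-monoʳ (0≤r n) (ratio≤Q m y 8≤κ m≤Lκ n≤2y)) ⟩
            q * r y * (Q * a y * r n) ≡⟨ eq q (r y) Q (a y) (r n) ⟩
            q * Q * (a y * r y) * r n ≡⟨ cong₂ (λ u v → u * v * r n) qQ (ar y) ⟩
            1ℚ * 1ℚ * r n ≡⟨ trans (cong (_* r n) (*-identityˡ 1ℚ)) (*-identityˡ (r n)) ⟩
            r n ∎
            where
            open ≤-Reasoning
            eq : ∀ q s Q b t → q * s * (Q * b * t) ≡ q * Q * (b * s) * t
            eq = solve-∀ ringℚ

          pos : ∀ i → n ∸ suc (m ℕ.+ i) ≡ y ∸ suc i
          pos i = trans (cong (n ∸_) (sym (ℕₚ.+-suc m i))) (ℕₚ.[m+n]∸[m+o]≡n∸o m y (suc i))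

          -- A jump by `i + 1` from `y` and one by `m + i + 1` from `n` reach the same point. The
          -- minorant `2 (i + 1)` increases with the length, so `q * o i` lies below both weights,
          -- although `σ` itself need not be monotone.
          o : ℕ → ℚ
          o i = 2ℚ * ι (suc i) * a (y ∸ suc i) * r y

          0≤o : ∀ i → 0ℚ ≤ o i
          0≤o i = *-nn (*-nn (*-nn 0≤2 (ι-nn (suc i))) (0≤a (y ∸ suc i))) (0≤r y)

          o≤wt : ∀ i → o i ≤ wt y i
          o≤wt i = *-monoʳ (0≤r y) (*-monoʳ (0≤a (y ∸ suc i)) (σ-low i))

          qo≤wt : ∀ i → q * o i ≤ wt n (m ℕ.+ i)
          qo≤wt i = begin
            q * o i ≡⟨ eq q (2ℚ * ι (suc i)) (a (y ∸ suc i)) (r y) ⟩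
            2ℚ * ι (suc i) * a (y ∸ suc i) * (q * r y) ≤⟨ *-mono (*-nn (*-nn 0≤2 (ι-nn (suc i))) (0≤a (y ∸ suc i))) (*-monoʳ (0≤a (y ∸ suc i)) (≤-trans (*-monoˡ 0≤2 (ι-mono (s≤s (ℕₚ.m≤n+m i m)))) (σ-low (m ℕ.+ i)))) (*-nn 0≤q (0≤r y)) qr ⟩
            σ (m ℕ.+ i) * a (y ∸ suc i) * r n ≡⟨ cong (λ z → σ (m ℕ.+ i) * a z * r n) (sym (pos i)) ⟩
            wt n (m ℕ.+ i) ∎
            where
            open ≤-Reasoning
            eq : ∀ q x b s → q * (x * b * s) ≡ x * b * (q * s)
            eq = solve-∀ ringℚ

          X : ℕ → ℚ
          X z = K * (Xc * ω n (n ∸ z) ^ D₂)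

          0≤X : ∀ z → 0ℚ ≤ X z
          0≤X z = *-nn 0≤K (*-nn 0≤Xc (^-nn (0≤ω n (n ∸ z)) D₂))

          c : ℚ
          c = K * u

          O N p a₁ a₂ b₁ b₂ : ℚ
          O = sum y o
          N = inv (ι n)
          -- The averages at `n` and `y` have masses `n` and `y`; with `p / y = q / n` the common
          -- part has the same probability in both normalised laws.
          p = q * (ι y * N)
          a₁ = 4ℚ * (K * Xc * M₂)
          a₂ = 4ℚ * (E * u)
          b₁ = 4ℚ * (K * Xc * (Λ * M₂))
          b₂ = 4ℚ * (E * (Λ′ * u))

          0≤N : 0ℚ ≤ N
          0≤N = inv-nn 0<ιn

          0≤p : 0ℚ ≤ p
          0≤p = *-nn 0≤q (*-nn (ι-nn y) 0≤N)

          p≤1 : p ≤ 1ℚ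
          p≤1 = ≤-trans (≤*1 (*-nn (ι-nn y) 0≤N) q≤1) (≤-trans (*-monoʳ 0≤N (ι-mono (ℕₚ.m≤n+m y m))) (≤-reflexive (inv-r 0<ιn)))

          close : ∀ z z′ → z ℕ.≤ z′ → z′ ℕ.< n → ∣ f z′ - f z ∣ ≤ c + X z
          close z z′ z≤z′ z′<n = begin
            ∣ f z′ - f z ∣ ≤⟨ IH z′<n (z′ ∸ z) z (ℕₚ.m∸n+n≡m z≤z′) ⟩
            K * (g z ^ d + β * (ι (z′ ∸ z) * g z ^ suc d)) ≤⟨ *-monoˡ 0≤K (+-monoʳ-≤ (g z ^ d) (*-monoˡ 0≤β (*-monoʳ (0≤g^ z (suc d)) (ι-mono (ℕₚ.∸-monoˡ-≤ z (ℕₚ.<⇒≤ z′<n)))))) ⟩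
            K * (g z ^ d + β * (ι (n ∸ z) * g z ^ suc d)) ≤⟨ *-monoˡ 0≤K (spread′ d n z 0≤β (ℕₚ.≤-trans z≤z′ (ℕₚ.<⇒≤ z′<n))) ⟩
            K * (u + Xc * ω n (n ∸ z) ^ D₂) ≡⟨ *-distribˡ-+ K u (Xc * ω n (n ∸ z) ^ D₂) ⟩
            c + X z ∎
            where open ≤-Reasoning

          close′ : ∀ z z′ → z ℕ.< n → z′ ℕ.< n → ∣ f z - f z′ ∣ ≤ c + (X z + X z′)
          close′ z z′ z<n z′<n with ℕₚ.≤-total z z′
          ... | inj₁ le = ≤-trans (≤-reflexive (abs-swap (f z) (f z′))) (≤-trans (close z z′ le z′<n) (+-monoʳ-≤ c (p≤p+q (0≤X z′))))
          ... | inj₂ ge = ≤-trans (close z′ z ge z<n) (+-monoʳ-≤ c (q≤p+q (0≤X z)))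

          Wn-X : W n (λ i → X (n ∸ suc i)) ≤ a₁ * ι n
          Wn-X = begin
            W n (λ i → X (n ∸ suc i)) ≡⟨ sum-cong n (λ i i<n → cong (wt n i *_) (trans (cong (λ z → K * (Xc * ω n z ^ D₂)) (ℕₚ.m∸[m∸n]≡n i<n)) (sym (*-assoc K Xc (ω n (suc i) ^ D₂))))) ⟩
            W n (λ i → K * Xc * ω n (suc i) ^ D₂) ≡⟨ W-*ˡ n (K * Xc) _ ⟩
            K * Xc * W n (λ i → ω n (suc i) ^ D₂) ≤⟨ *-monoˡ (*-nn 0≤K 0≤Xc) (≤-trans (moment₂ n) (*-monoˡ 0≤M₂ k²≤4n′)) ⟩
            K * Xc * (M₂ * (4ℚ * ι n)) ≡⟨ eq (K * Xc) M₂ (ι n) ⟩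
            a₁ * ι n ∎
            where
            open ≤-Reasoning
            eq : ∀ x m n → x * (m * (4ℚ * n)) ≡ 4ℚ * (x * m) * n
            eq = solve-∀ ringℚ

          mG≤L : ι m * G ≤ ι L
          mG≤L = ≤-trans (*-monoʳ 0≤G m≤Lk) (≤-reflexive (trans (*-assoc (ι L) (k n) G) (trans (cong (ι L *_) (kg n)) (*-identityʳ (ι L)))))

          ω-shift : ∀ j → ω n (m ℕ.+ j) ≤ (1ℚ + ι L) * ω y j
          ω-shift j = ≤-by (+-nn (+-nn (-nn mG≤L) (*-nn (ι-nn j) (-nn (g-anti m y)))) (*-nn (ι-nn L) (*-nn (ι-nn j) (0≤g y)))) (trans (cong (λ z → (1ℚ + ι L) * ω y j - (1ℚ + z * G)) (ι-+ m j)) (eq (ι L) (ι j) (ι m) (g y) G))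
            where
            eq : ∀ L j m x G → (1ℚ + L) * (1ℚ + j * x) - (1ℚ + (m + j) * G) ≡ L - m * G + j * (x - G) + L * (j * x)
            eq = solve-∀ ringℚ

          Wy-X : W y (λ i → X (y ∸ suc i)) ≤ b₁ * ι y
          Wy-X = begin
            W y (λ i → X (y ∸ suc i)) ≤⟨ W-mono y (λ i i<y → *-monoˡ 0≤K (*-monoˡ 0≤Xc (≤-trans (^-mono (0≤ω n (n ∸ (y ∸ suc i))) (≤-trans (≤-reflexive (cong (ω n) (pos′ i i<y))) (ω-shift (suc i))) D₂) (≤-trans (≤-reflexive (*-^ (1ℚ + ι L) (ω y (suc i)) D₂)) (*-monoʳ (^-nn (0≤ω y (suc i)) D₂) Λ-pow))))) ⟩
            W y (λ i → K * (Xc * (Λ * ω y (suc i) ^ D₂))) ≡⟨ sum-cong y (λ i _ → cong (wt y i *_) (eq₁ K Xc Λ (ω y (suc i) ^ D₂))) ⟩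
            W y (λ i → K * Xc * Λ * ω y (suc i) ^ D₂) ≡⟨ W-*ˡ y (K * Xc * Λ) _ ⟩
            K * Xc * Λ * W y (λ i → ω y (suc i) ^ D₂) ≤⟨ *-monoˡ (*-nn (*-nn 0≤K 0≤Xc) (1≤⇒0≤ 1≤Λ)) (≤-trans (moment₂ y) (*-monoˡ 0≤M₂ (k²≤ 1≤y))) ⟩
            K * Xc * Λ * (M₂ * (4ℚ * ι y)) ≡⟨ eq (K * Xc) Λ M₂ (ι y) ⟩
            b₁ * ι y ∎
            where
            open ≤-Reasoning
            pos′ : ∀ i → i ℕ.< y → n ∸ (y ∸ suc i) ≡ m ℕ.+ suc i
            pos′ i i<y = trans (ℕₚ.+-∸-assoc m (ℕₚ.m∸n≤m y (suc i))) (cong (m ℕ.+_) (ℕₚ.m∸[m∸n]≡n i<y))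
            eq₁ : ∀ x y z w → x * (y * (z * w)) ≡ x * y * z * w
            eq₁ = solve-∀ ringℚ
            eq : ∀ x l m n → x * l * (m * (4ℚ * n)) ≡ 4ℚ * (x * (l * m)) * n
            eq = solve-∀ ringℚ

          gy≤ : g y ^ d ≤ Λ′ * u
          gy≤ = ≤-trans (g′^≤ d m y) (*-monoʳ 0≤u (≤-trans (*-monoˡ (^-nn 0≤2 d) (^-mono (0≤ω n m) (+-monoʳ-≤ 1ℚ mG≤L) d)) Λ′-pow))

          𝓛n≤ : ∣ 𝓛 f n ∣ ≤ a₂ * ι n
          𝓛n≤ = 𝓛≤ n 1≤n

          𝓛y≤ : ∣ 𝓛 f y ∣ ≤ b₂ * ι y
          𝓛y≤ = ≤-trans (𝓛≤ y 1≤y) (*-monoʳ (ι-nn y) (*-monoˡ 0≤4 (*-monoˡ 0≤E gy≤)))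

          -- Coalescence saves a fraction `q / 4` of `c = K u`, because `O ≥ y / 2 ≥ n / 4`. Half of
          -- the saving pays for the terms with `Xc`, through `g-small₂` and `β-small`; the other
          -- half pays for `𝓛 f` at both points, through `Kq`.
          budget : c + (a₁ + a₂ + (b₁ + b₂)) - q * N * (c * O) ≤ K * u
          budget = *-cancelˡ (*-pos 0<4 0<4) (≤-by
            (+-nn (+-nn (+-nn (+-nn (*-nn (*-nn 0≤4 (*-nn 0≤K 0≤u)) (-nn θ≥)) (*-nn (*-nn 0≤K 0≤u) (-nn (g-small₂ n N₀≤κ)))) (*-nn (*-nn 0≤K 0≤u) (-nn β-small)))
              (+-nn (*-nn (*-nn 64K 0≤Xc) (*-nn (-nn 1≤Λ) 0≤M₂)) (*-nn (*-nn 0≤64 (*-nn 0≤E 0≤u)) (-nn 1≤Λ′)))) (*-nn 0≤2 (*-nn (-nn Kq) 0≤u)))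
            (eq K u E q N O M₂ Λ Λ′ c₁ G β c₂))
            where
            64K : 0ℚ ≤ 64ℚ * K
            64K = *-nn 0≤64 0≤K
            θ≥ : q ≤ 4ℚ * (q * N * O)
            θ≥ = begin
              q ≡⟨ sym (trans (cong (q *_) (inv-l 0<ιn)) (*-identityʳ q)) ⟩
              q * (N * ι n) ≤⟨ *-monoˡ 0≤q (*-monoˡ 0≤N (≤-trans n≤2y (*-monoˡ 0≤2 (overlapMass y)))) ⟩
              q * (N * (2ℚ * (2ℚ * O))) ≡⟨ eqθ q N O ⟩
              4ℚ * (q * N * O) ∎
              where
              open ≤-Reasoning
              eqθ : ∀ q n o → q * (n * (2ℚ * (2ℚ * o))) ≡ 4ℚ * (q * n * o)
              eqθ = solve-∀ ringℚ
            eq : ∀ K u E q N O M L L′ c₁ G b c₂ → let X = u * (c₁ * G + b * c₂) in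
              4ℚ * 4ℚ * (K * u) - 4ℚ * 4ℚ * (K * u + (4ℚ * (K * X * M) + 4ℚ * (E * u) + (4ℚ * (K * X * (L * M)) + 4ℚ * (E * (L′ * u)))) - q * N * (K * u * O))
              ≡ 4ℚ * (K * u) * (4ℚ * (q * N * O) - q) + K * u * (q - 128ℚ * (c₁ * (M * L)) * G) + K * u * (q - 128ℚ * (b * (c₂ * (M * L))))
                + (64ℚ * K * X * ((L - 1ℚ) * M) + 64ℚ * (E * u) * (L′ - 1ℚ)) + 2ℚ * ((K * q - 64ℚ * (E * L′)) * u)
            eq = solve-∀ ringℚ

          module Side (φ : ℕ → ℚ) (h : ℚ) (up : ∀ z → z ℕ.≤ n ∸ 1 → φ z ≤ h + X z) (lo : ∀ z → z ℕ.≤ n ∸ 1 → h - c - X z ≤ φ z)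
            (en : - 𝓛 φ n ≤ a₂ * ι n) (ey : 𝓛 φ y ≤ b₂ * ι y) where
            F h′ : ℚ
            F = sum y (λ i → o i * φ (y ∸ suc i))
            h′ = h - c
            in-n : ∀ i → n ∸ suc i ℕ.≤ n ∸ 1
            in-n i = ℕₚ.∸-monoʳ-≤ n (s≤s z≤n)
            in-y : ∀ i → y ∸ suc i ℕ.≤ n ∸ 1
            in-y i = subst (ℕ._≤ n ∸ 1) (pos i) (in-n (m ℕ.+ i))
            Wn-up : W n (λ i → φ (n ∸ suc i)) ≤ W n (λ i → h + X (n ∸ suc i)) + q * (F - h * O)
            Wn-up = begin
              sum n (λ i → wt n i * φ (n ∸ suc i)) ≡⟨ sum-split m y (λ i → wt n i * φ (n ∸ suc i)) ⟩
              sum m (λ i → wt n i * φ (n ∸ suc i)) + sum y (λ i → wt n (m ℕ.+ i) * φ (n ∸ suc (m ℕ.+ i))) ≤⟨ +-mono-≤ (sum-mono m λ i _ → *-monoˡ (0≤wt n i) (up (n ∸ suc i) (in-n i)))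
                (overlap-upper y (λ i → wt n (m ℕ.+ i)) o (λ i → φ (n ∸ suc (m ℕ.+ i))) (λ i → X (n ∸ suc (m ℕ.+ i))) h q 0≤q 0≤o (λ i → 0≤X (n ∸ suc (m ℕ.+ i))) qo≤wt (λ i → up (n ∸ suc (m ℕ.+ i)) (in-n (m ℕ.+ i)))) ⟩
              S₁ + (S₂ + q * (sum y (λ i → o i * φ (n ∸ suc (m ℕ.+ i))) - h * O)) ≡⟨ cong (λ z → S₁ + (S₂ + q * (z - h * O))) (sum-cong y λ i _ → cong (λ z → o i * φ z) (pos i)) ⟩
              S₁ + (S₂ + q * (F - h * O)) ≡⟨ sym (+-assoc S₁ S₂ (q * (F - h * O))) ⟩
              S₁ + S₂ + q * (F - h * O) ≡⟨ cong (_+ q * (F - h * O)) (sym (sum-split m y (λ i → wt n i * (h + X (n ∸ suc i))))) ⟩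
              W n (λ i → h + X (n ∸ suc i)) + q * (F - h * O) ∎
              where
              open ≤-Reasoning
              S₁ = sum m (λ i → wt n i * (h + X (n ∸ suc i)))
              S₂ = sum y (λ i → wt n (m ℕ.+ i) * (h + X (n ∸ suc (m ℕ.+ i))))
            Wy-lo : W y (λ i → h′ - X (y ∸ suc i)) + p * (F - h′ * O) ≤ W y (λ i → φ (y ∸ suc i))
            Wy-lo = overlap-lower y (wt y) o (λ i → φ (y ∸ suc i)) (λ i → X (y ∸ suc i)) h′ p 0≤p 0≤o (λ i → 0≤X (y ∸ suc i)) (λ i → ≤-trans (≤*1 (0≤o i) p≤1) (o≤wt i)) (λ i → lo (y ∸ suc i) (in-y i))
            upper : φ n ≤ h + (a₁ + a₂) + q * N * (F - h * O)
            upper = *-cancelˡ 0<ιn (begin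
              ι n * φ n ≡⟨ 𝓛-eq φ n ⟩
              W n (λ i → φ (n ∸ suc i)) - 𝓛 φ n ≤⟨ +-mono-≤ Wn-up en ⟩
              W n (λ i → h + X (n ∸ suc i)) + q * (F - h * O) + a₂ * ι n ≡⟨ cong (λ z → z + q * (F - h * O) + a₂ * ι n) (W-shift n (λ i → X (n ∸ suc i)) h) ⟩
              ι n * h + W n (λ i → X (n ∸ suc i)) + q * (F - h * O) + a₂ * ι n ≤⟨ +-monoˡ-≤ (a₂ * ι n) (+-monoˡ-≤ (q * (F - h * O)) (+-monoʳ-≤ (ι n * h) Wn-X)) ⟩
              ι n * h + a₁ * ι n + q * (F - h * O) + a₂ * ι n ≡⟨ cong (λ z → ι n * h + a₁ * ι n + z + a₂ * ι n) (sym (trans (cong (_* (q * (F - h * O))) (inv-r 0<ιn)) (*-identityˡ (q * (F - h * O))))) ⟩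
              ι n * h + a₁ * ι n + ι n * N * (q * (F - h * O)) + a₂ * ι n ≡⟨ eq₁ (ι n) h a₁ N q (F - h * O) a₂ ⟩
              ι n * (h + (a₁ + a₂) + q * N * (F - h * O)) ∎)
              where
              open ≤-Reasoning
              eq₁ : ∀ n h a N q z b → n * h + a * n + n * N * (q * z) + b * n ≡ n * (h + (a + b) + q * N * z)
              eq₁ = solve-∀ ringℚ
            lower : h′ - (b₁ + b₂) + q * N * (F - h′ * O) ≤ φ y
            lower = *-cancelˡ 0<ιy (begin
              ι y * (h′ - (b₁ + b₂) + q * N * (F - h′ * O)) ≡⟨ eq₁ (ι y) h′ b₁ N q (F - h′ * O) b₂ ⟩
              ι y * h′ - b₁ * ι y + p * (F - h′ * O) - b₂ * ι y ≤⟨ +-mono-≤ (+-monoˡ-≤ (p * (F - h′ * O)) (+-monoʳ-≤ (ι y * h′) (neg-antimono-≤ Wy-X))) (neg-antimono-≤ ey) ⟩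
              ι y * h′ - W y (λ i → X (y ∸ suc i)) + p * (F - h′ * O) - 𝓛 φ y ≡⟨ cong (λ z → z + p * (F - h′ * O) - 𝓛 φ y) (sym (W-shift⁻ y (λ i → X (y ∸ suc i)) h′)) ⟩
              W y (λ i → h′ - X (y ∸ suc i)) + p * (F - h′ * O) - 𝓛 φ y ≤⟨ +-monoˡ-≤ (- 𝓛 φ y) Wy-lo ⟩
              W y (λ i → φ (y ∸ suc i)) - 𝓛 φ y ≡⟨ sym (𝓛-eq φ y) ⟩
              ι y * φ y ∎)
              where
              open ≤-Reasoning
              eq₁ : ∀ n h a N q z b → n * (h - (a + b) + q * N * z) ≡ n * h - a * n + q * (n * N) * z - b * n
              eq₁ = solve-∀ ringℚ

            -- The common sum `F` cancels between the two bounds. The overlap is measured from `h`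
            -- above and from `h - c` below, and this discrepancy is the saving `q * N * (c * O)`.
            side : φ n - φ y ≤ c + (a₁ + a₂ + (b₁ + b₂)) - q * N * (c * O)
            side = ≤-by (+-nn (-nn upper) (-nn lower)) (eq (φ n) (φ y) h c (a₁ + a₂) (b₁ + b₂) (q * N) F O)
              where
              eq : ∀ x y h c a b t F O → c + (a + b) - t * (c * O) - (x - y) ≡ (h + a + t * (F - h * O) - x) + (y - (h - c - b + t * (F - (h - c) * O)))
              eq = solve-∀ ringℚ

          oneSide : ∀ (φ : ℕ → ℚ) → (∀ z z′ → z ℕ.< n → z′ ℕ.< n → φ z ≤ φ z′ + (c + (X z + X z′))) →
            - 𝓛 φ n ≤ a₂ * ι n → 𝓛 φ y ≤ b₂ * ι y → φ n - φ y ≤ K * u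
          oneSide φ hφ en ey = ≤-trans (Side.side φ (proj₁ bd) (proj₁ (proj₂ bd)) (proj₂ (proj₂ bd)) en ey) budget
            where
            lt : ∀ {z} → z ℕ.≤ n ∸ 1 → z ℕ.< n
            lt {z} h = ℕₚ.≤-trans (s≤s h) (ℕₚ.≤-reflexive (ℕₚ.m+[n∸m]≡n 1≤n))
            bd = band (n ∸ 1) φ X c (λ z z′ h h′ → hφ z z′ (lt h) (lt h′))

          near : ∣ f n - f y ∣ ≤ K * Φ y m
          near = ≤-trans (abs≤ (oneSide f (λ z z′ z< z′< → ≤-by (-nn (≤-trans (≤abs (f z - f z′)) (close′ z z′ z< z′<))) (eq₁ (f z) (f z′) (c + (X z + X z′)))) (≤-trans (-≤abs (𝓛 f n)) 𝓛n≤) (≤-trans (≤abs (𝓛 f y)) 𝓛y≤))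
              (≤-trans (≤-reflexive (eq₃ (f n) (f y))) (oneSide (λ z → - f z) (λ z z′ z< z′< → ≤-by (-nn (≤-trans (-≤abs (f z - f z′)) (close′ z z′ z< z′<))) (eq₂ (f z) (f z′) (c + (X z + X z′))))
                (≤-trans (≤-reflexive (trans (cong -_ (𝓛-neg f n)) (eq₄ (𝓛 f n)))) (≤-trans (≤abs (𝓛 f n)) 𝓛n≤)) (≤-trans (≤-reflexive (𝓛-neg f y)) (≤-trans (-≤abs (𝓛 f y)) 𝓛y≤)))))
            (*-monoˡ 0≤K (≤-trans (^-mono 0≤G (g-anti m y) d) (g^≤Φ y m)))
            where
            eq₁ : ∀ x y c → y + c - x ≡ c - (x - y)
            eq₁ = solve-∀ ringℚ
            eq₂ : ∀ x y c → - y + c - (- x) ≡ c - (- (x - y))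
            eq₂ = solve-∀ ringℚ
            eq₃ : ∀ x y → - (x - y) ≡ - x - (- y)
            eq₃ = solve-∀ ringℚ
            eq₄ : ∀ x → - (- x) ≡ x
            eq₄ = solve-∀ ringℚ

      large : ∀ m y → N₀ ℕ.≤ κ (m ℕ.+ y) → (∀ {n′} → n′ ℕ.< m ℕ.+ y → Bound n′) → ∣ f (m ℕ.+ y) - f y ∣ ≤ K * Φ y m
      large zero y _ _ = ≤-trans (≤-reflexive (cong ∣_∣ (eq (f y)))) (*-nn 0≤K (≤-trans (0≤g^ y d) (g^≤Φ y 0)))
        where
        eq : ∀ x → x - x ≡ 0ℚ
        eq = solve-∀ ringℚ
      large m@(suc _) y N₀≤κ IH = [ Large.Near.near m y N₀≤κ (s≤s z≤n) IH , Large.Far.far m y N₀≤κ (s≤s z≤n) IH ]′ (ℕₚ.≤-total m (L ℕ.* κ (m ℕ.+ y)))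

      bound : ∀ n → Bound n
      bound = <-rec Bound λ n IH m y e → step n IH m y e
        where
        step : ∀ n → (∀ {n′} → n′ ℕ.< n → Bound n′) → Bound n
        step n IH m y refl = [ small m y , (λ N₀≤κ → large m y N₀≤κ IH) ]′ (ℕₚ.≤-total (κ n) N₀)

    -- Existence of the constants.

    module _ (d : ℕ) (B E : ℚ) (0≤B : 0ℚ ≤ B) (0≤E : 0ℚ ≤ E) where

      module MkConstants (M₂ M₃ : ℚ) (0<M₂ : 0ℚ < M₂) (0≤M₃ : 0ℚ ≤ M₃)
        (moment₂ : ∀ n → W n (λ i → ω n (suc i) ^ suc (suc d)) ≤ M₂ * (k n * k n))
        (moment₃ : ∀ n → W n (λ i → ω n (suc i) ^ suc (suc (suc d))) ≤ M₃ * (k n * k n))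
        (L : ℕ) (1≤L : 1 ℕ.≤ L) (L-large : 256ℚ * (M₃ * C₂ d) ≤ ι L)
        (Q : ℚ) (1≤Q : 1ℚ ≤ Q)
        (ratio≤Q : ∀ m y → 8 ℕ.≤ κ (m ℕ.+ y) → m ℕ.≤ L ℕ.* κ (m ℕ.+ y) → ι (m ℕ.+ y) ≤ 2ℚ * ι y → a (m ℕ.+ y) ≤ Q * a y) where

        1≤ιL : 1ℚ ≤ ι L
        1≤ιL = ≤-trans (≤-reflexive (sym (+-identityˡ 1ℚ))) (ι-mono 1≤L)

        0<L : 0ℚ < ι L
        0<L = 1≤⇒0< 1≤ιL

        0<Q : 0ℚ < Q
        0<Q = 1≤⇒0< 1≤Q

        1≤1+L : 1ℚ ≤ 1ℚ + ι L
        1≤1+L = p≤p+q (ι-nn L)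

        l q Λ Λ′ T : ℚ
        l = inv (ι L)
        q = inv Q
        Λ = (1ℚ + ι L) ^ suc (suc d)
        Λ′ = 2ℚ ^ d * (1ℚ + ι L) ^ d
        T = 128ℚ * (C₂ d * (M₂ * Λ))

        0≤l : 0ℚ ≤ l
        0≤l = inv-nn 0<L

        0<q : 0ℚ < q
        0<q = inv-pos 0<Q

        1≤Λ : 1ℚ ≤ Λ
        1≤Λ = 1≤^ 1≤1+L (suc (suc d))

        1≤Λ′ : 1ℚ ≤ Λ′
        1≤Λ′ = ≤-trans (1≤^ 1≤1+L d) (1*≤ (^-nn (1≤⇒0≤ 1≤1+L) d) (1≤^ (p≤p+q 0≤1) d))

        0<T : 0ℚ < T
        0<T = *-pos 0<128 (*-pos (^-pos 0<2 (suc d)) (*-pos 0<M₂ (1≤⇒0< 1≤Λ)))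

        module _ (β : ℚ) (0<β : 0ℚ < β) (βT : β * T ≡ q) (N₁ N₂ : ℕ)
          (N₁-large : 256ℚ * (M₃ * C₁ d) * inv β ≤ ι N₁) (N₂-large : 128ℚ * (C₁ d * (M₂ * Λ)) * inv q ≤ ι N₂) where

          N₀ : ℕ
          N₀ = N₁ ℕ.+ N₂ ℕ.+ 8 ℕ.* L

          K₁ K₂ K₃ : ℚ
          K₁ = 128ℚ * E * inv β
          K₂ = 64ℚ * (E * Λ′) * inv q
          K₃ = 2ℚ * B * ι N₀ ^ d

          0≤K₁ : 0ℚ ≤ K₁
          0≤K₁ = *-nn (*-nn 0≤128 0≤E) (inv-nn 0<β)
          0≤K₂ : 0ℚ ≤ K₂
          0≤K₂ = *-nn (*-nn 0≤64 (*-nn 0≤E (1≤⇒0≤ 1≤Λ′))) (inv-nn 0<q)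
          0≤K₃ : 0ℚ ≤ K₃
          0≤K₃ = *-nn (*-nn 0≤2 0≤B) (^-nn (ι-nn N₀) d)

          scale : ∀ {x} b N n → 0ℚ < b → N ℕ.≤ κ n → x * inv b ≤ ι N → x * g n ≤ b
          scale {x} b N n 0<b N≤κ h = begin
            x * g n ≡⟨ sym (cong (_* g n) (*inv* x 0<b)) ⟩
            x * inv b * b * g n ≤⟨ *-monoʳ (0≤g n) (*-monoʳ (<⇒≤ 0<b) (≤-trans h (ι-mono N≤κ))) ⟩
            k n * b * g n ≡⟨ eq (k n) b (g n) ⟩
            k n * g n * b ≡⟨ trans (cong (_* b) (kg n)) (*-identityˡ b) ⟩
            b ∎
            where
            open ≤-Reasoning
            eq : ∀ x y z → x * y * z ≡ x * z * y
            eq = solve-∀ ringℚ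

          mkConstants : Constants d B E
          mkConstants = record
            { L = L ; N₀ = N₀ ; l = l ; q = q ; Q = Q ; Λ = Λ ; Λ′ = Λ′ ; β = β ; K = K₁ + K₂ + K₃ ; M₂ = M₂ ; M₃ = M₃
            ; 1≤L = 1≤L ; 0≤l = 0≤l ; l≤1 = ≤-trans (1*≤ 0≤l 1≤ιL) (≤-reflexive (inv-r 0<L)) ; lL = inv-l 0<L
            ; 0≤q = <⇒≤ 0<q ; q≤1 = ≤-trans (1*≤ (<⇒≤ 0<q) 1≤Q) (≤-reflexive (inv-r 0<Q)) ; qQ = inv-l 0<Q
            ; ratio≤Q = ratio≤Q ; 1≤Λ = 1≤Λ ; 1≤Λ′ = 1≤Λ′ ; Λ-pow = ≤-refl ; Λ′-pow = ≤-refl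
            ; 0≤β = <⇒≤ 0<β ; 0≤K = +-nn (+-nn 0≤K₁ 0≤K₂) 0≤K₃ ; 0≤M₂ = <⇒≤ 0<M₂ ; 0≤M₃ = 0≤M₃
            ; moment₂ = moment₂ ; moment₃ = moment₃
            ; L-large = ≤-trans (*-monoʳ 0≤l L-large) (≤-reflexive (inv-r 0<L))
            ; β-small = ≤-reflexive (trans (eq β (C₂ d * (M₂ * Λ))) βT)
            ; g-small₁ = λ n h → scale {256ℚ * (M₃ * C₁ d)} β N₁ n 0<β (ℕₚ.≤-trans (ℕₚ.≤-trans (ℕₚ.m≤m+n N₁ N₂) (ℕₚ.m≤m+n (N₁ ℕ.+ N₂) (8 ℕ.* L))) h) N₁-large
            ; g-small₂ = λ n h → scale {128ℚ * (C₁ d * (M₂ * Λ))} q N₂ n 0<q (ℕₚ.≤-trans (ℕₚ.≤-trans (ℕₚ.m≤n+m N₂ N₁) (ℕₚ.m≤m+n (N₁ ℕ.+ N₂) (8 ℕ.* L))) h) N₂-large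
            ; 8L≤N₀ = ℕₚ.m≤n+m (8 ℕ.* L) (N₁ ℕ.+ N₂)
            ; Kβ = ≤-trans (≤-reflexive (sym (*inv* (128ℚ * E) 0<β))) (*-monoʳ (<⇒≤ 0<β) (≤-trans (p≤p+q {K₁} {K₂} 0≤K₂) (p≤p+q {K₁ + K₂} {K₃} 0≤K₃)))
            ; Kq = ≤-trans (≤-reflexive (sym (*inv* (64ℚ * (E * Λ′)) 0<q))) (*-monoʳ (<⇒≤ 0<q) (≤-trans (q≤p+q {K₁} {K₂} 0≤K₁) (p≤p+q {K₁ + K₂} {K₃} 0≤K₃)))
            ; K-small = q≤p+q (+-nn 0≤K₁ 0≤K₂)
            }
            where
            eq : ∀ x y → 128ℚ * (x * y) ≡ x * (128ℚ * y)
            eq = solve-∀ ringℚ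

        result : Constants d B E
        -- The slope `q / T` turns `β-small` into an equality.
        result = mkConstants (q * inv T) (*-pos 0<q (inv-pos 0<T)) (*inv* q 0<T) (proj₁ arch₁) (proj₁ arch₂) (proj₂ arch₁) (proj₂ arch₂)
          where
          arch₁ = archimedean (256ℚ * (M₃ * C₁ d) * inv (q * inv T))
          arch₂ = archimedean (128ℚ * (C₁ d * (M₂ * Λ)) * inv q)

      constants : Constants d B E
      constants = MkConstants.result (M (suc (suc d))) (M (suc (suc (suc d)))) 0<M (0≤M (suc (suc (suc d)))) (W-ω (suc (suc d))) (W-ω (suc (suc (suc d))))
          (suc (proj₁ arch)) (s≤s z≤n) (≤-trans (proj₂ arch) (p≤p+q 0≤1)) (dblConst ^ (suc (proj₁ arch) ℕ.* 16)) (1≤^ 1≤dblConst (suc (proj₁ arch) ℕ.* 16)) (near-ratio (suc (proj₁ arch)))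
        where
        arch : ∃[ N ] 256ℚ * (M (suc (suc (suc d))) * C₂ d) ≤ ι N
        arch = archimedean (256ℚ * (M (suc (suc (suc d))) * C₂ d))
        0<M : 0ℚ < M (suc (suc d))
        0<M = <-≤-trans 0<2 (p≤p+q (*-nn 0≤2 (*-nn (ι-nn (suc (suc (suc (suc d))))) (0≤M₀ (suc (suc (suc d)))))))

    -- f oscillates by O(n^(-d/2)) over distances O(√n), with polynomial growth beyond.
    record Osc (d : ℕ) (f : ℕ → ℚ) : Set where
      constructor osc
      field
        C : ℚ
        c : ℕ
        0≤C : 0ℚ ≤ C
        osc≤ : ∀ m y → ∣ f (m ℕ.+ y) - f y ∣ ≤ C * (g (m ℕ.+ y) ^ d * ω (m ℕ.+ y) m ^ c)

    Size : ℕ → (ℕ → ℚ) → Set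
    Size d f = ∃[ C ] (0ℚ ≤ C × (∀ n → ∣ f n ∣ ≤ C * g n ^ d))

    spread″ : ∀ d {β} m y → 0ℚ ≤ β → let n = m ℕ.+ y in
      g y ^ d + β * (ι m * g y ^ suc d) ≤ (1ℚ + (C₁ d + β * C₂ d)) * (g n ^ d * ω n m ^ suc (suc d))
    spread″ d {β} m y 0≤β = ≤-trans (spread d m y 0≤β) (≤-by (+-nn (*-nn 0≤u (-nn (1≤^ (1≤ω n m) (suc (suc d))))) (*-nn (*-nn 0≤u (^-nn (0≤ω n m) (suc (suc d)))) (*-nn (0≤C₁ d) (-nn (g≤1 n)))))
        (eq (g n ^ d) (ω n m ^ suc (suc d)) (C₁ d) (β * C₂ d) (g n)))
      where
      n = m ℕ.+ y
      0≤u = ^-nn (0≤g n) d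
      eq : ∀ u w c b G → (1ℚ + (c + b)) * (u * w) - (u + u * (c * G + b) * w) ≡ u * (w - 1ℚ) + u * w * (c * (1ℚ - G))
      eq = solve-∀ ringℚ

    -- The two extra powers of `g` come from normalisation: divided by the mass `n`, comparable with
    -- `k²`, a generator of size `g^d` has size `g^(d + 2)`. Plain boundedness of `f` starts the
    -- induction at small `n`.
    osc-of-𝓛 : ∀ d f → Size 0 f → Size d (𝓛 f) → Osc (suc (suc d)) f
    osc-of-𝓛 d f (B , 0≤B , f≤) (E , 0≤E , 𝓛≤) = osc (K * (1ℚ + (C₁ d₂ + β * C₂ d₂))) (suc (suc d₂)) (*-nn 0≤K (+-nn 0≤1 (+-nn (0≤C₁ d₂) (*-nn 0≤β (0≤C₂ d₂)))))
        λ m y → ≤-trans (Contraction.bound d₂ f B E 0≤B 0≤E f≤B 𝓛f≤ cs (m ℕ.+ y) m y refl) (≤-trans (*-monoˡ 0≤K (spread″ d₂ m y 0≤β)) (≤-reflexive (sym (*-assoc K (1ℚ + (C₁ d₂ + β * C₂ d₂)) (g (m ℕ.+ y) ^ d₂ * ω (m ℕ.+ y) m ^ suc (suc d₂))))))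
      where
      d₂ = suc (suc d)
      cs : Constants d₂ B E
      cs = constants d₂ B E 0≤B 0≤E
      open Constants cs using (K; β; 0≤K; 0≤β)
      f≤B : ∀ n → ∣ f n ∣ ≤ B
      f≤B n = ≤-trans (f≤ n) (≤-reflexive (*-identityʳ B))
      𝓛f≤ : ∀ n → ∣ 𝓛 f n ∣ ≤ E * (g n ^ d₂ * (k n * k n))
      𝓛f≤ n = ≤-trans (𝓛≤ n) (≤-reflexive (cong (E *_) (sym (trans (eq (g n) (g n ^ d) (k n)) (trans (cong (λ z → z * z * g n ^ d) (kg n)) (eq′ (g n ^ d)))))))
        where
        eq : ∀ x p k → x * (x * p) * (k * k) ≡ k * x * (k * x) * p
        eq = solve-∀ ringℚ
        eq′ : ∀ p → 1ℚ * 1ℚ * p ≡ p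
        eq′ = solve-∀ ringℚ

    g² : ℕ → ℚ
    g² n = g n * g n

    0≤g² : ∀ n → 0ℚ ≤ g² n
    0≤g² n = *-nn (0≤g n) (0≤g n)

    g²≤1 : ∀ n → g² n ≤ 1ℚ
    g²≤1 n = ≤-trans (≤*1 (0≤g n) (g≤1 n)) (g≤1 n)

    open Symbols g² 0≤g² g²≤1


    -- Kernels of jumps and their differences.

    0≤g^ : ∀ d n → 0ℚ ≤ g n ^ d
    0≤g^ d n = ^-nn (0≤g n) d

    g-suc : ∀ n → g (suc n) ≤ g n
    g-suc n = g-anti 1 n

    ω-suc : ∀ n m → ω (suc n) m ≤ ω n m
    ω-suc n m = +-monoʳ-≤ 1ℚ (*-monoˡ (ι-nn m) (g-suc n))

    Kernel : Set
    Kernel = ℕ → ℕ → ℚ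

    -- A kernel p(n , i) is only ever evaluated for i < n, where i stands for the jump from n to n - (i + 1).
    record KBd (e : ℕ) (p : Kernel) : Set where
      constructor kbd
      field
        C : ℚ
        c : ℕ
        0≤C : 0ℚ ≤ C
        kbd≤ : ∀ n i → i ℕ.< n → ∣ p n i ∣ ≤ C * (g n ^ e * ω n (suc i) ^ c)

    ∇ E : Kernel → Kernel
    ∇ p n i = p (suc n) i - p n i
    E p n i = p (suc n) i

    -- The analogue of `Sym` for kernels: the jump length stays fixed while `n` is differenced, and
    -- the gain `g²` raises `e` by 2. Growth in the jump length is any power of `ω`, since all
    -- moments are finite.
    KSym : ℕ → ℕ → Kernel → Set
    KSym zero e p = KBd e p
    KSym (suc J) e p = KBd e p × KSym J (suc (suc e)) (∇ p)

    KBd-cong : ∀ {e p p′} → (∀ n i → i ℕ.< n → p n i ≡ p′ n i) → KBd e p → KBd e p′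
    KBd-cong h (kbd C c 0≤C b) = kbd C c 0≤C λ n i i<n → ≤-trans (≤-reflexive (cong ∣_∣ (sym (h n i i<n)))) (b n i i<n)

    KBd-+ : ∀ {e p p′} → KBd e p → KBd e p′ → KBd e (λ n i → p n i + p′ n i)
    KBd-+ {e} {p} {p′} (kbd C c 0≤C b) (kbd C′ c′ 0≤C′ b′) = kbd (C + C′) (c ℕ.+ c′) (+-nn 0≤C 0≤C′) λ n i i<n →
      ≤-trans (∣p+q∣≤∣p∣+∣q∣ (p n i) (p′ n i)) (≤-trans (+-mono-≤
        (≤-trans (b n i i<n) (*-monoˡ 0≤C (*-monoˡ (0≤g^ e n) (^-exp (1≤ω n (suc i)) (ℕₚ.m≤m+n c c′)))))
        (≤-trans (b′ n i i<n) (*-monoˡ 0≤C′ (*-monoˡ (0≤g^ e n) (^-exp (1≤ω n (suc i)) (ℕₚ.m≤n+m c′ c))))))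
        (≤-reflexive (sym (*-distribʳ-+ (g n ^ e * ω n (suc i) ^ (c ℕ.+ c′)) C C′))))

    KBd-* : ∀ {e e′ p p′} → KBd e p → KBd e′ p′ → KBd (e ℕ.+ e′) (λ n i → p n i * p′ n i)
    KBd-* {e} {e′} {p} {p′} (kbd C c 0≤C b) (kbd C′ c′ 0≤C′ b′) = kbd (C * C′) (c ℕ.+ c′) (*-nn 0≤C 0≤C′) λ n i i<n →
      ≤-trans (≤-reflexive (∣p*q∣≡∣p∣*∣q∣ (p n i) (p′ n i))) (≤-trans (*-mono (0≤∣p∣ (p n i)) (b n i i<n) (0≤∣p∣ (p′ n i)) (b′ n i i<n))
        (≤-reflexive (trans (eq C (g n ^ e) (ω n (suc i) ^ c) C′ (g n ^ e′) (ω n (suc i) ^ c′)) (cong₂ (λ x y → C * C′ * (x * y)) (sym (^-+ (g n) e e′)) (sym (^-+ (ω n (suc i)) c c′))))))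
      where
      eq : ∀ a b c d e f → a * (b * c) * (d * (e * f)) ≡ a * d * (b * e * (c * f))
      eq = solve-∀ ringℚ

    KBd-E : ∀ {e p} → KBd e p → KBd e (E p)
    KBd-E {e} (kbd C c 0≤C b) = kbd C c 0≤C λ n i i<n → ≤-trans (b (suc n) i (ℕₚ.m<n⇒m<1+n i<n))
      (*-monoˡ 0≤C (*-mono (0≤g^ e (suc n)) (^-mono (0≤g (suc n)) (g-suc n) e) (^-nn (0≤ω (suc n) (suc i)) c) (^-mono (0≤ω (suc n) (suc i)) (ω-suc n (suc i)) c)))

    KSym-down : ∀ J {e p} → KSym (suc J) e p → KSym J e p
    KSym-down zero (b , _) = b
    KSym-down (suc J) (b , s) = b , KSym-down J s

    KSym-cong : ∀ J {e p p′} → (∀ n i → i ℕ.< n → p n i ≡ p′ n i) → KSym J e p → KSym J e p′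
    KSym-cong zero h b = KBd-cong h b
    KSym-cong (suc J) h (b , s) = KBd-cong h b , KSym-cong J (λ n i i<n → cong₂ _-_ (h (suc n) i (ℕₚ.m<n⇒m<1+n i<n)) (h n i i<n)) s

    KSym-+ : ∀ J {e p p′} → KSym J e p → KSym J e p′ → KSym J e (λ n i → p n i + p′ n i)
    KSym-+ zero b b′ = KBd-+ b b′
    KSym-+ (suc J) {p = p} {p′} (b , s) (b′ , s′) = KBd-+ b b′ , KSym-cong J (λ n i _ → eq (p (suc n) i) (p n i) (p′ (suc n) i) (p′ n i)) (KSym-+ J s s′)
      where
      eq : ∀ a b c d → a - b + (c - d) ≡ a + c - (b + d)
      eq = solve-∀ ringℚ

    KSym-E : ∀ J {e p} → KSym J e p → KSym J e (E p)
    KSym-E zero b = KBd-E b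
    KSym-E (suc J) (b , s) = KBd-E b , KSym-E J s

    KSym-* : ∀ J {e e′ p p′} → KSym J e p → KSym J e′ p′ → KSym J (e ℕ.+ e′) (λ n i → p n i * p′ n i)
    KSym-* zero b b′ = KBd-* b b′
    KSym-* (suc J) {e} {e′} {p} {p′} s s′ = KBd-* (proj₁ s) (proj₁ s′) , KSym-cong J (λ n i _ → eq (p n i) (p (suc n) i) (p′ n i) (p′ (suc n) i))
      (KSym-+ J (KSym-* J (proj₂ s) (KSym-E J (KSym-down J s′)))
        (subst (λ z → KSym J z (λ n i → p n i * ∇ p′ n i)) (trans (ℕₚ.+-suc e (suc e′)) (cong suc (ℕₚ.+-suc e e′))) (KSym-* J (KSym-down J s) (proj₂ s′))))
      where
      eq : ∀ a b c d → (b - a) * d + a * (d - c) ≡ b * d - a * c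
      eq = solve-∀ ringℚ

    δ : (ℕ → ℚ) → Kernel
    δ f n i = f (n ∸ suc i) - f n

    suc-∸ : ∀ {n i} → i ℕ.< n → suc (n ∸ suc i) ≡ n ∸ i
    suc-∸ i<n = sym (ℕₚ.+-∸-assoc 1 i<n)

    -- Both ends of a jump of fixed length move together with `n`, so `∇` passes through `δ`;
    -- `i < n` makes the truncated subtraction exact.
    ∇δ : ∀ f n i → i ℕ.< n → δ (Δ f) n i ≡ ∇ (δ f) n i
    ∇δ f n i i<n = trans (eq (f (suc (n ∸ suc i))) (f (n ∸ suc i)) (f (suc n)) (f n)) (cong (λ z → f z - f (suc n) - (f (n ∸ suc i) - f n)) (suc-∸ i<n))
      where
      eq : ∀ a b c d → a - b - (c - d) ≡ a - c - (b - d)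
      eq = solve-∀ ringℚ

    OscJ : ℕ → ℕ → (ℕ → ℚ) → Set
    OscJ zero d f = Osc d f
    OscJ (suc J) d f = Osc d f × OscJ J (suc (suc d)) (Δ f)

    OscJ-bd : ∀ J {d f} → OscJ J d f → Osc d f
    OscJ-bd zero o = o
    OscJ-bd (suc J) o = proj₁ o

    OscJ-down : ∀ J {d f} → OscJ (suc J) d f → OscJ J d f
    OscJ-down zero (o , _) = o
    OscJ-down (suc J) (o , s) = o , OscJ-down J s

    Osc⇒KBd : ∀ {d f} → Osc d f → KBd d (δ f)
    Osc⇒KBd {d} {f} (osc C c 0≤C b) = kbd C c 0≤C λ n i i<n → ≤-trans (≤-reflexive (abs-swap (f (n ∸ suc i)) (f n)))
      (subst (λ z → ∣ f z - f (n ∸ suc i) ∣ ≤ C * (g z ^ d * ω z (suc i) ^ c)) (ℕₚ.m+[n∸m]≡n i<n) (b (suc i) (n ∸ suc i)))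

    OscJ⇒KSym : ∀ J {d f} → OscJ J d f → KSym J d (δ f)
    OscJ⇒KSym zero o = Osc⇒KBd o
    OscJ⇒KSym (suc J) {f = f} (o , s) = Osc⇒KBd o , KSym-cong J (∇δ f) (OscJ⇒KSym J s)

    Osc⇒SizeΔ : ∀ {d f} → Osc d f → Size d (Δ f)
    Osc⇒SizeΔ {d} {f} (osc C c 0≤C b) = C * 2ℚ ^ c , *-nn 0≤C (^-nn 0≤2 c) , λ n → ≤-trans (b 1 n) (≤-trans
      (*-monoˡ 0≤C (*-mono (0≤g^ d (suc n)) (^-mono (0≤g (suc n)) (g-suc n) d) (^-nn (0≤ω (suc n) 1) c) (^-mono (0≤ω (suc n) 1) (ω1≤2 n) c)))
      (≤-reflexive (eq C (g n ^ d) (2ℚ ^ c))))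
      where
      ω1≤2 : ∀ n → ω (suc n) 1 ≤ 2ℚ
      ω1≤2 n = +-monoʳ-≤ 1ℚ (≤-trans (≤-reflexive (trans (cong (_* g (suc n)) (+-identityˡ 1ℚ)) (*-identityˡ (g (suc n))))) (g≤1 (suc n)))
      eq : ∀ a b c → a * (b * c) ≡ a * c * b
      eq = solve-∀ ringℚ

    g^suc² : ∀ e n → g n ^ suc (suc e) ≡ g² n * g n ^ e
    g^suc² e n = sym (*-assoc (g n) (g n) (g n ^ e))

    OscJ⇒SymΔ : ∀ J {d f} → OscJ J d f → Sym J (λ n → g n ^ d) (Δ f)
    OscJ⇒SymΔ zero o = Osc⇒SizeΔ o
    OscJ⇒SymΔ (suc J) {d} (o , s) = Osc⇒SizeΔ o , Sym-weaken J (λ n → ≤-reflexive (g^suc² d n)) (OscJ⇒SymΔ J s)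

    Negl : (ℕ → ℚ) → Set
    Negl h = ∀ D → Size D h

    Negl-Δ : ∀ {h} → Negl h → Negl (Δ h)
    Negl-Δ {h} ng D with ng D
    ... | C , 0≤C , b = C + C , +-nn 0≤C 0≤C , λ n → ≤-trans (abs-sub (h (suc n)) (h n)) (≤-trans (+-mono-≤ (≤-trans (b (suc n)) (*-monoˡ 0≤C (^-mono (0≤g (suc n)) (g-suc n) D))) (b n)) (≤-reflexive (sym (*-distribʳ-+ (g n ^ D) C C))))

    -- Differences of a rapidly decreasing sequence need no gain: each is again rapidly decreasing
    -- and beats any weight bounded below by a power of `g`.
    Negl-Sym : ∀ J D {w h} → (∀ n → g n ^ D ≤ w n) → Negl h → Sym J w h
    Negl-Sym zero D le ng = Bd-weaken le (ng D)
    Negl-Sym (suc J) D {w} le ng = Bd-weaken le (ng D) , Negl-Sym J (suc (suc D)) (λ n → ≤-trans (≤-reflexive (g^suc² D n)) (*-monoˡ (0≤g² n) (le n))) (Negl-Δ ng)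

    -- The jump from `suc n` down to 0, which has no counterpart at `n`.
    edge : Kernel → ℕ → ℚ
    edge p n = wt (suc n) n * p (suc n) n

    -- A jump all the way down to 0 has ω ≥ k/4, so the moment bounds make it smaller than any power of g.
    edge-Negl : ∀ {e p} → KBd e p → Negl (edge p)
    edge-Negl {e} {p} (kbd C c 0≤C b) D = C * 4ℚ ^ D₂ * M c′ , *-nn (*-nn 0≤C (^-nn 0≤4 D₂)) (0≤M c′) , bound
      where
      -- Two powers more than claimed, to pay for the factor `k²` in `W-ω`.
      D₂ = suc (suc D)
      c′ = c ℕ.+ D₂
      bound : ∀ n → ∣ edge p n ∣ ≤ C * 4ℚ ^ D₂ * M c′ * g n ^ D
      bound n = begin
        ∣ wt N n * p N n ∣ ≡⟨ trans (∣p*q∣≡∣p∣*∣q∣ (wt N n) (p N n)) (cong (_* ∣ p N n ∣) (0≤p⇒∣p∣≡p (0≤wt N n))) ⟩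
        wt N n * ∣ p N n ∣ ≤⟨ *-monoˡ (0≤wt N n) (≤-trans (b N n ℕₚ.≤-refl) (*-monoˡ 0≤C (≤*1 (^-nn (0≤ω N N) c) (^-≤1 (0≤g N) (g≤1 N) e)))) ⟩
        wt N n * (C * ω N N ^ c) ≤⟨ *-monoˡ (0≤wt N n) (*-monoˡ 0≤C (≤-trans (≤-reflexive (sym (*-identityʳ (ω N N ^ c)))) (*-monoˡ (^-nn (0≤ω N N) c) one≤))) ⟩
        wt N n * (C * (ω N N ^ c * (4ℚ ^ D₂ * ω N N ^ D₂ * g N ^ D₂))) ≡⟨ trans (eq (wt N n) C (ω N N ^ c) (4ℚ ^ D₂) (ω N N ^ D₂) (g N ^ D₂)) (cong (λ z → C * 4ℚ ^ D₂ * g N ^ D₂ * (wt N n * z)) (sym (^-+ (ω N N) c D₂))) ⟩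
        C * 4ℚ ^ D₂ * g N ^ D₂ * (wt N n * ω N N ^ c′) ≤⟨ *-monoˡ (*-nn (*-nn 0≤C (^-nn 0≤4 D₂)) (0≤g^ D₂ N)) (≤-trans (sum-term N (λ i → wt N i * ω N (suc i) ^ c′) (λ i _ → *-nn (0≤wt N i) (^-nn (0≤ω N (suc i)) c′)) n ℕₚ.≤-refl) (W-ω c′ N)) ⟩
        C * 4ℚ ^ D₂ * g N ^ D₂ * (M c′ * (k N * k N)) ≡⟨ eq′ C (4ℚ ^ D₂) (g N) (g N ^ D) (M c′) (k N) ⟩
        C * 4ℚ ^ D₂ * M c′ * (k N * g N * (k N * g N) * g N ^ D) ≡⟨ cong (λ z → C * 4ℚ ^ D₂ * M c′ * (z * z * g N ^ D)) (kg N) ⟩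
        C * 4ℚ ^ D₂ * M c′ * (1ℚ * 1ℚ * g N ^ D) ≡⟨ cong (C * 4ℚ ^ D₂ * M c′ *_) (trans (cong (_* g N ^ D) (*-identityˡ 1ℚ)) (*-identityˡ (g N ^ D))) ⟩
        C * 4ℚ ^ D₂ * M c′ * g N ^ D ≤⟨ *-monoˡ (*-nn (*-nn 0≤C (^-nn 0≤4 D₂)) (0≤M c′)) (^-mono (0≤g N) (g-suc n) D) ⟩
        C * 4ℚ ^ D₂ * M c′ * g n ^ D ∎
        where
        open ≤-Reasoning
        N = suc n
        eq : ∀ w C x f y z → w * (C * (x * (f * y * z))) ≡ C * f * z * (w * (x * y))
        eq = solve-∀ ringℚ
        eq′ : ∀ C f x p m k → C * f * (x * (x * p)) * (m * (k * k)) ≡ C * f * m * (k * x * (k * x) * p)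
        eq′ = solve-∀ ringℚ
        k≤4ω : k N ≤ 4ℚ * ω N N
        k≤4ω = begin
          k N ≡⟨ sym (*-identityʳ (k N)) ⟩
          k N * 1ℚ ≡⟨ trans (cong (k N *_) (sym (kg N))) (sym (*-assoc (k N) (k N) (g N))) ⟩
          k N * k N * g N ≤⟨ *-monoʳ (0≤g N) (k²≤4n n) ⟩
          4ℚ * ι N * g N ≡⟨ *-assoc 4ℚ (ι N) (g N) ⟩
          4ℚ * (ι N * g N) ≤⟨ *-monoˡ 0≤4 (q≤p+q {1ℚ} {ι N * g N} 0≤1) ⟩
          4ℚ * ω N N ∎
        one≤ : 1ℚ ≤ 4ℚ ^ D₂ * ω N N ^ D₂ * g N ^ D₂
        one≤ = begin
          1ℚ ≡⟨ sym (1^ D₂) ⟩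
          1ℚ ^ D₂ ≡⟨ cong (_^ D₂) (sym (kg N)) ⟩
          (k N * g N) ^ D₂ ≤⟨ ^-mono (*-nn (0≤k N) (0≤g N)) (*-monoʳ (0≤g N) k≤4ω) D₂ ⟩
          (4ℚ * ω N N * g N) ^ D₂ ≡⟨ trans (*-^ (4ℚ * ω N N) (g N) D₂) (cong (_* g N ^ D₂) (*-^ 4ℚ (ω N N) D₂)) ⟩
          4ℚ ^ D₂ * ω N N ^ D₂ * g N ^ D₂ ∎

    -- The ratios `v` and the commutator of `Δ` with averages.

    v vi : ℕ → ℚ
    v n = a (suc n) * r n
    vi n = inv (v n)

    1≤v : ∀ n → 1ℚ ≤ v n
    1≤v n = ≤-trans (≤-reflexive (sym (ar n))) (*-monoʳ (0≤r n) (a-step n))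

    0<v : ∀ n → 0ℚ < v n
    0<v n = 1≤⇒0< (1≤v n)

    v-size : Size 0 v
    v-size = vConst , *-nn 0≤4 (+-nn 0≤2 0≤shiftConst) , λ n → begin
      ∣ v n ∣ ≡⟨ 0≤p⇒∣p∣≡p (<⇒≤ (0<v n)) ⟩
      a (suc n) * r n ≤⟨ *-monoʳ (0≤r n) (a-suc≤ n) ⟩
      vConst * a n * r n ≡⟨ trans (*-assoc vConst (a n) (r n)) (cong (vConst *_) (ar n)) ⟩
      vConst * 1ℚ ∎
      where open ≤-Reasoning

    va : ∀ n → v n * a n ≡ a (suc n)
    va n = trans (eq (a (suc n)) (r n) (a n)) (trans (cong (a (suc n) *_) (ar n)) (*-identityʳ (a (suc n))))
      where
      eq : ∀ x y z → x * y * z ≡ x * (z * y)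
      eq = solve-∀ ringℚ

    r-suc : ∀ n → r (suc n) ≡ vi n * r n
    r-suc n = begin
      r (suc n) ≡⟨ sym (trans (cong (_* r (suc n)) (inv-l (0<v n))) (*-identityˡ (r (suc n)))) ⟩
      vi n * v n * r (suc n) ≡⟨ eq (vi n) (a (suc n)) (r n) (r (suc n)) ⟩
      vi n * r n * (a (suc n) * r (suc n)) ≡⟨ trans (cong (vi n * r n *_) (ar (suc n))) (*-identityʳ (vi n * r n)) ⟩
      vi n * r n ∎
      where
      open ≡-Reasoning
      eq : ∀ i x y z → i * (x * y) * z ≡ i * y * (x * z)
      eq = solve-∀ ringℚ

    wt-suc : ∀ n i → i ℕ.< n → wt (suc n) i ≡ wt n i * (1ℚ + vi n * δ v n i)
    wt-suc n i i<n = begin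
      σ i * a (n ∸ i) * r (suc n) ≡⟨ cong₂ (λ x y → σ i * x * y) (trans (cong a (sym (suc-∸ i<n))) (sym (va (n ∸ suc i)))) (r-suc n) ⟩
      σ i * (v (n ∸ suc i) * a (n ∸ suc i)) * (vi n * r n) ≡⟨ eq (σ i) (v (n ∸ suc i)) (a (n ∸ suc i)) (vi n) (r n) ⟩
      wt n i * (0ℚ + vi n * v (n ∸ suc i)) ≡⟨ cong (λ z → wt n i * (z + vi n * v (n ∸ suc i))) (sym zero′) ⟩
      wt n i * (1ℚ - vi n * v n + vi n * v (n ∸ suc i)) ≡⟨ cong (wt n i *_) (eq′ (vi n) (v n) (v (n ∸ suc i))) ⟩
      wt n i * (1ℚ + vi n * δ v n i) ∎
      where
      open ≡-Reasoning
      eq : ∀ s x y i r → s * (x * y) * (i * r) ≡ s * y * r * (0ℚ + i * x)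
      eq = solve-∀ ringℚ
      eq′ : ∀ i x y → 1ℚ - i * x + i * y ≡ 1ℚ + i * (y - x)
      eq′ = solve-∀ ringℚ
      eq″ : ∀ x → x - x ≡ 0ℚ
      eq″ = solve-∀ ringℚ
      zero′ : 1ℚ - vi n * v n ≡ 0ℚ
      zero′ = trans (cong (λ z → 1ℚ - z) (inv-l (0<v n))) (eq″ 1ℚ)

    Qf : Kernel → ℕ → ℚ
    Qf p n = W n (p n)

    -- As `δ v` has order 2 in `g`, this kernel is two orders smaller than `p`, exactly the gain
    -- that a difference must show.
    twist : Kernel → Kernel
    twist p n i = δ v n i * E p n i

    -- The commutator of Δ with the averages Qf: passing from n to n + 1 reweights the jump law by v(n - i - 1)/v(n).
    ΔQ : ∀ p n → Δ (Qf p) n ≡ Qf (∇ p) n + vi n * Qf (twist p) n + edge p n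
    ΔQ p n = begin
      sum n (λ i → wt (suc n) i * p (suc n) i) + edge p n - Qf p n ≡⟨ cong (λ z → z + edge p n - Qf p n) (sum-cong n λ i i<n → trans (cong (_* p (suc n) i) (wt-suc n i i<n)) (eq₁ (wt n i) (vi n) (δ v n i) (p (suc n) i) (p n i))) ⟩
      sum n (λ i → wt n i * p n i + (wt n i * ∇ p n i + vi n * (wt n i * twist p n i))) + edge p n - Qf p n ≡⟨ cong (λ z → z + edge p n - Qf p n) (trans (sum-+ n (λ i → wt n i * p n i) (λ i → wt n i * ∇ p n i + vi n * (wt n i * twist p n i))) (cong (Qf p n +_) (trans (sum-+ n (λ i → wt n i * ∇ p n i) (λ i → vi n * (wt n i * twist p n i))) (cong (Qf (∇ p) n +_) (sum-*ˡ n (vi n) (λ i → wt n i * twist p n i)))))) ⟩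
      Qf p n + (Qf (∇ p) n + vi n * Qf (twist p) n) + edge p n - Qf p n ≡⟨ eq₂ (Qf p n) (Qf (∇ p) n) (vi n * Qf (twist p) n) (edge p n) ⟩
      Qf (∇ p) n + vi n * Qf (twist p) n + edge p n ∎
      where
      open ≡-Reasoning
      eq₁ : ∀ w i d x y → w * (1ℚ + i * d) * x ≡ w * y + (w * (x - y) + i * (w * (d * x)))
      eq₁ = solve-∀ ringℚ
      eq₂ : ∀ a b c e → a + (b + c) + e - a ≡ b + c + e
      eq₂ = solve-∀ ringℚ

    qw : ℕ → ℕ → ℚ
    qw e n = g n ^ e * (k n * k n)

    0≤qw : ∀ e n → 0ℚ ≤ qw e n
    0≤qw e n = *-nn (0≤g^ e n) (*-nn (0≤k n) (0≤k n))

    qw-suc² : ∀ e n → qw (suc (suc e)) n ≡ g n ^ e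
    qw-suc² e n = trans (eq (g n) (g n ^ e) (k n)) (trans (cong (λ z → z * z * g n ^ e) (kg n)) (eq′ (g n ^ e)))
      where
      eq : ∀ x p k → x * (x * p) * (k * k) ≡ k * x * (k * x) * p
      eq = solve-∀ ringℚ
      eq′ : ∀ p → 1ℚ * 1ℚ * p ≡ p
      eq′ = solve-∀ ringℚ

    qw-step : ∀ e n → qw (suc (suc e)) n ≡ g² n * qw e n
    qw-step e n = trans (cong (_* (k n * k n)) (g^suc² e n)) (*-assoc (g² n) (g n ^ e) (k n * k n))

    Q-size : ∀ {e p} → KBd e p → Bd (qw e) (Qf p)
    Q-size {e} {p} (kbd C c 0≤C b) = C * M c , *-nn 0≤C (0≤M c) , λ n → begin
      ∣ Qf p n ∣ ≤⟨ W-abs n (p n) ⟩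
      W n (λ i → ∣ p n i ∣) ≤⟨ W-mono n (λ i i<n → b n i i<n) ⟩
      W n (λ i → C * (g n ^ e * ω n (suc i) ^ c)) ≡⟨ trans (W-*ˡ n C (λ i → g n ^ e * ω n (suc i) ^ c)) (cong (C *_) (W-*ˡ n (g n ^ e) (λ i → ω n (suc i) ^ c))) ⟩
      C * (g n ^ e * W n (λ i → ω n (suc i) ^ c)) ≤⟨ *-monoˡ 0≤C (*-monoˡ (0≤g^ e n) (W-ω c n)) ⟩
      C * (g n ^ e * (M c * (k n * k n))) ≡⟨ eq C (g n ^ e) (M c) (k n * k n) ⟩
      C * M c * qw e n ∎
      where
      open ≤-Reasoning
      eq : ∀ a b c d → a * (b * (c * d)) ≡ a * c * (b * d)
      eq = solve-∀ ringℚ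

    one : ℕ → ℚ
    one _ = 1ℚ

    v-sym : ∀ J → OscJ J 2 v → Sym (suc J) one v
    v-sym J o = v-size , Sym-weaken J (λ n → ≤-reflexive (g^suc² 0 n)) (OscJ⇒SymΔ J o)

    vi-sym : ∀ J → Sym J one v → Sym J one vi
    vi-sym J s = Sym-weaken J (λ n → ≤-trans (≤-reflexive (sym (*-identityˡ (inv 1ℚ)))) (≤-reflexive (inv-r 0<1)))
      (Sym-inv J (λ _ → 0<1) (1ℚ , 0≤1 , λ _ → ≤-reflexive (sym (*-identityˡ 1ℚ))) 0<v (1ℚ , 0≤1 , λ n → ≤-trans (1≤v n) (≤-reflexive (sym (*-identityˡ (v n))))) s)

    v-sym′ : ∀ J → OscJ J 2 v → Sym J one v
    v-sym′ J o = Sym-down J (v-sym J o)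

    g^≤qw : ∀ e n → g n ^ e ≤ qw e n
    g^≤qw e n = ≤-trans (≤-reflexive (sym (*-identityʳ (g n ^ e)))) (*-monoˡ (0≤g^ e n) (≤-trans (1≤k n) (1*≤ (0≤k n) (1≤k n))))

    -- v only needs the order of regularity that precedes the one being established for Qf p.
    Q-sym : ∀ J {e p} → OscJ J 2 v → KSym (suc J) e p → Sym (suc J) (qw e) (Qf p)
    Q-sym₀ : ∀ J {e p} → OscJ J 2 v → KSym J e p → Sym J (qw e) (Qf p)

    Q-sym₀ zero o s = Q-size s
    Q-sym₀ (suc J) o s = Q-sym J (OscJ-down J o) s

    Q-sym J {e} {p} o s = Q-size (proj₁ s) , Sym-cong J (λ n → sym (ΔQ p n))
      (Sym-+ J (Sym-+ J (Sym-weaken J (λ n → ≤-reflexive (qw-step e n)) (Q-sym₀ J o (proj₂ s)))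
          (Sym-weaken J (λ n → ≤-reflexive (trans (*-identityˡ (qw (suc (suc e)) n)) (qw-step e n))) (Sym-* J (λ _ → 0≤1) (0≤qw (suc (suc e))) (vi-sym J (v-sym′ J o)) (Q-sym₀ J o (KSym-* J (OscJ⇒KSym J o) (KSym-E J (KSym-down J s)))))))
        (Negl-Sym J (suc (suc e)) (λ n → ≤-trans (g^≤qw (suc (suc e)) n) (≤-reflexive (qw-step e n))) (edge-Negl (proj₁ s))))

    -- `𝓛 f` is `Qf (δ f)`, and by `∇δ` the first term of `ΔQ` is `𝓛 (Δ f)`; what remains is the
    -- commutator.
    𝓛Δ : ∀ f n → 𝓛 (Δ f) n ≡ Δ (𝓛 f) n - (vi n * Qf (twist (δ f)) n + edge (δ f) n)
    𝓛Δ f n = trans (sum-cong n λ i i<n → cong (wt n i *_) (∇δ f n i i<n)) (trans (eq (Qf (∇ (δ f)) n) (vi n * Qf (twist (δ f)) n) (edge (δ f) n)) (cong (_- (vi n * Qf (twist (δ f)) n + edge (δ f) n)) (sym (ΔQ (δ f) n))))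
      where
      eq : ∀ a b c → a ≡ a + b + c - (b + c)
      eq = solve-∀ ringℚ

    -- The commutator pairs `δ v`, of order 2, with `δ f`, of order `e + 2`, and averaging costs the
    -- two orders of `k²`. The result has order `e + 2`, like `Δ (𝓛 f)`. Only `J` differences of `v`
    -- and `f` are used, so the induction on regularity is not circular.
    𝓛Δ-sym : ∀ J {e f} → OscJ J 2 v → OscJ J (suc (suc e)) f → Sym (suc J) (λ n → g n ^ e) (𝓛 f) → Sym J (λ n → g n ^ suc (suc e)) (𝓛 (Δ f))
    𝓛Δ-sym J {e} {f} ov of s = Sym-cong J (λ n → sym (𝓛Δ f n)) (Sym-sub J
      (Sym-weaken J (λ n → ≤-reflexive (sym (g^suc² e n))) (proj₂ s))
      (Sym-+ J (Sym-weaken J (λ n → ≤-reflexive (trans (*-identityˡ (qw (suc (suc (suc (suc e)))) n)) (qw-suc² (suc (suc e)) n)))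
          (Sym-* J (λ _ → 0≤1) (0≤qw (suc (suc (suc (suc e))))) (vi-sym J (v-sym′ J ov)) (Q-sym₀ J ov (KSym-* J (OscJ⇒KSym J ov) (KSym-E J (OscJ⇒KSym J of))))))
        (Negl-Sym J (suc (suc e)) (λ n → ≤-refl) (edge-Negl (Osc⇒KBd (OscJ-bd J of))))))

    -- Regularity of `v` to all orders.

    Size-Δ : ∀ {f} → Size 0 f → Size 0 (Δ f)
    Size-Δ {f} (C , 0≤C , b) = C + C , +-nn 0≤C 0≤C , λ n → ≤-trans (abs-sub (f (suc n)) (f n)) (≤-trans (+-mono-≤ (b (suc n)) (b n)) (≤-reflexive (sym (*-distribʳ-+ 1ℚ C C))))

    -- The only new bound concerns the difference of `f` of order `J + 1`: `𝓛Δ-sym` carries the size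
    -- of `𝓛 f` up to it, and `osc-of-𝓛` is applied there.
    regularity-step : ∀ J e f → Size 0 f → OscJ J 2 v → OscJ J (suc (suc e)) f → Sym (suc J) (λ n → g n ^ e) (𝓛 f) → OscJ (suc J) (suc (suc e)) f
    regularity-step zero e f sz ov of s = of , osc-of-𝓛 (suc (suc e)) (Δ f) (Size-Δ sz) (𝓛Δ-sym 0 ov of s)
    regularity-step (suc J) e f sz ov of s = proj₁ of , regularity-step J (suc (suc e)) (Δ f) (Size-Δ sz) (OscJ-down J ov) (proj₂ of) (𝓛Δ-sym (suc J) ov of s)

    -- Divide the recurrence at `suc n` by `a n`: the jumps from `n` average `v` to `(n + 1) * v n`
    -- instead of `n * v n`, except for the jump from `suc n` to 0, which is left over. `edge`
    -- evaluates its kernel at `suc n`, so `n ∸ 1` there yields `v n`.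
    𝓛v : ∀ n → 𝓛 v n ≡ v n - edge (λ n _ → v (n ∸ 1)) n
    𝓛v n = begin
      𝓛 v n ≡⟨ eq₀ (𝓛 v n) (W n (λ i → v (n ∸ suc i))) ⟩
      W n (λ i → v (n ∸ suc i)) - (W n (λ i → v (n ∸ suc i)) - 𝓛 v n) ≡⟨ cong₂ _-_ main (sym (𝓛-eq v n)) ⟩
      ι (suc n) * v n - σ n * a 0 * r n - ι n * v n ≡⟨ eq₁ (ι n) (v n) (σ n * a 0 * r n) ⟩
      v n - σ n * a 0 * r n ≡⟨ cong (λ z → v n - z) edge-eq ⟩
      v n - edge (λ n _ → v (n ∸ 1)) n ∎
      where
      open ≡-Reasoning
      eq₀ : ∀ x y → x ≡ y - (y - x)
      eq₀ = solve-∀ ringℚ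
      eq₁ : ∀ i x z → (i + 1ℚ) * x - z - i * x ≡ x - z
      eq₁ = solve-∀ ringℚ
      eq₂ : ∀ s x y z → s * x * z * y ≡ z * (s * (y * x))
      eq₂ = solve-∀ ringℚ
      eq₃ : ∀ t s x z → z * t ≡ (t + s * x) * z - s * x * z
      eq₃ = solve-∀ ringℚ
      T = sum n (λ i → σ i * a (n ∸ i))
      main : W n (λ i → v (n ∸ suc i)) ≡ ι (suc n) * v n - σ n * a 0 * r n
      main = begin
        W n (λ i → v (n ∸ suc i)) ≡⟨ sum-cong n (λ i i<n → trans (eq₂ (σ i) (a (n ∸ suc i)) (v (n ∸ suc i)) (r n)) (cong (λ z → r n * (σ i * z)) (trans (va (n ∸ suc i)) (cong a (suc-∸ i<n))))) ⟩
        sum n (λ i → r n * (σ i * a (n ∸ i))) ≡⟨ sum-*ˡ n (r n) (λ i → σ i * a (n ∸ i)) ⟩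
        r n * T ≡⟨ eq₃ T (σ n) (a 0) (r n) ⟩
        (T + σ n * a 0) * r n - σ n * a 0 * r n ≡⟨ cong (λ z → (T + σ n * a z) * r n - σ n * a 0 * r n) (sym (ℕₚ.n∸n≡0 n)) ⟩
        sum (suc n) (λ i → σ i * a (n ∸ i)) * r n - σ n * a 0 * r n ≡⟨ cong (λ z → z * r n - σ n * a 0 * r n) (sym (rec (suc n))) ⟩
        ι (suc n) * a (suc n) * r n - σ n * a 0 * r n ≡⟨ cong (_- σ n * a 0 * r n) (*-assoc (ι (suc n)) (a (suc n)) (r n)) ⟩
        ι (suc n) * v n - σ n * a 0 * r n ∎
      edge-eq : σ n * a 0 * r n ≡ wt (suc n) n * v n
      edge-eq = begin
        σ n * a 0 * r n ≡⟨ cong (λ z → σ n * a z * r n) (sym (ℕₚ.n∸n≡0 n)) ⟩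
        σ n * a (n ∸ n) * r n ≡⟨ sym (trans (cong (σ n * a (n ∸ n) * r n *_) (ar (suc n))) (*-identityʳ (σ n * a (n ∸ n) * r n))) ⟩
        σ n * a (n ∸ n) * r n * (a (suc n) * r (suc n)) ≡⟨ eq₄ (σ n * a (n ∸ n)) (r n) (a (suc n)) (r (suc n)) ⟩
        wt (suc n) n * v n ∎
        where
        eq₄ : ∀ x y z w → x * y * (z * w) ≡ x * w * (z * y)
        eq₄ = solve-∀ ringℚ

    abstract
      v-edge-Negl : Negl (edge (λ n _ → v (n ∸ 1)))
      v-edge-Negl = edge-Negl {0} (kbd vConst 0 (proj₁ (proj₂ v-size)) λ n i _ → ≤-trans (proj₂ (proj₂ v-size) (n ∸ 1)) (≤-reflexive (cong (vConst *_) (sym (*-identityˡ 1ℚ)))))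

    𝓛v-sym : ∀ J → Sym J one v → Sym J one (𝓛 v)
    𝓛v-sym J s = Sym-cong J (λ n → sym (𝓛v n)) (Sym-sub J s (Negl-Sym J 0 (λ _ → ≤-refl) v-edge-Negl))

    abstract
      -- Bootstrap: `𝓛 v` is `v` up to a negligible term, so oscillation bounds of order `J` for `v`
      -- control `suc J` differences of `𝓛 v`, and `regularity-step` returns oscillation bounds of
      -- order `suc J` for `v`.
      v-regular : ∀ J → OscJ J 2 v
      v-regular zero = osc-of-𝓛 0 v v-size (𝓛v-sym 0 v-size)
      v-regular (suc J) = regularity-step J 0 v v-size (v-regular J) (v-regular J) (𝓛v-sym (suc J) (v-sym J (v-regular J)))


    -- The last half power, and the lower bound for `Dv`.

    telescope : ∀ f j y → f (j ℕ.+ y) - f y ≡ sum j (λ t → Δ f (t ℕ.+ y))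
    telescope f zero y = eq (f y)
      where
      eq : ∀ x → x - x ≡ 0ℚ
      eq = solve-∀ ringℚ
    telescope f (suc j) y = trans (eq (f (suc (j ℕ.+ y))) (f (j ℕ.+ y)) (f y)) (cong (_+ Δ f (j ℕ.+ y)) (telescope f j y))
      where
      eq : ∀ x y z → x - z ≡ y - z + (x - y)
      eq = solve-∀ ringℚ

    window : ∀ {d f} (o : Osc d f) n i → ι i ≤ k n → ∣ f (i ℕ.+ n) - f n ∣ ≤ Osc.C o * 2ℚ ^ Osc.c o * g n ^ d
    window {d} {f} (osc C c 0≤C b) n i i≤k = ≤-trans (b i n) (≤-trans
      (*-monoˡ 0≤C (*-mono (0≤g^ d (i ℕ.+ n)) (^-mono (0≤g (i ℕ.+ n)) (g-anti i n) d) (^-nn (0≤ω (i ℕ.+ n) i) c) (^-mono (0≤ω (i ℕ.+ n) i) ω≤2 c)))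
      (≤-reflexive (eq C (g n ^ d) (2ℚ ^ c))))
      where
      ω≤2 : ω (i ℕ.+ n) i ≤ 2ℚ
      ω≤2 = +-monoʳ-≤ 1ℚ (≤-trans (*-mono (ι-nn i) i≤k (0≤g (i ℕ.+ n)) (g-anti i n)) (≤-reflexive (kg n)))
      eq : ∀ a b c → a * (b * c) ≡ a * c * b
      eq = solve-∀ ringℚ

    -- Averaging Δ f over a window of length k: the average is small because f oscillates little, and Δ f is nearly constant.
    gain : ∀ {d f} → Osc d f → Osc (suc (suc d)) (Δ f) → Size (suc d) (Δ f)
    gain {d} {f} o o′ = A + A′ , +-nn 0≤A 0≤A′ , λ n → begin
      ∣ Δ f n ∣ ≡⟨ sym (trans (cong (_* ∣ Δ f n ∣) (trans (*-comm (g n) (k n)) (kg n))) (*-identityˡ ∣ Δ f n ∣)) ⟩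
      g n * k n * ∣ Δ f n ∣ ≡⟨ *-assoc (g n) (k n) ∣ Δ f n ∣ ⟩
      g n * (k n * ∣ Δ f n ∣) ≤⟨ *-monoˡ (0≤g n) (main n) ⟩
      g n * (A * g n ^ d + k n * (A′ * g n ^ suc (suc d))) ≡⟨ eq₁ (g n) A (g n ^ d) (k n) A′ ⟩
      A * g n ^ suc d + k n * g n * (A′ * g n ^ suc (suc d)) ≡⟨ cong (λ z → A * g n ^ suc d + z) (trans (cong (_* (A′ * g n ^ suc (suc d))) (kg n)) (*-identityˡ (A′ * g n ^ suc (suc d)))) ⟩
      A * g n ^ suc d + A′ * g n ^ suc (suc d) ≤⟨ +-monoʳ-≤ (A * g n ^ suc d) (*-monoˡ 0≤A′ (≤*1 (0≤g^ (suc d) n) (g≤1 n))) ⟩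
      A * g n ^ suc d + A′ * g n ^ suc d ≡⟨ sym (*-distribʳ-+ (g n ^ suc d) A A′) ⟩
      (A + A′) * g n ^ suc d ∎
      where
      open ≤-Reasoning
      A A′ : ℚ
      A = Osc.C o * 2ℚ ^ Osc.c o
      A′ = Osc.C o′ * 2ℚ ^ Osc.c o′
      0≤A : 0ℚ ≤ A
      0≤A = *-nn (Osc.0≤C o) (^-nn 0≤2 (Osc.c o))
      0≤A′ : 0ℚ ≤ A′
      0≤A′ = *-nn (Osc.0≤C o′) (^-nn 0≤2 (Osc.c o′))
      eq₁ : ∀ x a p k b → x * (a * p + k * (b * (x * (x * p)))) ≡ a * (x * p) + k * x * (b * (x * (x * p)))
      eq₁ = solve-∀ ringℚ
      eq₂ : ∀ x y → x ≡ y - (y - x)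
      eq₂ = solve-∀ ringℚ
      eq₃ : ∀ x y → x + (- 1ℚ) * y ≡ x - y
      eq₃ = solve-∀ ringℚ
      main : ∀ n → k n * ∣ Δ f n ∣ ≤ A * g n ^ d + k n * (A′ * g n ^ suc (suc d))
      main n = begin
        k n * ∣ Δ f n ∣ ≡⟨ trans (cong (_* ∣ Δ f n ∣) (sym (0≤p⇒∣p∣≡p (0≤k n)))) (sym (∣p*q∣≡∣p∣*∣q∣ (k n) (Δ f n))) ⟩
        ∣ k n * Δ f n ∣ ≡⟨ cong ∣_∣ (trans (eq₂ (k n * Δ f n) (f (h ℕ.+ n) - f n)) (cong (λ z → f (h ℕ.+ n) - f n - z) diff)) ⟩
        ∣ f (h ℕ.+ n) - f n - sum h (λ t → Δ f (t ℕ.+ n) - Δ f n) ∣ ≤⟨ abs-sub (f (h ℕ.+ n) - f n) (sum h (λ t → Δ f (t ℕ.+ n) - Δ f n)) ⟩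
        ∣ f (h ℕ.+ n) - f n ∣ + ∣ sum h (λ t → Δ f (t ℕ.+ n) - Δ f n) ∣ ≤⟨ +-mono-≤ (window o n h ≤-refl) (≤-trans (sum-abs h (λ t → Δ f (t ℕ.+ n) - Δ f n)) (≤-trans (sum-mono h λ t t<h → window o′ n t (ι-mono (ℕₚ.<⇒≤ t<h))) (≤-reflexive (sum-const h (A′ * g n ^ suc (suc d)))))) ⟩
        A * g n ^ d + k n * (A′ * g n ^ suc (suc d)) ∎
        where
        h = κ n
        diff : f (h ℕ.+ n) - f n - k n * Δ f n ≡ sum h (λ t → Δ f (t ℕ.+ n) - Δ f n)
        diff = trans (cong₂ _-_ (telescope f h n) (sym (sum-const h (Δ f n)))) (trans (sym (eq₃ (sum h (λ t → Δ f (t ℕ.+ n))) (sum h (λ _ → Δ f n)))) (trans (cong (sum h (λ t → Δ f (t ℕ.+ n)) +_) (sym (sum-*ˡ h (- 1ℚ) (λ _ → Δ f n)))) (trans (sym (sum-+ h (λ t → Δ f (t ℕ.+ n)) (λ _ → (- 1ℚ) * Δ f n))) (sum-cong h λ t _ → eq₃ (Δ f (t ℕ.+ n)) (Δ f n)))))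

    gain-sym : ∀ J {d f} → OscJ (suc J) d f → Sym J (λ n → g n ^ suc d) (Δ f)
    gain-sym zero (o , o′) = gain o o′
    gain-sym (suc J) {d} (o , s) = gain o (proj₁ s) , Sym-weaken J (λ n → ≤-reflexive (g^suc² (suc d) n)) (gain-sym J s)

    Dv : ℕ → ℚ
    Dv n = v n - v (suc n)

    Dv-sym : ∀ J → Sym J (λ n → g n ^ 3) Dv
    Dv-sym J = Sym-cong J (λ n → eq (v (suc n)) (v n)) (Sym-neg J (gain-sym J (v-regular (suc J))))
      where
      eq : ∀ x y → - (x - y) ≡ y - x
      eq = solve-∀ ringℚ

    Δv-osc : Osc 4 (Δ v)
    Δv-osc = proj₂ (v-regular 1)

    -- Since 𝓛 v ≈ v ≥ 1 is an average of v(n - j) - v(n) ≈ j (v(n) - v(n + 1)), these bounds force a lower bound on Dv.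
    drop≤ : ∀ j y → let n = j ℕ.+ y in v y - v n ≤ ι j * Dv n + Osc.C Δv-osc * (g n ^ 3 * ω n j ^ suc (Osc.c Δv-osc))
    drop≤ j y = begin
      v y - v n ≡⟨ eq₁ (v y) (v n) ⟩
      - (v n - v y) ≡⟨ cong -_ (telescope v j y) ⟩
      - sum j (λ t → Δ v (t ℕ.+ y)) ≤⟨ neg-antimono-≤ (≤-trans (≤-reflexive (sym (sum-const j (Δ v n - e)))) (sum-mono j pt)) ⟩
      - (ι j * (Δ v n - e)) ≡⟨ eq₂ (ι j) (v (suc n)) (v n) C (g n) (g n ^ 3) (ω n j ^ c) ⟩
      ι j * Dv n + C * (g n ^ 3 * (ι j * g n * ω n j ^ c)) ≤⟨ +-monoʳ-≤ (ι j * Dv n) (*-monoˡ 0≤C (*-monoˡ (0≤g^ 3 n) (*-monoʳ (^-nn (0≤ω n j) c) (q≤p+q {1ℚ} {ι j * g n} 0≤1)))) ⟩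
      ι j * Dv n + C * (g n ^ 3 * (ω n j * ω n j ^ c)) ∎
      where
      open ≤-Reasoning
      open Osc Δv-osc using (C; c; 0≤C; osc≤)
      n = j ℕ.+ y
      e : ℚ
      e = C * (g n ^ 4 * ω n j ^ c)
      eq₁ : ∀ x y → x - y ≡ - (y - x)
      eq₁ = solve-∀ ringℚ
      eq₂ : ∀ j b a C x p w → - (j * (b - a - C * (x * p * w))) ≡ j * (a - b) + C * (p * (j * x * w))
      eq₂ = solve-∀ ringℚ
      eq₃ : ∀ x y e → y - (x - e) ≡ e - (x - y)
      eq₃ = solve-∀ ringℚ
      pt : ∀ t → t ℕ.< j → Δ v n - e ≤ Δ v (t ℕ.+ y)
      pt t t<j = ≤-by (-nn (≤-trans (≤abs (Δ v n - Δ v (t ℕ.+ y))) bnd)) (eq₃ (Δ v n) (Δ v (t ℕ.+ y)) e)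
        where
        n≡ : j ∸ t ℕ.+ (t ℕ.+ y) ≡ n
        n≡ = trans (sym (ℕₚ.+-assoc (j ∸ t) t y)) (cong (ℕ._+ y) (ℕₚ.m∸n+n≡m (ℕₚ.<⇒≤ t<j)))
        bnd : ∣ Δ v n - Δ v (t ℕ.+ y) ∣ ≤ e
        bnd = ≤-trans (subst (λ z → ∣ Δ v z - Δ v (t ℕ.+ y) ∣ ≤ C * (g z ^ 4 * ω z (j ∸ t) ^ c)) n≡ (osc≤ (j ∸ t) (t ℕ.+ y)))
          (*-monoˡ 0≤C (*-monoˡ (0≤g^ 4 n) (^-mono (0≤ω n (j ∸ t)) (+-monoʳ-≤ 1ℚ (*-monoʳ (0≤g n) (ι-mono (ℕₚ.m∸n≤m j t)))) c)))

    module LowerBound (C E : ℚ) (c : ℕ) (0≤C : 0ℚ ≤ C) (0≤E : 0ℚ ≤ E) (M₁ M₂ : ℚ) (0≤M₁ : 0ℚ ≤ M₁) (0≤M₂ : 0ℚ ≤ M₂)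
      (moment₁ : ∀ n → W n (λ i → ω n (suc i) ^ 1) ≤ M₁ * (k n * k n))
      (moment₂ : ∀ n → W n (λ i → ω n (suc i) ^ c) ≤ M₂ * (k n * k n))
      (drop : ∀ j y → v y - v (j ℕ.+ y) ≤ ι j * Dv (j ℕ.+ y) + C * (g (j ℕ.+ y) ^ 3 * ω (j ℕ.+ y) j ^ c))
      (edge≤ : ∀ n → 1ℚ - E * g n ≤ 𝓛 v n) where

      -- The total jump length `S` is at most `M₁ k³`. As `𝓛 v n` is at least 1 up to `E g`, and
      -- replacing `v` by its tangent costs `C M₂ g`, for large `n` at least half of the 1 must come
      -- from `Dv n * S`.
      low : ∀ n → 2ℚ * (E + C * M₂) ≤ k n → g n ^ 3 ≤ 2ℚ * M₁ * Dv n
      low n large = begin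
        g n ^ 3 ≡⟨ sym (*-identityˡ (g n ^ 3)) ⟩
        1ℚ * g n ^ 3 ≤⟨ *-monoʳ (0≤g^ 3 n) 1≤ ⟩
        2ℚ * (Dv n * S) * g n ^ 3 ≤⟨ *-monoʳ (0≤g^ 3 n) (*-monoˡ 0≤2 (*-monoˡ 0≤D S≤)) ⟩
        2ℚ * (Dv n * (M₁ * (k n * k n * k n))) * g n ^ 3 ≡⟨ eq₁ (Dv n) M₁ (k n) (g n) ⟩
        2ℚ * M₁ * Dv n * (k n * g n * (k n * g n) * (k n * g n)) ≡⟨ cong (λ z → 2ℚ * M₁ * Dv n * (z * z * z)) (kg n) ⟩
        2ℚ * M₁ * Dv n * (1ℚ * 1ℚ * 1ℚ) ≡⟨ eq₂ (2ℚ * M₁ * Dv n) ⟩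
        2ℚ * M₁ * Dv n ∎
        where
        open ≤-Reasoning
        S : ℚ
        S = W n (λ i → ι (suc i))
        0≤S : 0ℚ ≤ S
        0≤S = W-nn n (λ i _ → ι-nn (suc i))
        eq₁ : ∀ d m k x → 2ℚ * (d * (m * (k * k * k))) * (x * (x * (x * 1ℚ))) ≡ 2ℚ * m * d * (k * x * (k * x) * (k * x))
        eq₁ = solve-∀ ringℚ
        eq₂ : ∀ x → x * (1ℚ * 1ℚ * 1ℚ) ≡ x
        eq₂ = solve-∀ ringℚ
        eq₅ : ∀ j k x → j * (k * x) + k ≡ k * ((1ℚ + j * x) * 1ℚ)
        eq₅ = solve-∀ ringℚ
        S≤ : S ≤ M₁ * (k n * k n * k n)
        S≤ = begin
          S ≤⟨ W-mono n (λ i _ → ≤-trans (≤-trans (≤-reflexive (sym (trans (cong (ι (suc i) *_) (kg n)) (*-identityʳ (ι (suc i)))))) (p≤p+q (0≤k n))) (≤-reflexive (eq₅ (ι (suc i)) (k n) (g n)))) ⟩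
          W n (λ i → k n * ω n (suc i) ^ 1) ≡⟨ W-*ˡ n (k n) (λ i → ω n (suc i) ^ 1) ⟩
          k n * W n (λ i → ω n (suc i) ^ 1) ≤⟨ *-monoˡ (0≤k n) (moment₁ n) ⟩
          k n * (M₁ * (k n * k n)) ≡⟨ eq₆ (k n) M₁ ⟩
          M₁ * (k n * k n * k n) ∎
          where
          eq₆ : ∀ k m → k * (m * (k * k)) ≡ m * (k * k * k)
          eq₆ = solve-∀ ringℚ
        𝓛≤ : 𝓛 v n ≤ Dv n * S + C * M₂ * g n
        𝓛≤ = begin
          𝓛 v n ≤⟨ W-mono n (λ i i<n → subst (λ z → v (n ∸ suc i) - v z ≤ ι (suc i) * Dv z + C * (g z ^ 3 * ω z (suc i) ^ c)) (ℕₚ.m+[n∸m]≡n i<n) (drop (suc i) (n ∸ suc i))) ⟩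
          W n (λ i → ι (suc i) * Dv n + C * (g n ^ 3 * ω n (suc i) ^ c)) ≡⟨ sum-cong n (λ i _ → cong (wt n i *_) (eq₃ (ι (suc i)) (Dv n) C (g n ^ 3) (ω n (suc i) ^ c))) ⟩
          W n (λ i → Dv n * ι (suc i) + C * g n ^ 3 * ω n (suc i) ^ c) ≡⟨ trans (W-+ n (λ i → Dv n * ι (suc i)) (λ i → C * g n ^ 3 * ω n (suc i) ^ c)) (cong₂ _+_ (W-*ˡ n (Dv n) (λ i → ι (suc i))) (W-*ˡ n (C * g n ^ 3) (λ i → ω n (suc i) ^ c))) ⟩
          Dv n * S + C * g n ^ 3 * W n (λ i → ω n (suc i) ^ c) ≤⟨ +-monoʳ-≤ (Dv n * S) (*-monoˡ (*-nn 0≤C (0≤g^ 3 n)) (moment₂ n)) ⟩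
          Dv n * S + C * g n ^ 3 * (M₂ * (k n * k n)) ≡⟨ cong (Dv n * S +_) (trans (eq₄ C (g n) M₂ (k n)) (trans (cong (λ z → C * M₂ * g n * (z * z)) (kg n)) (trans (cong (C * M₂ * g n *_) (*-identityˡ 1ℚ)) (*-identityʳ (C * M₂ * g n))))) ⟩
          Dv n * S + C * M₂ * g n ∎
          where
          eq₃ : ∀ j d C p w → j * d + C * (p * w) ≡ d * j + C * p * w
          eq₃ = solve-∀ ringℚ
          eq₄ : ∀ C x m k → C * (x * (x * (x * 1ℚ))) * (m * (k * k)) ≡ C * m * x * (k * x * (k * x))
          eq₄ = solve-∀ ringℚ
        small : 2ℚ * (E + C * M₂) * g n ≤ 1ℚ
        small = ≤-trans (*-monoʳ (0≤g n) large) (≤-reflexive (kg n))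
        1≤ : 1ℚ ≤ 2ℚ * (Dv n * S)
        1≤ = ≤-by (+-nn (*-nn 0≤2 (-nn (≤-trans (edge≤ n) 𝓛≤))) (-nn small)) (eq₇ (Dv n * S) E (C * M₂) (g n))
          where
          eq₇ : ∀ x e c g → 2ℚ * x - 1ℚ ≡ 2ℚ * (x + c * g - (1ℚ - e * g)) + (1ℚ - 2ℚ * (e + c) * g)
          eq₇ = solve-∀ ringℚ
        0≤D : 0ℚ ≤ Dv n
        0≤D with ≤-total 0ℚ (Dv n)
        ... | inj₁ h = h
        ... | inj₂ h = ⊥-elim (<-irrefl refl (<-≤-trans 0<1 (≤-trans 1≤ (≤-trans (*-monoˡ 0≤2 (≤-trans (*-monoʳ 0≤S h) (≤-reflexive (*-zeroˡ S)))) (≤-reflexive (*-zeroʳ 2ℚ))))))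

    1-edge≤ : ∀ n → 1ℚ - proj₁ (v-edge-Negl 1) * g n ≤ 𝓛 v n
    1-edge≤ n = ≤-trans (+-mono-≤ (1≤v n) (neg-antimono-≤ (≤-trans (≤abs (edge (λ n _ → v (n ∸ 1)) n)) (≤-trans (proj₂ (proj₂ (v-edge-Negl 1)) n) (≤-reflexive (cong (proj₁ (v-edge-Negl 1) *_) (*-identityʳ (g n)))))))) (≤-reflexive (sym (𝓛v n)))

    abstract
      Dv-low : ∃[ C ] ∃[ K₀ ] (0ℚ ≤ C × (∀ n → K₀ ≤ k n → g n ^ 3 ≤ C * Dv n))
      Dv-low = 2ℚ * M 1 , 2ℚ * (proj₁ (v-edge-Negl 1) + Osc.C Δv-osc * M (suc (Osc.c Δv-osc))) , *-nn 0≤2 (0≤M 1) ,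
        LowerBound.low (Osc.C Δv-osc) (proj₁ (v-edge-Negl 1)) (suc (Osc.c Δv-osc)) (Osc.0≤C Δv-osc) (proj₁ (proj₂ (v-edge-Negl 1))) (M 1) (M (suc (Osc.c Δv-osc))) (0≤M 1) (0≤M (suc (Osc.c Δv-osc))) (W-ω 1) (W-ω (suc (Osc.c Δv-osc))) drop≤ 1-edge≤

    -- Log-concavity of renewal sequences.

    κ-large : ∀ N n → N ℕ.* N ℕ.≤ n → ι N ≤ k n
    κ-large N n h = sq-cancel (0≤k n) (≤-trans (≤-reflexive (sym (ι-* N N))) (≤-trans (ι-mono h) (n≤k² n)))

    -- Both demands of `small` reduce to `x * g n ≤ 1ℚ`: the weight is `g³`, and the squared step
    -- `g⁴` is smaller than it by one factor `g`.
    scale : Scale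
    scale = record
      { step = g² ; w = λ n → g n ^ 3 ; 0≤step = 0≤g² ; step≤1 = g²≤1 ; 0<w = λ n → ^-pos (0<g n) 3
      ; D = 2ℚ ^ 3 * 2ℚ ^ 3 ; 0≤D = *-nn (^-nn 0≤2 3) (^-nn 0≤2 3)
      ; w-suc = λ n → ≤-trans (g′^≤ 3 1 n) (*-monoʳ (0≤g^ 3 (suc n)) (*-monoˡ (^-nn 0≤2 3) (^-mono (0≤ω (suc n) 1) (ω1≤2 n) 3)))
      ; small = λ x → proj₁ (archimedean x) ℕ.* proj₁ (archimedean x) , λ n h → small x n (≤-trans (proj₂ (archimedean x)) (κ-large (proj₁ (archimedean x)) n h)) }
      where
      ω1≤2 : ∀ n → ω (suc n) 1 ≤ 2ℚ
      ω1≤2 n = +-monoʳ-≤ 1ℚ (≤-trans (≤-reflexive (trans (cong (_* g (suc n)) (+-identityˡ 1ℚ)) (*-identityˡ (g (suc n))))) (g≤1 (suc n)))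
      small : ∀ x n → x ≤ k n → x * g n ^ 3 ≤ 1ℚ × x * (g² n * g² n) ≤ g n ^ 3
      small x n x≤k = ≤-trans (≤-reflexive (sym (*-assoc x (g n) (g n ^ 2)))) (≤-trans (≤*1 (0≤g^ 2 n) xg≤1) (^-≤1 (0≤g n) (g≤1 n) 2)) ,
        ≤-trans (≤-reflexive (eq x (g n))) (≤*1 (0≤g^ 3 n) xg≤1)
        where
        xg≤1 : x * g n ≤ 1ℚ
        xg≤1 = ≤-trans (*-monoʳ (0≤g n) x≤k) (≤-reflexive (kg n))
        eq : ∀ x y → x * (y * y * (y * y)) ≡ x * y * (y * (y * (y * 1ℚ)))
        eq = solve-∀ ringℚ

    uv : ℕ → ℚ
    uv n = Dv n * vi n

    uv-sym : ∀ J → Sym J (λ n → g n ^ 3) uv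
    uv-sym J = Sym-weaken J (λ n → ≤-reflexive (*-identityʳ (g n ^ 3))) (Sym-* J (0≤g^ 3) (λ _ → 0≤1) (Dv-sym J) (vi-sym J (v-sym′ J (v-regular J))))

    uv-eq : ∀ n → a n * a (suc (suc n)) ≡ a (suc n) * a (suc n) * (1ℚ - uv n)
    uv-eq n = begin
      a n * a (suc (suc n)) ≡⟨ cong (a n *_) (sym (va (suc n))) ⟩
      a n * (v (suc n) * a (suc n)) ≡⟨ sym (trans (cong (_* (a n * (v (suc n) * a (suc n)))) (inv-r (0<v n))) (*-identityˡ (a n * (v (suc n) * a (suc n))))) ⟩
      v n * vi n * (a n * (v (suc n) * a (suc n))) ≡⟨ eq₁ (v n) (vi n) (a n) (v (suc n)) (a (suc n)) ⟩
      v n * a n * a (suc n) * (v (suc n) * vi n) ≡⟨ cong₂ (λ x y → x * a (suc n) * y) (va n) (trans (eq₂ (v n) (v (suc n)) (vi n)) (cong (_- (v n - v (suc n)) * vi n) (inv-r (0<v n)))) ⟩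
      a (suc n) * a (suc n) * (1ℚ - uv n) ∎
      where
      open ≡-Reasoning
      eq₁ : ∀ v i x w y → v * i * (x * (w * y)) ≡ v * x * y * (w * i)
      eq₁ = solve-∀ ringℚ
      eq₂ : ∀ v w i → w * i ≡ v * i - (v - w) * i
      eq₂ = solve-∀ ringℚ

    asymptotically-log-concave : ∀ j → ∃[ N ] (∀ i → i ℕ.≤ j → ∀ n → N ℕ.≤ n → 0ℚ ≤ Lℚ^ i a n)
    asymptotically-log-concave j = proj₁ res ℕ.+ N , λ i i≤j n N≤n →
      subst (0ℚ ≤_) (trans (Lℚ^-shift i a N (n ∸ N)) (cong (Lℚ^ i a) (ℕₚ.m∸n+n≡m (ℕₚ.≤-trans (ℕₚ.m≤n+m N (proj₁ res)) N≤n))))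
        (proj₂ res i i≤j (n ∸ N) (ℕₚ.≤-trans (ℕₚ.≤-reflexive (sym (ℕₚ.m+n∸n≡m (proj₁ res) N))) (ℕₚ.∸-monoˡ-≤ N N≤n)))
      where
      C K₀ : ℚ
      C = proj₁ Dv-low
      K₀ = proj₁ (proj₂ Dv-low)
      0≤C : 0ℚ ≤ C
      0≤C = proj₁ (proj₂ (proj₂ Dv-low))
      N : ℕ
      N = proj₁ (archimedean K₀) ℕ.* proj₁ (archimedean K₀)
      D≤ : ∀ n → g (n ℕ.+ N) ^ 3 ≤ C * Dv (n ℕ.+ N)
      D≤ n = proj₂ (proj₂ (proj₂ Dv-low)) (n ℕ.+ N) (≤-trans (proj₂ (archimedean K₀)) (κ-large (proj₁ (archimedean K₀)) (n ℕ.+ N) (ℕₚ.m≤n+m N n)))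
      Vc : ℚ
      Vc = proj₁ v-size
      low : ∀ n → g (n ℕ.+ N) ^ 3 ≤ C * Vc * uv (n ℕ.+ N)
      low n = begin
        g m ^ 3 ≤⟨ D≤ n ⟩
        C * Dv m ≡⟨ cong (C *_) (sym (trans (cong (Dv m *_) (inv-r (0<v m))) (*-identityʳ (Dv m)))) ⟩
        C * (Dv m * (v m * vi m)) ≡⟨ eq C (Dv m) (v m) (vi m) ⟩
        C * Dv m * vi m * v m ≤⟨ *-monoˡ (*-nn (≤-trans (0≤g^ 3 m) (D≤ n)) (inv-nn (0<v m))) (≤-trans (≤abs (v m)) (≤-trans (proj₂ (proj₂ v-size) m) (≤-reflexive (*-identityʳ Vc)))) ⟩
        C * Dv m * vi m * Vc ≡⟨ eq′ C (Dv m) (vi m) Vc ⟩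
        C * Vc * uv m ∎
        where
        open ≤-Reasoning
        m = n ℕ.+ N
        eq : ∀ c d v i → c * (d * (v * i)) ≡ c * d * i * v
        eq = solve-∀ ringℚ
        eq′ : ∀ c d i v → c * d * i * v ≡ c * v * (d * i)
        eq′ = solve-∀ ringℚ
      reg : Regular (shiftScale N scale) (λ n → uv (n ℕ.+ N))
      reg = record { C = C * Vc ; 0≤C = *-nn 0≤C (proj₁ (proj₂ v-size)) ; w≤Cu = low ; sym-u = λ J → shiftSym N scale J (uv-sym J) }
      res : ∃[ N′ ] (∀ i → i ℕ.≤ j → ∀ n → N′ ℕ.≤ n → 0ℚ ≤ Lℚ^ i (λ m → a (m ℕ.+ N)) n)
      res = eventually-log-concave j (shiftScale N scale) (λ n → a (n ℕ.+ N)) (λ n → uv (n ℕ.+ N)) (λ n → 0<a (n ℕ.+ N)) (λ n → uv-eq (n ℕ.+ N)) reg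


  -- Overpartitions as a renewal sequence

  -- Sequences stand for power series in `q`: `sh₁` multiplies by `q`, `sh j` by `q^j`.
  sh₁ : (ℕ → ℚ) → ℕ → ℚ
  sh₁ f zero = 0ℚ
  sh₁ f (suc n) = f n

  sh : ℕ → (ℕ → ℚ) → ℕ → ℚ
  sh zero f = f
  sh (suc j) f = sh₁ (sh j f)

  sh₁-cong : ∀ {f h} → (∀ n → f n ≡ h n) → ∀ n → sh₁ f n ≡ sh₁ h n
  sh₁-cong e zero = refl
  sh₁-cong e (suc n) = e n

  sh-cong : ∀ j {f h} → (∀ n → f n ≡ h n) → ∀ n → sh j f n ≡ sh j h n
  sh-cong zero e = e
  sh-cong (suc j) e = sh₁-cong (sh-cong j e)

  sh-+ : ∀ j f h n → sh j (λ i → f i + h i) n ≡ sh j f n + sh j h n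
  sh-+ zero f h n = refl
  sh-+ (suc j) f h zero = sym (+-identityˡ 0ℚ)
  sh-+ (suc j) f h (suc n) = sh-+ j f h n

  sh-* : ∀ j c f n → sh j (λ i → c * f i) n ≡ c * sh j f n
  sh-* zero c f n = refl
  sh-* (suc j) c f zero = sym (*-zeroʳ c)
  sh-* (suc j) c f (suc n) = sh-* j c f n

  sh-< : ∀ j f n → n ℕ.< j → sh j f n ≡ 0ℚ
  sh-< (suc j) f zero _ = refl
  sh-< (suc j) f (suc n) (s≤s h) = sh-< j f n h

  sh-≥ : ∀ j f n → sh j f (j ℕ.+ n) ≡ f n
  sh-≥ zero f n = refl
  sh-≥ (suc j) f n = sh-≥ j f n

  sh-zero : ∀ j f n → (∀ i → i ℕ.≤ n → f i ≡ 0ℚ) → sh j f n ≡ 0ℚ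
  sh-zero zero f n h = h n ℕₚ.≤-refl
  sh-zero (suc j) f zero h = refl
  sh-zero (suc j) f (suc n) h = sh-zero j f n λ i i≤n → h i (ℕₚ.m≤n⇒m≤1+n i≤n)

  -- Replaces cancelling the invertible series `1 - c q^(m + 1)`; the coefficients vanish one after
  -- another from the lowest.
  fixed-zero : ∀ c m f → (∀ n → f n ≡ c * sh (suc m) f n) → ∀ n → f n ≡ 0ℚ
  fixed-zero c m f h n = go (suc n) n ℕₚ.≤-refl
    where
    go : ∀ N n → n ℕ.< N → f n ≡ 0ℚ
    go (suc N) zero _ = trans (h 0) (*-zeroʳ c)
    go (suc N) (suc n) (s≤s n<N) = trans (h (suc n)) (trans (cong (c *_) (sh-zero m f n λ i i≤n → go N i (ℕₚ.≤-<-trans i≤n n<N))) (*-zeroʳ c))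

  -- Products of power series and the operator `q d/dq`.

  conv : (ℕ → ℚ) → (ℕ → ℚ) → ℕ → ℚ
  conv f h n = sum (suc n) (λ i → f i * h (n ∸ i))

  conv-+ˡ : ∀ f f′ h n → conv (λ i → f i + f′ i) h n ≡ conv f h n + conv f′ h n
  conv-+ˡ f f′ h n = trans (sum-cong (suc n) λ i _ → *-distribʳ-+ (h (n ∸ i)) (f i) (f′ i)) (sum-+ (suc n) (λ i → f i * h (n ∸ i)) (λ i → f′ i * h (n ∸ i)))

  conv-+ʳ : ∀ f h h′ n → conv f (λ i → h i + h′ i) n ≡ conv f h n + conv f h′ n
  conv-+ʳ f h h′ n = trans (sum-cong (suc n) λ i _ → *-distribˡ-+ (f i) (h (n ∸ i)) (h′ (n ∸ i))) (sum-+ (suc n) (λ i → f i * h (n ∸ i)) (λ i → f i * h′ (n ∸ i)))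

  conv-*ˡ : ∀ c f h n → conv (λ i → c * f i) h n ≡ c * conv f h n
  conv-*ˡ c f h n = trans (sum-cong (suc n) λ i _ → *-assoc c (f i) (h (n ∸ i))) (sum-*ˡ (suc n) c (λ i → f i * h (n ∸ i)))

  conv-sh₁ˡ : ∀ f h n → conv (sh₁ f) h n ≡ sh₁ (conv f h) n
  conv-sh₁ˡ f h zero = eq (h 0)
    where
    eq : ∀ x → 0ℚ + 0ℚ * x ≡ 0ℚ
    eq = solve-∀ ringℚ
  conv-sh₁ˡ f h (suc n) = trans (sum-head (suc n) (λ i → sh₁ f i * h (suc n ∸ i))) (eq (h (suc n)) (conv f h n))
    where
    eq : ∀ x y → 0ℚ * x + y ≡ y
    eq = solve-∀ ringℚ

  conv-shˡ : ∀ j f h n → conv (sh j f) h n ≡ sh j (conv f h) n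
  conv-shˡ zero f h n = refl
  conv-shˡ (suc j) f h n = trans (conv-sh₁ˡ (sh j f) h n) (sh₁-cong (conv-shˡ j f h) n)

  conv-sh₁ʳ : ∀ f h n → conv f (sh₁ h) n ≡ sh₁ (conv f h) n
  conv-sh₁ʳ f h zero = eq (f 0)
    where
    eq : ∀ x → 0ℚ + x * 0ℚ ≡ 0ℚ
    eq = solve-∀ ringℚ
  conv-sh₁ʳ f h (suc n) = trans (cong₂ _+_ (sum-cong (suc n) λ i i<1+n → cong (λ z → f i * sh₁ h z) (ℕₚ.+-∸-assoc 1 (ℕₚ.≤-pred i<1+n))) (cong (λ z → f (suc n) * sh₁ h z) (ℕₚ.n∸n≡0 n))) (eq (conv f h n) (f (suc n)))
    where
    eq : ∀ x y → x + y * 0ℚ ≡ x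
    eq = solve-∀ ringℚ

  conv-shʳ : ∀ j f h n → conv f (sh j h) n ≡ sh j (conv f h) n
  conv-shʳ zero f h n = refl
  conv-shʳ (suc j) f h n = trans (conv-sh₁ʳ f (sh j h) n) (sh₁-cong (conv-shʳ j f h) n)

  conv-cong : ∀ {f f′ h h′} → (∀ n → f n ≡ f′ n) → (∀ n → h n ≡ h′ n) → ∀ n → conv f h n ≡ conv f′ h′ n
  conv-cong e e′ n = sum-cong (suc n) λ i _ → cong₂ _*_ (e i) (e′ (n ∸ i))

  unit : ℕ → ℚ
  unit zero = 1ℚ
  unit (suc _) = 0ℚ

  conv-unit : ∀ h n → conv unit h n ≡ h n
  conv-unit h n = trans (sum-head n (λ i → unit i * h (n ∸ i))) (trans (cong (1ℚ * h n +_) (trans (sum-*ˡ n 0ℚ (λ i → h (n ∸ suc i))) (*-zeroˡ (sum n (λ i → h (n ∸ suc i)))))) (eq (h n)))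
    where
    eq : ∀ x → 1ℚ * x + 0ℚ ≡ x
    eq = solve-∀ ringℚ

  θ : (ℕ → ℚ) → ℕ → ℚ
  θ f n = ι n * f n

  θ-sh : ∀ j f n → θ (sh j f) n ≡ sh j (θ f) n + ι j * sh j f n
  θ-sh zero f n = eq (ι n * f n) (f n)
    where
    eq : ∀ x y → x ≡ x + 0ℚ * y
    eq = solve-∀ ringℚ
  θ-sh (suc j) f zero = eq (ι (suc j))
    where
    eq : ∀ x → 0ℚ * 0ℚ ≡ 0ℚ + x * 0ℚ
    eq = solve-∀ ringℚ
  θ-sh (suc j) f (suc n) = trans (eq (ι n) (sh j f n)) (trans (cong (_+ sh j f n) (θ-sh j f n)) (eq′ (sh j (θ f) n) (ι j) (sh j f n)))
    where
    eq : ∀ x y → (x + 1ℚ) * y ≡ x * y + y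
    eq = solve-∀ ringℚ
    eq′ : ∀ x y z → x + y * z + z ≡ x + (y + 1ℚ) * z
    eq′ = solve-∀ ringℚ

  -- mult m r b is the indicator of the multiples r + j(m+1), where j is even if b and odd otherwise.
  mult : ℕ → ℕ → Bool → ℕ → ℚ
  mult m zero b zero = if b then 1ℚ else 0ℚ
  mult m (suc r) b zero = 0ℚ
  mult m zero b (suc n) = mult m m (not b) n
  mult m (suc r) b (suc n) = mult m r b n

  mult-sh : ∀ m r b n → mult m r b n ≡ sh r (mult m 0 b) n
  mult-sh m zero b n = refl
  mult-sh m (suc r) b zero = refl
  mult-sh m (suc r) b (suc n) = mult-sh m r b n

  oddMult evenMult : ℕ → ℕ → ℚ
  oddMult m = mult m 0 false
  evenMult m = mult m 0 true

  oddMult-eq : ∀ m n → oddMult m n ≡ sh (suc m) (evenMult m) n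
  oddMult-eq m zero = refl
  oddMult-eq m (suc n) = mult-sh m m true n

  evenMult-eq : ∀ m n → evenMult m n ≡ unit n + sh (suc m) (oddMult m) n
  evenMult-eq m zero = sym (+-identityʳ 1ℚ)
  evenMult-eq m (suc n) = trans (mult-sh m m false n) (sym (+-identityˡ (sh m (oddMult m) n)))

  mult-nn : ∀ m r b n → 0ℚ ≤ mult m r b n
  mult-nn m zero true zero = 0≤1
  mult-nn m zero false zero = ≤-refl
  mult-nn m (suc r) b zero = ≤-refl
  mult-nn m zero b (suc n) = mult-nn m m (not b) n
  mult-nn m (suc r) b (suc n) = mult-nn m r b n

  -- Between two hits `r` counts down from `m` to 0, so the waiting time `r` has to be part of the
  -- inductive statement. At `r = m` the offsets cancel, and `m + 1` times the count is at most `X`.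
  mult-count : ∀ m r b X → r ℕ.≤ m → ι (suc m) * sum X (mult m r b) + ι r ≤ ι X + ι m
  mult-count m r b zero r≤m = ≤-trans (≤-reflexive (eq (ι (suc m)) (ι r))) (≤-trans (ι-mono r≤m) (≤-reflexive (sym (+-identityˡ (ι m)))))
    where
    eq : ∀ x y → x * 0ℚ + y ≡ y
    eq = solve-∀ ringℚ
  mult-count m (suc r) b (suc X) r<m = ≤-trans (≤-reflexive (trans (cong (λ z → ι (suc m) * z + ι (suc r)) (sum-head X (mult m (suc r) b))) (eq (ι (suc m)) (sum X (mult m r b)) (ι r))))
      (≤-trans (+-monoˡ-≤ 1ℚ (mult-count m r b X (ℕₚ.<⇒≤ r<m))) (≤-reflexive (eq′ (ι X) (ι m))))
    where
    eq : ∀ x y z → x * (0ℚ + y) + (z + 1ℚ) ≡ x * y + z + 1ℚ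
    eq = solve-∀ ringℚ
    eq′ : ∀ x y → x + y + 1ℚ ≡ x + 1ℚ + y
    eq′ = solve-∀ ringℚ
  mult-count m zero b (suc X) _ = ≤-trans (≤-reflexive (cong (λ z → ι (suc m) * z + 0ℚ) (sum-head X (mult m 0 b))))
      (≤-by (+-nn (-nn (mult-count m m (not b) X ℕₚ.≤-refl)) (*-nn (ι-nn (suc m)) (-nn (first b)))) (eq (ι m) (ι X) (sum X (mult m m (not b))) (mult m 0 b 0)))
    where
    first : ∀ b → mult m 0 b 0 ≤ 1ℚ
    first true = ≤-refl
    first false = 0≤1
    eq : ∀ m X s z → X + 1ℚ + m - ((m + 1ℚ) * (z + s) + 0ℚ) ≡ (X + m - ((m + 1ℚ) * s + m)) + (m + 1ℚ) * (1ℚ - z)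
    eq = solve-∀ ringℚ

  -- q d/dq of the logarithm of the generating function of overpartitions with parts at most m is Σ logDer m i qⁱ.
  logDer : ℕ → ℕ → ℚ
  logDer zero n = 0ℚ
  logDer (suc m) n = logDer m n + 2ℚ * ι (suc m) * oddMult m n

  -- The generating function for bounded parts.

  withPart-fuel : ∀ m n j → withPart m n (j ℕ.+ n) ≡ withPart m n n
  withPart-fuel m n zero = refl
  withPart-fuel m n (suc j) with suc (j ℕ.+ n) ℕ.* suc m ℕ.≤? n
  ... | yes h = ⊥-elim (ℕₚ.<-irrefl refl (ℕₚ.≤-trans (s≤s (ℕₚ.m≤n+m n j)) (ℕₚ.≤-trans (ℕₚ.m≤m*n (suc (j ℕ.+ n)) (suc m)) h)))
  ... | no _ = withPart-fuel m n j

  withPart-< : ∀ m n j → n ℕ.< suc m → withPart m n j ≡ 0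
  withPart-< m n zero h = refl
  withPart-< m n (suc j) h with suc j ℕ.* suc m ℕ.≤? n
  ... | yes le = ⊥-elim (ℕₚ.<-irrefl refl (ℕₚ.<-≤-trans h (ℕₚ.≤-trans (ℕₚ.m≤m+n (suc m) (j ℕ.* suc m)) le)))
  ... | no _ = withPart-< m n j h

  withPart-suc : ∀ m n j → withPart m (suc m ℕ.+ n) (suc j) ≡ ovBounded m n ℕ.+ withPart m n j
  withPart-suc m n zero with suc 0 ℕ.* suc m ℕ.≤? suc m ℕ.+ n
  ... | yes _ = cong (λ z → ovBounded m z ℕ.+ 0) (trans (cong (suc m ℕ.+ n ∸_) (ℕₚ.*-identityˡ (suc m))) (ℕₚ.m+n∸m≡n (suc m) n))
  ... | no h = ⊥-elim (h (ℕₚ.+-monoʳ-≤ (suc m) z≤n))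
  withPart-suc m n (suc j) with suc (suc j) ℕ.* suc m ℕ.≤? suc m ℕ.+ n | suc j ℕ.* suc m ℕ.≤? n
  ... | yes _ | yes _ = trans (cong₂ ℕ._+_ (cong (ovBounded m) (ℕₚ.[m+n]∸[m+o]≡n∸o (suc m) n (suc j ℕ.* suc m))) (withPart-suc m n j)) (swap (ovBounded m (n ∸ suc j ℕ.* suc m)) (ovBounded m n) (withPart m n j))
    where
    swap : ∀ x y z → x ℕ.+ (y ℕ.+ z) ≡ y ℕ.+ (x ℕ.+ z)
    swap x y z = trans (sym (ℕₚ.+-assoc x y z)) (trans (cong (ℕ._+ z) (ℕₚ.+-comm x y)) (ℕₚ.+-assoc y x z))
  ... | yes h | no h′ = ⊥-elim (h′ (ℕₚ.+-cancelˡ-≤ (suc m) (suc j ℕ.* suc m) n h))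
  ... | no h | yes h′ = ⊥-elim (h (ℕₚ.+-monoʳ-≤ (suc m) h′))
  ... | no _ | no _ = withPart-suc m n j

  ov : ℕ → ℕ → ℚ
  ov m n = ι (ovBounded m n)

  -- With `K = m + 1` this is `(1 - q^K) P = (1 + q^K) B` in coefficients. Splitting off
  -- multiplicity 1 from the sum over multiplicities leaves the same sum at `n - K`, which together
  -- with one of the two split-off copies of `B` makes up `P` there.
  ov-suc : ∀ m n → ov (suc m) n ≡ ov m n + (sh (suc m) (ov (suc m)) n + sh (suc m) (ov m) n)
  ov-suc m n with suc m ℕ.≤? n
  ... | no h = trans (cong ι (trans (cong (λ z → ovBounded m n ℕ.+ 2 ℕ.* z) (withPart-< m n n (ℕₚ.≰⇒> h))) (ℕₚ.+-identityʳ (ovBounded m n))))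
      (trans (eq (ov m n)) (cong₂ (λ x y → ov m n + (x + y)) (sym (sh-< (suc m) (ov (suc m)) n (ℕₚ.≰⇒> h))) (sym (sh-< (suc m) (ov m) n (ℕₚ.≰⇒> h)))))
    where
    eq : ∀ x → x ≡ x + (0ℚ + 0ℚ)
    eq = solve-∀ ringℚ
  ... | yes h = subst (λ z → ov (suc m) z ≡ ov m z + (sh (suc m) (ov (suc m)) z + sh (suc m) (ov m) z)) (ℕₚ.m+[n∸m]≡n h) (main (n ∸ suc m))
    where
    expand : ∀ n → ov (suc m) n ≡ ov m n + 2ℚ * ι (withPart m n n)
    expand n = trans (ι-+ (ovBounded m n) (2 ℕ.* withPart m n n)) (cong (ov m n +_) (ι-* 2 (withPart m n n)))
    main : ∀ n′ → ov (suc m) (suc m ℕ.+ n′) ≡ ov m (suc m ℕ.+ n′) + (sh (suc m) (ov (suc m)) (suc m ℕ.+ n′) + sh (suc m) (ov m) (suc m ℕ.+ n′))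
    main n′ = begin
      ov (suc m) N ≡⟨ expand N ⟩
      ov m N + 2ℚ * ι (withPart m N N) ≡⟨ cong (λ z → ov m N + 2ℚ * ι z) (trans (withPart-suc m n′ (m ℕ.+ n′)) (cong (ovBounded m n′ ℕ.+_) (withPart-fuel m n′ m))) ⟩
      ov m N + 2ℚ * ι (ovBounded m n′ ℕ.+ withPart m n′ n′) ≡⟨ cong (λ z → ov m N + 2ℚ * z) (ι-+ (ovBounded m n′) (withPart m n′ n′)) ⟩
      ov m N + 2ℚ * (ov m n′ + ι (withPart m n′ n′)) ≡⟨ eq (ov m N) (ov m n′) (ι (withPart m n′ n′)) ⟩
      ov m N + (ov m n′ + 2ℚ * ι (withPart m n′ n′) + ov m n′) ≡⟨ cong (λ z → ov m N + (z + ov m n′)) (sym (expand n′)) ⟩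
      ov m N + (ov (suc m) n′ + ov m n′) ≡⟨ cong₂ (λ x y → ov m N + (x + y)) (sym (sh-≥ (suc m) (ov (suc m)) n′)) (sym (sh-≥ (suc m) (ov m) n′)) ⟩
      ov m N + (sh (suc m) (ov (suc m)) N + sh (suc m) (ov m) N) ∎
      where
      open ≡-Reasoning
      N = suc m ℕ.+ n′
      eq : ∀ x y z → x + 2ℚ * (y + z) ≡ x + (y + 2ℚ * z + y)
      eq = solve-∀ ringℚ

  -- For `x = q^K` the operator `q d/dq` takes the logarithm of `(1 + x) / (1 - x)` to
  -- `2 K x / (1 - x²)`, the series of odd multiples of `K` times `2 K`. The proof is this
  -- computation with denominators cleared.
  module LogDerivative (m : ℕ) (B P s : ℕ → ℚ) (P-eq : ∀ n → P n ≡ B n + (sh (suc m) P n + sh (suc m) B n)) (θB : ∀ n → θ B n ≡ conv s B n) where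
    K : ℕ
    K = suc m

    Y : ℕ → ℚ
    Y = conv (oddMult m) P

    Y-eq : ∀ n → Y n ≡ sh K P n + sh K (sh K Y) n
    Y-eq n = begin
      conv (oddMult m) P n ≡⟨ conv-cong {h = P} (oddMult-eq m) (λ _ → refl) n ⟩
      conv (sh K (evenMult m)) P n ≡⟨ conv-shˡ K (evenMult m) P n ⟩
      sh K (conv (evenMult m) P) n ≡⟨ sh-cong K (λ i → trans (conv-cong {h = P} (evenMult-eq m) (λ _ → refl) i) (trans (conv-+ˡ unit (sh K (oddMult m)) P i) (cong₂ _+_ (conv-unit P i) (conv-shˡ K (oddMult m) P i)))) n ⟩
      sh K (λ i → P i + sh K Y i) n ≡⟨ sh-+ K P (sh K Y) n ⟩
      sh K P n + sh K (sh K Y) n ∎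
      where open ≡-Reasoning

    xP-eq : ∀ n → sh K P n ≡ sh K B n + (sh K (sh K P) n + sh K (sh K B) n)
    xP-eq n = trans (sh-cong K P-eq n) (trans (sh-+ K B (λ i → sh K P i + sh K B i) n) (cong (sh K B n +_) (sh-+ K (sh K P) (sh K B) n)))

    -- `Z = 0` says `2 (1 - x) Y = x (P + B)` with `x = q^K`; it follows from `(1 + x) Z = 0`.
    Z : ℕ → ℚ
    Z n = 2ℚ * Y n + ((- 2ℚ) * sh K Y n + ((- 1ℚ) * sh K P n + (- 1ℚ) * sh K B n))

    Z-zero : ∀ n → Z n ≡ 0ℚ
    Z-zero = fixed-zero (- 1ℚ) m Z λ n → begin
      Z n ≡⟨ cong (λ a → 2ℚ * a + ((- 2ℚ) * sh K Y n + ((- 1ℚ) * sh K P n + (- 1ℚ) * sh K B n))) (Y-eq n) ⟩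
      2ℚ * (sh K P n + sh K (sh K Y) n) + ((- 2ℚ) * sh K Y n + ((- 1ℚ) * sh K P n + (- 1ℚ) * sh K B n)) ≡⟨ eq₁ (sh K P n) (sh K (sh K Y) n) (sh K Y n) (sh K B n) ⟩
      sh K P n + (2ℚ * sh K (sh K Y) n + ((- 2ℚ) * sh K Y n + (- 1ℚ) * sh K B n)) ≡⟨ cong (_+ (2ℚ * sh K (sh K Y) n + ((- 2ℚ) * sh K Y n + (- 1ℚ) * sh K B n))) (xP-eq n) ⟩
      sh K B n + (sh K (sh K P) n + sh K (sh K B) n) + (2ℚ * sh K (sh K Y) n + ((- 2ℚ) * sh K Y n + (- 1ℚ) * sh K B n)) ≡⟨ eq₂ (sh K B n) (sh K (sh K P) n) (sh K (sh K B) n) (sh K (sh K Y) n) (sh K Y n) ⟩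
      (- 1ℚ) * (2ℚ * sh K Y n + ((- 2ℚ) * sh K (sh K Y) n + ((- 1ℚ) * sh K (sh K P) n + (- 1ℚ) * sh K (sh K B) n))) ≡⟨ cong ((- 1ℚ) *_) (sym (xZ n)) ⟩
      (- 1ℚ) * sh K Z n ∎
      where
      open ≡-Reasoning
      eq₁ : ∀ p y₂ y₁ b → 2ℚ * (p + y₂) + ((- 2ℚ) * y₁ + ((- 1ℚ) * p + (- 1ℚ) * b)) ≡ p + (2ℚ * y₂ + ((- 2ℚ) * y₁ + (- 1ℚ) * b))
      eq₁ = solve-∀ ringℚ
      eq₂ : ∀ b p₂ b₂ y₂ y₁ → b + (p₂ + b₂) + (2ℚ * y₂ + ((- 2ℚ) * y₁ + (- 1ℚ) * b)) ≡ (- 1ℚ) * (2ℚ * y₁ + ((- 2ℚ) * y₂ + ((- 1ℚ) * p₂ + (- 1ℚ) * b₂)))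
      eq₂ = solve-∀ ringℚ
      xZ : ∀ n → sh K Z n ≡ 2ℚ * sh K Y n + ((- 2ℚ) * sh K (sh K Y) n + ((- 1ℚ) * sh K (sh K P) n + (- 1ℚ) * sh K (sh K B) n))
      xZ n = trans (sh-+ K (λ i → 2ℚ * Y i) _ n) (cong₂ _+_ (sh-* K 2ℚ Y n) (trans (sh-+ K (λ i → (- 2ℚ) * sh K Y i) _ n) (cong₂ _+_ (sh-* K (- 2ℚ) (sh K Y) n) (trans (sh-+ K (λ i → (- 1ℚ) * sh K P i) _ n) (cong₂ _+_ (sh-* K (- 1ℚ) (sh K P) n) (sh-* K (- 1ℚ) (sh K B) n))))))

    c : ℚ
    c = 2ℚ * ι K

    -- `F = 0` is the claim. Applying `q d/dq` to `P-eq` gives `(1 - x) F = - K Z`, so `Z-zero`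
    -- leaves a case of `fixed-zero`.
    F : ℕ → ℚ
    F n = θ P n + ((- 1ℚ) * conv s P n + (- c) * Y n)

    F-zero : ∀ n → F n ≡ 0ℚ
    F-zero = fixed-zero 1ℚ m F λ n → begin
      ι n * P n + ((- 1ℚ) * conv s P n + (- c) * Y n) ≡⟨ cong₂ (λ a b → a + ((- 1ℚ) * b + (- c) * Y n)) (θP n) (sP n) ⟩
      θ B n + (sh K (θ P) n + ι K * sh K P n + (sh K (θ B) n + ι K * sh K B n)) + ((- 1ℚ) * (conv s B n + (sh K (conv s P) n + sh K (conv s B) n)) + (- c) * Y n)
        ≡⟨ cong₂ (λ a b → a + (sh K (θ P) n + ι K * sh K P n + (b + ι K * sh K B n)) + ((- 1ℚ) * (conv s B n + (sh K (conv s P) n + sh K (conv s B) n)) + (- c) * Y n)) (θB n) (sh-cong K θB n) ⟩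
      conv s B n + (sh K (θ P) n + ι K * sh K P n + (sh K (conv s B) n + ι K * sh K B n)) + ((- 1ℚ) * (conv s B n + (sh K (conv s P) n + sh K (conv s B) n)) + (- c) * Y n)
        ≡⟨ eq (conv s B n) (sh K (θ P) n) (ι K) (sh K P n) (sh K (conv s B) n) (sh K B n) (sh K (conv s P) n) (Y n) (sh K Y n) ⟩
      1ℚ * (sh K (θ P) n + ((- 1ℚ) * sh K (conv s P) n + (- c) * sh K Y n)) + (- ι K) * Z n ≡⟨ cong (λ z → 1ℚ * (sh K (θ P) n + ((- 1ℚ) * sh K (conv s P) n + (- c) * sh K Y n)) + (- ι K) * z) (Z-zero n) ⟩
      1ℚ * (sh K (θ P) n + ((- 1ℚ) * sh K (conv s P) n + (- c) * sh K Y n)) + (- ι K) * 0ℚ ≡⟨ eq′ (1ℚ * (sh K (θ P) n + ((- 1ℚ) * sh K (conv s P) n + (- c) * sh K Y n))) (- ι K) ⟩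
      1ℚ * (sh K (θ P) n + ((- 1ℚ) * sh K (conv s P) n + (- c) * sh K Y n)) ≡⟨ cong (1ℚ *_) (sym (xF n)) ⟩
      1ℚ * sh K F n ∎
      where
      open ≡-Reasoning
      eq′ : ∀ x y → x + y * 0ℚ ≡ x
      eq′ = solve-∀ ringℚ
      eq : ∀ sB xθP k xP xsB xB xsP Y xY → sB + (xθP + k * xP + (xsB + k * xB)) + ((- 1ℚ) * (sB + (xsP + xsB)) + (- (2ℚ * k)) * Y)
         ≡ 1ℚ * (xθP + ((- 1ℚ) * xsP + (- (2ℚ * k)) * xY)) + (- k) * (2ℚ * Y + ((- 2ℚ) * xY + ((- 1ℚ) * xP + (- 1ℚ) * xB)))
      eq = solve-∀ ringℚ
      θP : ∀ n → θ P n ≡ θ B n + (sh K (θ P) n + ι K * sh K P n + (sh K (θ B) n + ι K * sh K B n))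
      θP n = trans (cong (ι n *_) (P-eq n)) (trans (eq″ (ι n) (B n) (sh K P n) (sh K B n)) (cong₂ (λ x y → θ B n + (x + y)) (θ-sh K P n) (θ-sh K B n)))
        where
        eq″ : ∀ i b p q → i * (b + (p + q)) ≡ i * b + (i * p + i * q)
        eq″ = solve-∀ ringℚ
      sP : ∀ n → conv s P n ≡ conv s B n + (sh K (conv s P) n + sh K (conv s B) n)
      sP n = trans (conv-cong {s} (λ _ → refl) P-eq n) (trans (conv-+ʳ s B (λ i → sh K P i + sh K B i) n) (cong (conv s B n +_) (trans (conv-+ʳ s (sh K P) (sh K B) n) (cong₂ _+_ (conv-shʳ K s P n) (conv-shʳ K s B n)))))
      xF : ∀ n → sh K F n ≡ sh K (θ P) n + ((- 1ℚ) * sh K (conv s P) n + (- c) * sh K Y n)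
      xF n = trans (sh-+ K (θ P) _ n) (cong (sh K (θ P) n +_) (trans (sh-+ K (λ i → (- 1ℚ) * conv s P i) _ n) (cong₂ _+_ (sh-* K (- 1ℚ) (conv s P) n) (sh-* K (- c) Y n))))

    result : ∀ n → θ P n ≡ conv (λ i → s i + c * oddMult m i) P n
    result n = begin
      θ P n ≡⟨ eq (θ P n) (conv s P n) c (Y n) ⟩
      F n + (conv s P n + c * Y n) ≡⟨ cong (_+ (conv s P n + c * Y n)) (F-zero n) ⟩
      0ℚ + (conv s P n + c * Y n) ≡⟨ +-identityˡ (conv s P n + c * Y n) ⟩
      conv s P n + c * Y n ≡⟨ cong (conv s P n +_) (sym (conv-*ˡ c (oddMult m) P n)) ⟩
      conv s P n + conv (λ i → c * oddMult m i) P n ≡⟨ sym (conv-+ˡ s (λ i → c * oddMult m i) P n) ⟩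
      conv (λ i → s i + c * oddMult m i) P n ∎
      where
      open ≡-Reasoning
      eq : ∀ a b c y → a ≡ a + ((- 1ℚ) * b + (- c) * y) + (b + c * y)
      eq = solve-∀ ringℚ

  θ-ov : ∀ m n → θ (ov m) n ≡ conv (logDer m) (ov m) n
  θ-ov zero n = trans (base n) (sym (trans (sum-*ˡ (suc n) 0ℚ (λ i → ov 0 (n ∸ i))) (*-zeroˡ (sum (suc n) (λ i → ov 0 (n ∸ i))))))
    where
    base : ∀ n → θ (ov 0) n ≡ 0ℚ
    base zero = *-zeroˡ (ov 0 0)
    base (suc n) = *-zeroʳ (ι (suc n))
  θ-ov (suc m) = LogDerivative.result m (ov m) (ov (suc m)) (logDer m) (ov-suc m) (θ-ov m)

  -- Removing the bound on the parts.

  ov-stable : ∀ j n → ov (j ℕ.+ n) n ≡ ov n n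
  ov-stable zero n = refl
  ov-stable (suc j) n = trans (ov-suc (j ℕ.+ n) n) (trans (cong₂ (λ x y → ov (j ℕ.+ n) n + (x + y)) (sh-< (suc (j ℕ.+ n)) (ov (suc (j ℕ.+ n))) n n<) (sh-< (suc (j ℕ.+ n)) (ov (j ℕ.+ n)) n n<)) (trans (eq (ov (j ℕ.+ n) n)) (ov-stable j n)))
    where
    n< : n ℕ.< suc (j ℕ.+ n)
    n< = s≤s (ℕₚ.m≤n+m n j)
    eq : ∀ x → x + (0ℚ + 0ℚ) ≡ x
    eq = solve-∀ ringℚ

  oddMult-< : ∀ m n → n ℕ.< suc m → oddMult m n ≡ 0ℚ
  oddMult-< m n h = trans (oddMult-eq m n) (sh-< (suc m) (evenMult m) n h)

  logDer-stable : ∀ j n → logDer (j ℕ.+ n) n ≡ logDer n n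
  logDer-stable zero n = refl
  logDer-stable (suc j) n = trans (cong (λ z → logDer (j ℕ.+ n) n + 2ℚ * ι (suc (j ℕ.+ n)) * z) (oddMult-< (j ℕ.+ n) n (s≤s (ℕₚ.m≤n+m n j)))) (trans (eq (logDer (j ℕ.+ n) n) (2ℚ * ι (suc (j ℕ.+ n)))) (logDer-stable j n))
    where
    eq : ∀ x y → x + y * 0ℚ ≡ x
    eq = solve-∀ ringℚ

  logDer-top : ∀ {n N} → n ℕ.≤ N → logDer N n ≡ logDer n n
  logDer-top {n} {N} h = trans (cong (λ z → logDer z n) (sym (ℕₚ.m∸n+n≡m h))) (logDer-stable (N ∸ n) n)

  logDer-0 : ∀ m → logDer m 0 ≡ 0ℚ
  logDer-0 m = trans (cong (λ z → logDer z 0) (sym (ℕₚ.+-identityʳ m))) (logDer-stable m 0)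

  logDer-nn : ∀ m n → 0ℚ ≤ logDer m n
  logDer-nn zero n = ≤-refl
  logDer-nn (suc m) n = +-nn (logDer-nn m n) (*-nn (*-nn 0≤2 (ι-nn (suc m))) (mult-nn m 0 false n))

  -- `overσ i` is twice the sum of the divisors `d` of `i + 1` with odd cofactor `(i + 1) / d`; by
  -- `logDer-stable` larger part sizes would add nothing.
  overA overσ : ℕ → ℚ
  overA n = ι (overpartition n)
  overσ i = logDer (suc i) (suc i)

  over-rec : ∀ n → ι n * overA n ≡ sum n (λ i → overσ i * overA (n ∸ suc i))
  over-rec n = begin
    θ (ov n) n ≡⟨ θ-ov n n ⟩
    conv (logDer n) (ov n) n ≡⟨ sum-head n (λ i → logDer n i * ov n (n ∸ i)) ⟩
    logDer n 0 * ov n n + sum n (λ i → logDer n (suc i) * ov n (n ∸ suc i)) ≡⟨ cong₂ _+_ (trans (cong (_* ov n n) (logDer-0 n)) (*-zeroˡ (ov n n)))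
        (sum-cong n λ i i<n → cong₂ _*_ (logDer-top i<n) (trans (cong (λ z → ov z (n ∸ suc i)) (sym (ℕₚ.m+[n∸m]≡n i<n))) (ov-stable (suc i) (n ∸ suc i)))) ⟩
    0ℚ + sum n (λ i → overσ i * overA (n ∸ suc i)) ≡⟨ +-identityˡ (sum n (λ i → overσ i * overA (n ∸ suc i))) ⟩
    sum n (λ i → overσ i * overA (n ∸ suc i)) ∎
    where open ≡-Reasoning

  over-σ-low : ∀ i → 2ℚ * ι (suc i) ≤ overσ i
  over-σ-low i = ≤-trans (≤-reflexive (sym (trans (cong (2ℚ * ι (suc i) *_) one) (*-identityʳ (2ℚ * ι (suc i)))))) (q≤p+q (logDer-nn i (suc i)))
    where
    one : oddMult i (suc i) ≡ 1ℚ
    one = trans (oddMult-eq i (suc i)) (trans (cong (sh (suc i) (evenMult i)) (sym (ℕₚ.+-identityʳ (suc i)))) (sh-≥ (suc i) (evenMult i) 0))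

  -- Sum over part sizes first: each size `j ≤ X` contributes `2 j` for at most `X / j` multiples,
  -- hence at most `2 X`.
  over-σ-sum : ∀ X → sum X overσ ≤ 2ℚ * (ι X * ι X)
  over-σ-sum X = ≤-trans (≤-reflexive (sum-cong X λ i i<X → sym (logDer-top i<X))) (≤-trans (go X X) (≤-reflexive (eq (ι X))))
    where
    eq : ∀ x → 2ℚ * x * x ≡ 2ℚ * (x * x)
    eq = solve-∀ ringℚ
    go : ∀ m X → sum X (λ i → logDer m (suc i)) ≤ 2ℚ * ι X * ι m
    go zero X = ≤-reflexive (trans (sum-const X 0ℚ) (trans (*-zeroʳ (ι X)) (sym (*-zeroʳ (2ℚ * ι X)))))
    go (suc m) X = begin
      sum X (λ i → logDer m (suc i) + 2ℚ * ι (suc m) * oddMult m (suc i)) ≡⟨ trans (sum-+ X (λ i → logDer m (suc i)) (λ i → 2ℚ * ι (suc m) * oddMult m (suc i))) (cong (sum X (λ i → logDer m (suc i)) +_) (sum-*ˡ X (2ℚ * ι (suc m)) (mult m m true))) ⟩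
      sum X (λ i → logDer m (suc i)) + 2ℚ * ι (suc m) * sum X (mult m m true) ≤⟨ +-mono-≤ (go m X) (≤-by (*-nn 0≤2 (-nn (mult-count m m true X ℕₚ.≤-refl))) (eq₁ (ι X) (ι m) (sum X (mult m m true)))) ⟩
      2ℚ * ι X * ι m + 2ℚ * ι X ≡⟨ eq₂ (ι X) (ι m) ⟩
      2ℚ * ι X * ι (suc m) ∎
      where
      open ≤-Reasoning
      eq₁ : ∀ x m s → 2ℚ * x - 2ℚ * (m + 1ℚ) * s ≡ 2ℚ * (x + m - ((m + 1ℚ) * s + m))
      eq₁ = solve-∀ ringℚ
      eq₂ : ∀ x m → 2ℚ * x * m + 2ℚ * x ≡ 2ℚ * x * (m + 1ℚ)
      eq₂ = solve-∀ ringℚ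

  -- Monotonicity of the counts.

  withPart-mono : ∀ m n j → (∀ i → ovBounded m i ℕ.≤ ovBounded m (suc i)) → withPart m n j ℕ.≤ withPart m (suc n) j
  withPart-mono m n zero h = z≤n
  withPart-mono m n (suc j) h with suc j ℕ.* suc m ℕ.≤? n | suc j ℕ.* suc m ℕ.≤? suc n
  ... | yes p | yes _ = ℕₚ.+-mono-≤ (subst (λ z → ovBounded m (n ∸ suc j ℕ.* suc m) ℕ.≤ ovBounded m z) (sym (ℕₚ.+-∸-assoc 1 p)) (h (n ∸ suc j ℕ.* suc m))) (withPart-mono m n j h)
  ... | yes p | no ¬p = ⊥-elim (¬p (ℕₚ.m≤n⇒m≤1+n p))
  ... | no _ | yes _ = ℕₚ.≤-trans (withPart-mono m n j h) (ℕₚ.m≤n+m _ _)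
  ... | no _ | no _ = withPart-mono m n j h

  withPart-grow : ∀ m n j → withPart m n j ℕ.≤ withPart m n (suc j)
  withPart-grow m n j with suc j ℕ.* suc m ℕ.≤? n
  ... | yes _ = ℕₚ.m≤n+m _ _
  ... | no _ = ℕₚ.≤-refl

  -- False without the part size 1, hence `suc m`. In the base case `ov-suc` exhibits the count at
  -- `n` as a summand of the count at `suc n`.
  ovBounded-mono : ∀ m n → ovBounded (suc m) n ℕ.≤ ovBounded (suc m) (suc n)
  ovBounded-mono zero n = ι-reflect (≤-trans (≤-trans (p≤p+q (ι-nn (ovBounded 0 n))) (q≤p+q (ι-nn (ovBounded 0 (suc n))))) (≤-reflexive (sym (ov-suc 0 (suc n)))))
  ovBounded-mono (suc m) n = ℕₚ.+-mono-≤ (ovBounded-mono m n) (ℕₚ.*-monoʳ-≤ 2 (ℕₚ.≤-trans (withPart-mono (suc m) n n (ovBounded-mono m)) (withPart-grow (suc m) (suc n) n)))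

  over-step : ∀ n → overA n ≤ overA (suc n)
  over-step n = ≤-trans (≤-reflexive (sym (ov-stable 1 n))) (ι-mono (ovBounded-mono n n))

  over-renewal : Renewal
  over-renewal = record
    { a = overA ; σ = overσ ; a0 = +-identityˡ 1ℚ ; a-step = over-step ; rec = over-rec ; σ-low = over-σ-low ; σ-sum = over-σ-sum }

  -- Return to integer sequences.

  fromℤ-L : ∀ j (b : ℕ → ℤ.ℤ) n → fromℤ (Lhat^ j b n) ≡ Lℚ^ j (λ i → fromℤ (b i)) n
  fromℤ-L zero b n = refl
  fromℤ-L (suc j) b n = trans (hom (Lhat^ j b (suc n)) (Lhat^ j b n) (Lhat^ j b (suc (suc n)))) (Lℚ-cong (fromℤ-L j b) n)
    where
    hom : ∀ x y z → fromℤ (x ℤ.* x ℤ.- y ℤ.* z) ≡ fromℤ x * fromℤ x - fromℤ y * fromℤ z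
    hom x y z = trans (fromℤ-+ (x ℤ.* x) (ℤ.- (y ℤ.* z))) (cong₂ _+_ (fromℤ-* x x) (trans (fromℤ-neg (y ℤ.* z)) (cong -_ (fromℤ-* y z))))

  eventually-nonneg : (r : ℕ) →
      ∃[ N ] (1 ℕ.≤ N × ((k : ℕ) → 1 ℕ.≤ k → k ℕ.≤ r → (n : ℕ) → ℤ.+ 0 ℤ.≤ Lhat^ k (overpartitionFrom N) n))
  eventually-nonneg r = N , s≤s z≤n , λ k _ k≤r n → fromℤ-nn _ (subst (0ℚ ≤_)
      (sym (trans (fromℤ-L k (overpartitionFrom N) n) (trans (Lℚ^-cong k (λ i → trans (sym (ι≡fromℤ (overpartition (N ℕ.+ i)))) (cong overA (ℕₚ.+-comm N i))) n) (Lℚ^-shift k overA N n))))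
      (proj₂ res k k≤r (n ℕ.+ N) (ℕₚ.≤-trans (ℕₚ.n≤1+n (proj₁ res)) (ℕₚ.m≤n+m N n))))
    where
    res : ∃[ N ] (∀ i → i ℕ.≤ r → ∀ n → N ℕ.≤ n → 0ℚ ≤ Lℚ^ i overA n)
    res = Analysis.asymptotically-log-concave over-renewal r
    N : ℕ
    N = suc (proj₁ res)


open import Data.Nat using (ℕ; _≤_)
open import Data.Integer using (ℤ; +_) renaming (_≤_ to _≤ℤ_)
open import Data.Product using (∃-syntax; _×_)

theorem1p2 : (r : ℕ) → 1 ≤ r →
    ∃[ N ] (1 ≤ N × ((k : ℕ) → 1 ≤ k → k ≤ r → (n : ℕ) → + 0 ≤ℤ Lhat^ k (overpartitionFrom N) n))
theorem1p2 r _ = Overpartitions.eventually-nonneg r
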